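{- The following data define a $*$-autonomous category (with coherent graphs considered up to $\equiv$): (i) objects are conducts; (ii) a morphism from $\mathbf{A}$ to $\mathbf{B}$ is an ($\equiv$-class of a) coherent graph belonging to the conduct $\iota_0(\mathbf{A}) \multimap \iota_1(\mathbf{B})$ on the vertex set $V(\mathbf{A}) + V(\mathbf{B})$, where $\iota_0,\iota_1$ rename vertices by the two coproduct injections; (iii) the composite of $F : \mathbf{A} \to \mathbf{B}$ and $G : \mathbf{B} \to \mathbf{C}$ is given by execution: rename the vertices so that the copy of $V(\mathbf{B})$ in $F$ is identified with the copy of $V(\mathbf{B})$ in $G$, while the copies of $V(\mathbf{A})$, $V(\mathbf{B})$, $V(\mathbf{C})$ are pairwise disjoint, form the execution $F :: G$ (a graph on the copies of $V(\mathbf{A})$ and $V(\mathbf{C})$), and rename its vertices back to $V(\mathbf{A})+V(\mathbf{C})$; (iv) the monoidal product is the delocated tensor: on objects, $\iota_0(\mathbf{A}) \otimes \iota_1(\mathbf{B})$, a conduct on $V(\mathbf{A})+V(\mathbf{B})$; on morphisms, the tensor $F \otimes G$ of disjoint renamed copies, with vertices renamed accordingly; (v) the dualization is $\mathbf{A} \mapsto \mathbf{A}^{\perp}$ on objects, and on morphisms it sends $F:\mathbf{A}\to\mathbf{B}$ to the graph $\mathbf{B}^\perp\to\mathbf{A}^\perp$ obtained from $F$ by exchanging the two summands of the vertex set.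
   Context: Graphs are directed multigraphs: a vertex set $V(G)$, an edge set $E(G)$, and source and target maps $s,t:E(G)\to V(G)$ (parallel edges and loops are allowed). A coherence relation is a symmetric reflexive binary relation. A coherent graph is a graph $G$ with a coherence relation on $E(G)$. For coherent graphs, $G\equiv G'$ means $V(G)=V(G')$ and there is a bijection $E(G)\to E(G')$ preserving sources and targets and preserving and reflecting coherence. $\emptyset_V$ is the edgeless graph on $V$. Plugging: $G \mathbin{\square} H$ has vertex set $V(G)\cup V(H)$ and edge set $E(G)+E(H)$ (disjoint union, remembering the provenance of edges). Its coherence relation restricts to those of $G$ and $H$, and every edge of $G$ is coherent with every edge of $H$. A path is a sequence $v_0,e_1,v_1,\dots,e_n,v_n$ with $n\ge 1$, $s(e_i)=v_{i-1}$, $t(e_i)=v_i$; a cycle is a path with $v_n=v_0$. A path in $G\mathbin{\square}H$ is alternating if, of any two consecutive edges, exactly one is in $E(G)$; for a cycle, the last edge and the first edge also count as consecutive (so alternating cycles have positive even length). A path or cycle is coherent if its edges are pairwise coherent. Two coherent paths are mutually coherent if every edge of one is coherent with every edge of the other. Execution: $G :: H$ has vertex set the symmetric difference $V(G)\mathbin{\triangle}V(H)$, and one edge from $u$ to $v$ for each coherent alternating path from $u$ to $v$ in $G\mathbin{\square}H$ with $u,v\in V(G)\mathbin{\triangle}V(H)$; the coherence of edges is mutual coherence of paths. If $V(G)\cap V(H)=\emptyset$, write $G\otimes H$ for $G::H$ (the disjoint union, with all edges of $G$ coherent with all edges of $H$). Orthogonality: if $V(G)=V(H)$, then $G\perp H$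 means that $G\mathbin{\square}H$ contains no coherent alternating cycle. For a set $X$ of coherent graphs on a common vertex set $V$, $X^\perp=\{G : V(G)=V,\ \forall H\in X,\ G\perp H\}$. A conduct $\mathbf{A}$ on $V(\mathbf{A})$ is a set of coherent graphs with vertex set $V(\mathbf{A})$ such that $\mathbf{A}=\mathbf{A}^{\perp\perp}$. For conducts with $V(\mathbf{A})\cap V(\mathbf{B})=\emptyset$: $\mathbf{A}\otimes\mathbf{B}=\{G\otimes H : G\in\mathbf{A},H\in\mathbf{B}\}^{\perp\perp}$ and $\mathbf{A}\multimap\mathbf{B}=(\mathbf{A}\otimes\mathbf{B}^\perp)^\perp$. For a bijection (or injection onto its image) $\phi:V(\mathbf{A})\to V'$, $\phi(\mathbf{A})$ is the conduct obtained by renaming the vertices of all graphs of $\mathbf{A}$ along $\phi$ (a delocation). -}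

module Defs where

open import Level using (Level; _⊔_; suc)
open import Data.Empty using (⊥)
open import Data.List.Base using (List; []; _∷_; map)
open import Data.List.Relation.Unary.All using (All; []; _∷_)
import Data.List.Relation.Unary.All as All
import Data.List.Relation.Unary.All.Properties as All
open import Data.List.Relation.Unary.Linked using (Linked; [-]; _∷_)
import Data.List.Relation.Unary.Linked as Linked
import Data.List.Relation.Unary.Linked.Properties as Linked
open import Data.Product.Base using (Σ; _,_; _×_; proj₁; ∃-syntax; Σ-syntax)
open import Data.Sum.Base using (_⊎_; inj₁; inj₂; [_,_]; swap)
import Data.Sum.Base as Sum
open import Data.Unit.Base using (⊤)
open import Data.Unit.Polymorphic.Base using () renaming (⊤ to ⊤ₗ; tt to ttₗ)
open import Function.Base using (id) renaming (_∘_ to _∘′_)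
open import Function.Bundles using (_↔_; _⇔_; mk⇔; mk↔ₛ′; Inverse)
open import Function.Definitions using (Bijective)
open import Relation.Binary.Core using (Rel)
open import Relation.Binary.Definitions using (Reflexive; Symmetric; Irrelevant)
open import Relation.Binary.Structures using (IsEquivalence)
open import Relation.Binary.PropositionalEquality using (_≡_; refl; sym; trans; cong; subst)
open import Relation.Nullary.Negation using (¬_)
open import Relation.Unary using (Pred; _∈_; _⊆_; _≐_)

-- A relation on edges is a subset of E × E, hence proposition-valued: this is
-- `≍-irrelevant`.  It ensures that the execution below has exactly one edge
-- for each coherent alternating path.

record CohGraph {ℓ} (V : Set ℓ) : Set (suc ℓ) where
  field
    E            : Set ℓ
    s t          : E → V
    _≍_          : Rel E ℓ
    ≍-refl       : Reflexive _≍_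
    ≍-sym        : Symmetric _≍_
    ≍-irrelevant : Irrelevant _≍_

  _≍*_ : Rel (List E) ℓ
  es ≍* es′ = All (λ e → All (e ≍_) es′) es

  ≍*-sym : Symmetric _≍*_
  ≍*-sym c = All.tabulate λ e′∈ → All.tabulate λ e∈ →
    ≍-sym (All.lookup (All.lookup c e∈) e′∈)

  ≍*-irrelevant : Irrelevant _≍*_
  ≍*-irrelevant = All.irrelevant (All.irrelevant ≍-irrelevant)

open CohGraph using (E)

infix 4 _≅_

-- The relation written ≡ on paper.
record _≅_ {ℓ} {V : Set ℓ} (G H : CohGraph V) : Set ℓ where
  private
    module G = CohGraph G
    module H = CohGraph H
  field
    edges↔ : G.E ↔ H.E
  open Inverse edges↔ public using (to; from)
  field
    s-≡ : ∀ e → H.s (to e) ≡ G.s e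
    t-≡ : ∀ e → H.t (to e) ≡ G.t e
    ≍-⇔ : ∀ e e′ → (e G.≍ e′) ⇔ (to e H.≍ to e′)

-- For injective φ this renames the vertices and adds those outside the image
-- of φ as isolated vertices.
rename : ∀ {ℓ} {V W : Set ℓ} → (V → W) → CohGraph V → CohGraph W
rename φ G = record
  { E            = G.E
  ; s            = φ ∘′ G.s
  ; t            = φ ∘′ G.t
  ; _≍_          = G._≍_
  ; ≍-refl       = G.≍-refl
  ; ≍-sym        = G.≍-sym
  ; ≍-irrelevant = G.≍-irrelevant
  }
  where module G = CohGraph G

-- Both graphs live on a common vertex set V.  If V(G) and V(H) are different,
-- both are first renamed into V = V(G) ∪ V(H).

infixl 6 _□_

_□_ : ∀ {ℓ} {V : Set ℓ} → CohGraph V → CohGraph V → CohGraph V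
_□_ {ℓ} G H = record
  { E            = G.E ⊎ H.E
  ; s            = [ G.s , H.s ]
  ; t            = [ G.t , H.t ]
  ; _≍_          = _≍_
  ; ≍-refl       = λ {e} → ≍-refl e
  ; ≍-sym        = λ {e} {e′} → ≍-sym e e′
  ; ≍-irrelevant = λ {e} {e′} → ≍-irrelevant e e′
  }
  where
  module G = CohGraph G
  module H = CohGraph H

  _≍_ : Rel (G.E ⊎ H.E) ℓ
  inj₁ e ≍ inj₁ e′ = e G.≍ e′
  inj₁ _ ≍ inj₂ _  = ⊤ₗ
  inj₂ _ ≍ inj₁ _  = ⊤ₗ
  inj₂ e ≍ inj₂ e′ = e H.≍ e′

  ≍-refl : ∀ e → e ≍ e
  ≍-refl (inj₁ _) = G.≍-refl
  ≍-refl (inj₂ _) = H.≍-refl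

  ≍-sym : ∀ e e′ → e ≍ e′ → e′ ≍ e
  ≍-sym (inj₁ _) (inj₁ _) p = G.≍-sym p
  ≍-sym (inj₁ _) (inj₂ _) _ = ttₗ
  ≍-sym (inj₂ _) (inj₁ _) _ = ttₗ
  ≍-sym (inj₂ _) (inj₂ _) p = H.≍-sym p

  ≍-irrelevant : ∀ e e′ (p q : e ≍ e′) → p ≡ q
  ≍-irrelevant (inj₁ _) (inj₁ _) p q = G.≍-irrelevant p q
  ≍-irrelevant (inj₁ _) (inj₂ _) _ _ = refl
  ≍-irrelevant (inj₂ _) (inj₁ _) _ _ = refl
  ≍-irrelevant (inj₂ _) (inj₂ _) p q = H.≍-irrelevant p q

module _ {ℓ} {V : Set ℓ} (G : CohGraph V) where
  open CohGraph G using (s; t)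

  data Path (u v : V) : Set ℓ where
    edge : ∀ e → s e ≡ u → t e ≡ v → Path u v
    step : ∀ e {w} → s e ≡ u → t e ≡ w → Path w v → Path u v

module _ {ℓ} {V : Set ℓ} {G : CohGraph V} where
  open CohGraph G using (_≍*_)

  edges : ∀ {u v} → Path G u v → List (E G)
  edges (edge e _ _)   = e ∷ []
  edges (step e _ _ p) = e ∷ edges p

  firstEdge lastEdge : ∀ {u v} → Path G u v → E G
  firstEdge (edge e _ _)   = e
  firstEdge (step e _ _ _) = e
  lastEdge (edge e _ _)   = e
  lastEdge (step _ _ _ p) = lastEdge p

  MutuallyCoherent : ∀ {u v u′ v′} → Path G u v → Path G u′ v′ → Set ℓ
  MutuallyCoherent p q = edges p ≍* edges q

  Coherent : ∀ {u v} → Path G u v → Set ℓ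
  Coherent p = MutuallyCoherent p p

-- Exactly one of two edges of G □ H is in E(G).
Alternate : ∀ {a b} {A : Set a} {B : Set b} → A ⊎ B → A ⊎ B → Set
Alternate (inj₁ _) (inj₁ _) = ⊥
Alternate (inj₁ _) (inj₂ _) = ⊤
Alternate (inj₂ _) (inj₁ _) = ⊤
Alternate (inj₂ _) (inj₂ _) = ⊥

module _ {ℓ} {V : Set ℓ} (G H : CohGraph V) where

  AlternatingPath : ∀ {u v} → Path (G □ H) u v → Set ℓ
  AlternatingPath p = Linked Alternate (edges p)

  AlternatingCycle : ∀ {v} → Path (G □ H) v v → Set ℓ
  AlternatingCycle p = AlternatingPath p × Alternate (lastEdge p) (firstEdge p)

-- `exec o G H` is G :: H when U = V(G) ∪ V(H), G and H have been renamed into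
-- U, and o : W → U is an injection with image V(G) △ V(H).

module _ {ℓ} {U W : Set ℓ} (o : W → U) (G H : CohGraph U) where

  record ExecEdge : Set ℓ where
    constructor execEdge
    field
      {src tgt}   : W
      path        : Path (G □ H) (o src) (o tgt)
      alternating : AlternatingPath G H path
      coherent    : Coherent path

  open ExecEdge

  exec : CohGraph W
  exec = record
    { E            = ExecEdge
    ; s            = src
    ; t            = tgt
    ; _≍_          = λ p q → MutuallyCoherent (path p) (path q)
    ; ≍-refl       = λ {p} → coherent p
    ; ≍-sym        = CohGraph.≍*-sym (G □ H)
    ; ≍-irrelevant = CohGraph.≍*-irrelevant (G □ H)
    }

-- F :: G for V(F) ∩ V(G) = Q: the union of the vertex sets is P ⊎ (Q ⊎ R) and
-- their symmetric difference is P ⊎ R.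

infixl 6 _∷∷_

_∷∷_ : ∀ {ℓ} {P Q R : Set ℓ} → CohGraph (P ⊎ Q) → CohGraph (Q ⊎ R) → CohGraph (P ⊎ R)
F ∷∷ G = exec (Sum.map₂ inj₂) (rename (Sum.map₂ inj₁) F) (rename inj₂ G)

infixr 7 _⊗ᴳ_

_⊗ᴳ_ : ∀ {ℓ} {V W : Set ℓ} → CohGraph V → CohGraph W → CohGraph (V ⊎ W)
G ⊗ᴳ H = rename inj₁ G □ rename inj₂ H

-- `_⊗ᴳ_` agrees with the execution of graphs with disjoint vertex sets: the
-- symmetric difference is then the whole union, and since the two graphs share
-- no vertex, alternating paths have length 1.

module _ {ℓ} {V W : Set ℓ} (G : CohGraph V) (H : CohGraph W) where
  private
    module □ = CohGraph (G ⊗ᴳ H)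
    module :: = CohGraph (exec id (rename inj₁ G) (rename inj₂ H))

    single : □.E → ::.E
    single e = execEdge (edge e refl refl) [-] ((□.≍-refl {e} ∷ []) ∷ [])

    connected⇒¬Alternate : ∀ e e′ → □.t e ≡ □.s e′ → ¬ Alternate e e′
    connected⇒¬Alternate (inj₁ _) (inj₂ _) () _
    connected⇒¬Alternate (inj₂ _) (inj₁ _) () _

    single-surjective : ∀ p → single (firstEdge (ExecEdge.path p)) ≡ p
    single-surjective (execEdge (edge e refl refl) [-] ((c ∷ []) ∷ []))
      rewrite □.≍-irrelevant {e} {e} c (□.≍-refl {e}) = refl
    single-surjective (execEdge (step e refl t≡ (edge e′ s≡ _)) (a ∷ _) _)
      with () ← connected⇒¬Alternate e e′ (trans t≡ (sym s≡)) a
    single-surjective (execEdge (step e refl t≡ (step e′ s≡ _ _)) (a ∷ _) _)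
      with () ← connected⇒¬Alternate e e′ (trans t≡ (sym s≡)) a

  ⊗ᴳ≅exec : G ⊗ᴳ H ≅ exec id (rename inj₁ G) (rename inj₂ H)
  ⊗ᴳ≅exec = record
    { edges↔ = mk↔ₛ′ single (λ p → firstEdge (ExecEdge.path p)) single-surjective (λ _ → refl)
    ; s-≡    = λ _ → refl
    ; t-≡    = λ _ → refl
    ; ≍-⇔    = λ _ _ → mk⇔ (λ c → (c ∷ []) ∷ []) (λ { ((c ∷ []) ∷ []) → c })
    }

infix 4 _⟂_

_⟂_ : ∀ {ℓ} {V : Set ℓ} → CohGraph V → CohGraph V → Set ℓ
_⟂_ {V = V} G H =
  ¬ (Σ[ v ∈ V ] Σ[ c ∈ Path (G □ H) v v ] AlternatingCycle G H c × Coherent c)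

module _ {ℓ} {V : Set ℓ} (G H : CohGraph V) where
  private
    module GH = CohGraph (G □ H)
    module HG = CohGraph (H □ G)

    swap-s : ∀ e → HG.s (swap e) ≡ GH.s e
    swap-s (inj₁ _) = refl
    swap-s (inj₂ _) = refl

    swap-t : ∀ e → HG.t (swap e) ≡ GH.t e
    swap-t (inj₁ _) = refl
    swap-t (inj₂ _) = refl

    swap-≍ : ∀ e e′ → e GH.≍ e′ → swap e HG.≍ swap e′
    swap-≍ (inj₁ _) (inj₁ _) c = c
    swap-≍ (inj₁ _) (inj₂ _) c = c
    swap-≍ (inj₂ _) (inj₁ _) c = c
    swap-≍ (inj₂ _) (inj₂ _) c = c

    swap-Alternate : ∀ (e e′ : GH.E) → Alternate e e′ → Alternate (swap e) (swap e′)
    swap-Alternate (inj₁ _) (inj₂ _) a = a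
    swap-Alternate (inj₂ _) (inj₁ _) a = a

    swapPath : ∀ {u v} → Path (G □ H) u v → Path (H □ G) u v
    swapPath (edge e s≡ t≡)   = edge (swap e) (trans (swap-s e) s≡) (trans (swap-t e) t≡)
    swapPath (step e s≡ t≡ p) = step (swap e) (trans (swap-s e) s≡) (trans (swap-t e) t≡) (swapPath p)

    edges-swapPath : ∀ {u v} (p : Path (G □ H) u v) → edges (swapPath p) ≡ map swap (edges p)
    edges-swapPath (edge _ _ _)   = refl
    edges-swapPath (step e _ _ p) = cong (swap e ∷_) (edges-swapPath p)

    first-swapPath : ∀ {u v} (p : Path (G □ H) u v) → firstEdge (swapPath p) ≡ swap (firstEdge p)
    first-swapPath (edge _ _ _)   = refl
    first-swapPath (step _ _ _ _) = refl

    last-swapPath : ∀ {u v} (p : Path (G □ H) u v) → lastEdge (swapPath p) ≡ swap (lastEdge p)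
    last-swapPath (edge _ _ _)   = refl
    last-swapPath (step _ _ _ p) = last-swapPath p

    swap-≍* : ∀ {es es′} → es GH.≍* es′ → map swap es HG.≍* map swap es′
    swap-≍* c = All.map⁺ (All.map (λ {e} c′ → All.map⁺ (All.map (λ {e′} → swap-≍ e e′) c′)) c)

  ⟂-sym : H ⟂ G → G ⟂ H
  ⟂-sym H⟂G (v , p , (alt , wrap) , coh) = H⟂G (v , swapPath p , (alt′ , wrap′) , coh′)
    where
    alt′ : AlternatingPath H G (swapPath p)
    alt′ = subst (Linked Alternate) (sym (edges-swapPath p))
      (Linked.map⁺ (Linked.map (λ {e} {e′} → swap-Alternate e e′) alt))

    wrap′ : Alternate (lastEdge (swapPath p)) (firstEdge (swapPath p))
    wrap′ rewrite last-swapPath p | first-swapPath p = swap-Alternate (lastEdge p) (firstEdge p) wrap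

    coh′ : Coherent (swapPath p)
    coh′ = subst (λ es → es HG.≍* es) (sym (edges-swapPath p)) (swap-≍* coh)

GraphSet : ∀ {ℓ} → Set ℓ → Set (suc (suc ℓ))
GraphSet {ℓ} V = Pred (CohGraph V) (suc ℓ)

infix 9 _^⟂

_^⟂ : ∀ {ℓ} {V : Set ℓ} → GraphSet V → GraphSet V
(X ^⟂) G = ∀ {H} → H ∈ X → G ⟂ H

IsConduct : ∀ {ℓ} {V : Set ℓ} → GraphSet V → Set (suc ℓ)
IsConduct A = A ≐ A ^⟂ ^⟂

record Conduct (ℓ : Level) : Set (suc (suc ℓ)) where
  field
    V         : Set ℓ
    graphs    : GraphSet V
    isConduct : IsConduct graphs

open Conduct

⊆-^⟂^⟂ : ∀ {ℓ} {V : Set ℓ} (X : GraphSet V) → X ⊆ X ^⟂ ^⟂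
⊆-^⟂^⟂ X {G} G∈X {H} H∈X^⟂ = ⟂-sym G H (H∈X^⟂ G∈X)

^⟂-isConduct : ∀ {ℓ} {V : Set ℓ} (X : GraphSet V) → IsConduct (X ^⟂)
^⟂-isConduct X = ⊆-^⟂^⟂ (X ^⟂) , λ G∈ H∈X → G∈ (⊆-^⟂^⟂ X H∈X)

infix 9 _^⟂ᶜ

_^⟂ᶜ : ∀ {ℓ} → Conduct ℓ → Conduct ℓ
A ^⟂ᶜ = record
  { V         = V A
  ; graphs    = graphs A ^⟂
  ; isConduct = ^⟂-isConduct (graphs A)
  }

-- { G ⊗ H : G ∈ A, H ∈ B }, as a set of graphs up to ≅.
Tensors : ∀ {ℓ} (A B : Conduct ℓ) → GraphSet (V A ⊎ V B)
Tensors A B K = ∃[ G ] ∃[ H ] G ∈ graphs A × H ∈ graphs B × K ≅ G ⊗ᴳ H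

-- Delocated: on paper these are ι₀(A) ⊗ ι₁(B) and ι₀(A) ⊸ ι₁(B).
infixr 7 _⊗_
infixr 6 _⊸_

_⊗_ : ∀ {ℓ} → Conduct ℓ → Conduct ℓ → Conduct ℓ
A ⊗ B = record
  { V         = V A ⊎ V B
  ; graphs    = Tensors A B ^⟂ ^⟂
  ; isConduct = ^⟂-isConduct (Tensors A B ^⟂)
  }

_⊸_ : ∀ {ℓ} → Conduct ℓ → Conduct ℓ → Conduct ℓ
A ⊸ B = (A ⊗ B ^⟂ᶜ) ^⟂ᶜ

record RawStarCategory (o m e : Level) : Set (suc (o ⊔ m ⊔ e)) where
  infix  4 _≈_
  infixr 9 _∘_
  infixr 10 _⊗₀_ _⊗₁_
  field
    Obj  : Set o
    Hom  : Obj → Obj → Set m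
    _≈_  : ∀ {A B} → Rel (Hom A B) e
    _∘_  : ∀ {A B C} → Hom B C → Hom A B → Hom A C
    _⊗₀_ : Obj → Obj → Obj
    _⊗₁_ : ∀ {A B A′ B′} → Hom A B → Hom A′ B′ → Hom (A ⊗₀ A′) (B ⊗₀ B′)
    _*₀  : Obj → Obj
    _*₁  : ∀ {A B} → Hom A B → Hom (B *₀) (A *₀)

module _ {o m e} (R : RawStarCategory o m e) where
  open RawStarCategory R

  record IsCategory : Set (o ⊔ m ⊔ e) where
    field
      ≈-isEquivalence : ∀ {A B} → IsEquivalence (_≈_ {A} {B})
      idₘ             : ∀ {A} → Hom A A
      ∘-cong          : ∀ {A B C} {g g′ : Hom B C} {f f′ : Hom A B} →
                        g ≈ g′ → f ≈ f′ → g ∘ f ≈ g′ ∘ f′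
      identityˡ       : ∀ {A B} (f : Hom A B) → idₘ ∘ f ≈ f
      identityʳ       : ∀ {A B} (f : Hom A B) → f ∘ idₘ ≈ f
      assoc           : ∀ {A B C D} (h : Hom C D) (g : Hom B C) (f : Hom A B) →
                        (h ∘ g) ∘ f ≈ h ∘ (g ∘ f)

    record Iso (A B : Obj) : Set (m ⊔ e) where
      field
        to   : Hom A B
        from : Hom B A
        isoˡ : from ∘ to ≈ idₘ
        isoʳ : to ∘ from ≈ idₘ

  record IsSymmetricMonoidal : Set (o ⊔ m ⊔ e) where
    field
      isCategory : IsCategory
    open IsCategory isCategory public
    field
      ⊗-cong     : ∀ {A B A′ B′} {f g : Hom A B} {f′ g′ : Hom A′ B′} →
                   f ≈ g → f′ ≈ g′ → f ⊗₁ f′ ≈ g ⊗₁ g′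
      ⊗-id       : ∀ {A B} → idₘ {A} ⊗₁ idₘ {B} ≈ idₘ
      ⊗-∘        : ∀ {A B C A′ B′ C′} (g : Hom B C) (f : Hom A B)
                   (g′ : Hom B′ C′) (f′ : Hom A′ B′) →
                   (g ∘ f) ⊗₁ (g′ ∘ f′) ≈ (g ⊗₁ g′) ∘ (f ⊗₁ f′)
      unit       : Obj
      associator : ∀ A B C → Iso ((A ⊗₀ B) ⊗₀ C) (A ⊗₀ (B ⊗₀ C))
      unitorˡ    : ∀ A → Iso (unit ⊗₀ A) A
      unitorʳ    : ∀ A → Iso (A ⊗₀ unit) A
      σ          : ∀ {A B} → Hom (A ⊗₀ B) (B ⊗₀ A)

    α : ∀ {A B C} → Hom ((A ⊗₀ B) ⊗₀ C) (A ⊗₀ (B ⊗₀ C))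
    α = Iso.to (associator _ _ _)

    lam : ∀ {A} → Hom (unit ⊗₀ A) A
    lam = Iso.to (unitorˡ _)

    rho : ∀ {A} → Hom (A ⊗₀ unit) A
    rho = Iso.to (unitorʳ _)

    field
      α-natural    : ∀ {A B C A′ B′ C′} (f : Hom A A′) (g : Hom B B′) (h : Hom C C′) →
                     α ∘ ((f ⊗₁ g) ⊗₁ h) ≈ (f ⊗₁ (g ⊗₁ h)) ∘ α
      lam-natural  : ∀ {A A′} (f : Hom A A′) → lam ∘ (idₘ ⊗₁ f) ≈ f ∘ lam
      rho-natural  : ∀ {A A′} (f : Hom A A′) → rho ∘ (f ⊗₁ idₘ) ≈ f ∘ rho
      σ-natural    : ∀ {A B A′ B′} (f : Hom A A′) (g : Hom B B′) →
                     σ ∘ (f ⊗₁ g) ≈ (g ⊗₁ f) ∘ σ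
      pentagon     : ∀ {A B C D} →
                     (idₘ {A} ⊗₁ α {B} {C} {D}) ∘ (α ∘ (α ⊗₁ idₘ)) ≈ α ∘ α
      triangle     : ∀ {A B} → (idₘ {A} ⊗₁ lam {B}) ∘ α ≈ rho ⊗₁ idₘ
      hexagon      : ∀ {A B C} →
                     (idₘ {B} ⊗₁ σ {A} {C}) ∘ (α ∘ (σ ⊗₁ idₘ)) ≈ α ∘ (σ ∘ α)
      σ-involutive : ∀ {A B} → σ {B} {A} ∘ σ {A} {B} ≈ idₘ

  -- Barr's definition in terms of the dualization: a full and faithful functor
  -- * : Cᵒᵖ → C with bijections Hom (A ⊗ B) (C *) ≃ Hom A ((B ⊗ C) *), natural
  -- in A, B and C.  It yields A ≅ A * * and the internal hom (A ⊗ B *) *.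
  record IsStarAutonomous : Set (o ⊔ m ⊔ e) where
    field
      isSymmetricMonoidal : IsSymmetricMonoidal
    open IsSymmetricMonoidal isSymmetricMonoidal public
    field
      *-cong        : ∀ {A B} {f g : Hom A B} → f ≈ g → f *₁ ≈ g *₁
      *-id          : ∀ {A} → idₘ {A} *₁ ≈ idₘ
      *-∘           : ∀ {A B C} (g : Hom B C) (f : Hom A B) → (g ∘ f) *₁ ≈ f *₁ ∘ g *₁
      *-bijective   : ∀ {A B} → Bijective _≈_ _≈_ (_*₁ {A} {B})
      adj           : ∀ {A B C} → Hom (A ⊗₀ B) (C *₀) → Hom A ((B ⊗₀ C) *₀)
      adj-cong      : ∀ {A B C} {f g : Hom (A ⊗₀ B) (C *₀)} → f ≈ g → adj f ≈ adj g
      adj-bijective : ∀ {A B C} → Bijective _≈_ _≈_ (adj {A} {B} {C})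
      adj-natural   : ∀ {A B C A′ B′ C′} (f : Hom A′ A) (g : Hom B′ B) (h : Hom C′ C)
                      (k : Hom (A ⊗₀ B) (C *₀)) →
                      adj (h *₁ ∘ (k ∘ (f ⊗₁ g))) ≈ (g ⊗₁ h) *₁ ∘ (adj k ∘ f)

Morphism : ∀ {ℓ} → Conduct ℓ → Conduct ℓ → Set (suc ℓ)
Morphism A B = Σ[ F ∈ CohGraph (V A ⊎ V B) ] F ∈ graphs (A ⊸ B)

interchange : ∀ {a b c d} {A : Set a} {B : Set b} {C : Set c} {D : Set d} →
              (A ⊎ B) ⊎ (C ⊎ D) → (A ⊎ C) ⊎ (B ⊎ D)
interchange = [ Sum.map inj₁ inj₁ , Sum.map inj₂ inj₂ ]

-- That the operations on graphs send morphisms to morphisms; needed for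
-- `conducts` below to be defined at all.
record WellDefined (ℓ : Level) : Set (suc (suc ℓ)) where
  field
    ∷∷-closed : ∀ (A B C : Conduct ℓ) {F G} →
                F ∈ graphs (A ⊸ B) → G ∈ graphs (B ⊸ C) →
                F ∷∷ G ∈ graphs (A ⊸ C)
    ⊗-closed  : ∀ (A B A′ B′ : Conduct ℓ) {F G} →
                F ∈ graphs (A ⊸ B) → G ∈ graphs (A′ ⊸ B′) →
                rename interchange (F ⊗ᴳ G) ∈ graphs (A ⊗ A′ ⊸ B ⊗ B′)
    *-closed  : ∀ (A B : Conduct ℓ) {F} →
                F ∈ graphs (A ⊸ B) →
                rename swap F ∈ graphs (B ^⟂ᶜ ⊸ A ^⟂ᶜ)

conducts : ∀ {ℓ} → WellDefined ℓ → RawStarCategory (suc (suc ℓ)) (suc ℓ) ℓ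
conducts {ℓ} wd = record
  { Obj  = Conduct ℓ
  ; Hom  = Morphism
  ; _≈_  = λ F G → proj₁ F ≅ proj₁ G
  ; _∘_  = λ {A} {B} {C} (G , G∈) (F , F∈) → F ∷∷ G , ∷∷-closed A B C F∈ G∈
  ; _⊗₀_ = _⊗_
  ; _⊗₁_ = λ {A} {B} {A′} {B′} (F , F∈) (G , G∈) →
             rename interchange (F ⊗ᴳ G) , ⊗-closed A B A′ B′ F∈ G∈
  ; _*₀  = _^⟂ᶜ
  ; _*₁  = λ {A} {B} (F , F∈) → rename swap F , *-closed A B F∈
  }
  where open WellDefined wd

{-# OPTIONS --safe #-}

-- A state is a vertex together with the graph that has to provide the next edge,
-- so that alternating paths of G □ H become ordinary walks between states.  If F,
-- G and H form a chain over P ⊎ Q, Q ⊎ R and R ⊎ S, then the paths of (F ∷∷ G) □ H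
-- are those of (F ⊗ᴳ H) □ G, cut at the edges of H into blocks.  For open paths
-- this makes execution associative; for cycles it says that F ⟂ a ⊗ x if and only
-- if F ⟂ a ⊗ ∅ and x is orthogonal to the execution of a against F.  The edgeless
-- graph ∅ lies in every conduct, so this adjunction gives all the membership
-- statements.  The structural morphisms are wires along bijections of vertices:
-- composing with a wire renames vertices, which reduces the coherence laws to
-- equations between bijections.

module Submission where

open import Defs
open import Level using (Level)
open import Data.Bool.Base using (Bool; true; false; not)
open import Data.Bool.Properties using (not-involutive; not-injective)
open import Data.Empty.Polymorphic using () renaming (⊥ to ⊥ₗ; ⊥-elim to ⊥-elimₗ)
open import Data.List.Base using (List; []; _∷_; map; _++_; concatMap; length)
open import Data.Nat.Base using (suc; _≤_; s≤s)
open import Data.Nat.Properties using (≤-trans; ≤-refl; ≤-reflexive; m≤n+m)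
open import Data.List.Properties
  using (map-injective; ∷-injective; ∷-injectiveˡ; ∷-injectiveʳ; length-++; ++-identityʳ; ++-conicalˡ; ++-conicalʳ)
open import Data.List.Relation.Unary.All using (All; []; _∷_)
import Data.List.Relation.Unary.All as All
import Data.List.Relation.Unary.All.Properties as All
open import Data.List.Relation.Unary.Linked using (Linked; [-]; _∷_)
open import Data.Product.Base using (_,_; _×_; proj₁; proj₂; ∃-syntax; Σ-syntax)
open import Data.Sum.Base using (_⊎_; inj₁; inj₂; [_,_])
import Data.Sum.Base as Sum
open import Data.Sum.Algebra using (⊎-cong; ⊎-comm; ⊎-assoc)
open import Data.Unit.Polymorphic.Base using () renaming (⊤ to ⊤ₗ; tt to ttₗ)
open import Data.Sum.Properties using (inj₁-injective; inj₂-injective; swap-involutive; map-id)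
open import Function.Base using (id) renaming (_∘_ to _∘′_)
open import Function.Bundles using (_↔_; _⇔_; mk⇔; mk↔ₛ′; Inverse; Equivalence)
open import Function.Construct.Composition using (_↔-∘_)
open import Function.Construct.Identity using (↔-id)
open import Function.Construct.Symmetry using (↔-sym)
open import Function.Definitions using (Injective)
open import Relation.Binary.PropositionalEquality using (_≡_; _≢_; refl; sym; trans; cong; cong₂; subst; subst₂)
open import Relation.Unary using (_∈_)
open import Relation.Nullary.Negation using (¬_; contradiction)

open CohGraph using (E; s; t)
open Equivalence using () renaming (to to ⇒; from to ⇐)

-- Execution forgets every cycle that never meets the outer vertices, so orthogonality of `a ▷ F` to
-- `x` says less than orthogonality of `F` to `a ⊗ᴳ x`. This loss accounts for the extra condition
-- with the edgeless graph, and it shapes the membership proofs for composites, tensors and wires: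
-- the condition is discharged by passing to the other argument and making that one edgeless too,
-- where nothing is left to prove. A graph of a conduct is treated as a morphism out of the empty
-- vertex set. The adjunction is then the flattening of a chain with P and S empty, so that open
-- paths and cycles share one combinatorial analysis. A second obstacle is that edges of an
-- execution carry witnesses of alternation and coherence. These are proof-irrelevant, so such edges
-- are compared through their lists of edges, and isomorphisms between executions are built as
-- translations of lists.

private variable
  ℓ : Level
  A B C D P P′ Q Q′ R R′ S U U′ V V′ W W′ : Set ℓ

-- Isomorphisms of coherent graphs, renaming and plugging.

infix 4 _[_≍_] _[_≍*_]

_[_≍_] : (G : CohGraph V) → E G → E G → Set _
G [ e ≍ e′ ] = CohGraph._≍_ G e e′

_[_≍*_] : (G : CohGraph V) → List (E G) → List (E G) → Set _
G [ es ≍* es′ ] = CohGraph._≍*_ G es es′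

Inj : (A → B) → Set _
Inj f = Injective _≡_ _≡_ f

-- Injectivity together with chosen preimages is easier to supply than a two-sided inverse when the
-- edges are those of an execution, which are compared only through their traces.
mk≅ : {G H : CohGraph V} (f : E G → E H) → Inj f → (∀ y → ∃[ x ] f x ≡ y) →
      (∀ e → s H (f e) ≡ s G e) → (∀ e → t H (f e) ≡ t G e) →
      (∀ e e′ → G [ e ≍ e′ ] ⇔ H [ f e ≍ f e′ ]) → G ≅ H
mk≅ f inj surj s-≡ t-≡ ≍-⇔ = record
  { edges↔ = mk↔ₛ′ f (proj₁ ∘′ surj) (proj₂ ∘′ surj) (λ x → inj (proj₂ (surj (f x))))
  ; s-≡ = s-≡ ; t-≡ = t-≡ ; ≍-⇔ = ≍-⇔ }

module Iso {G H : CohGraph V} (i : G ≅ H) where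
  open _≅_ i public
  to-from : ∀ y → to (from y) ≡ y
  to-from y = Inverse.strictlyInverseˡ edges↔ y
  from-to : ∀ x → from (to x) ≡ x
  from-to x = Inverse.strictlyInverseʳ edges↔ x
  to-injective : Inj to
  to-injective {x} {y} eq = trans (sym (from-to x)) (trans (cong from eq) (from-to y))

≅-refl : {G : CohGraph V} → G ≅ G
≅-refl = mk≅ id id (λ y → y , refl) (λ _ → refl) (λ _ → refl) (λ _ _ → mk⇔ id id)

≅-sym : {G H : CohGraph V} → G ≅ H → H ≅ G
≅-sym {G = G} {H} i = mk≅ from
  (λ {x} {y} eq → trans (sym (to-from x)) (trans (cong to eq) (to-from y)))
  (λ x → to x , from-to x)
  (λ e → trans (sym (s-≡ (from e))) (cong (s H) (to-from e)))
  (λ e → trans (sym (t-≡ (from e))) (cong (t H) (to-from e)))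
  (λ e e′ → mk⇔
    (λ c → ⇐ (≍-⇔ _ _) (subst₂ (H [_≍_]) (sym (to-from e)) (sym (to-from e′)) c))
    (λ c → subst₂ (H [_≍_]) (to-from e) (to-from e′) (⇒ (≍-⇔ _ _) c)))
  where open Iso i

≅-trans : {G H K : CohGraph V} → G ≅ H → H ≅ K → G ≅ K
≅-trans {K = K} i j = mk≅ (J.to ∘′ I.to) (I.to-injective ∘′ J.to-injective)
  (λ z → I.from (J.from z) , trans (cong J.to (I.to-from _)) (J.to-from z))
  (λ e → trans (J.s-≡ _) (I.s-≡ e)) (λ e → trans (J.t-≡ _) (I.t-≡ e))
  (λ e e′ → mk⇔ (⇒ (J.≍-⇔ _ _) ∘′ ⇒ (I.≍-⇔ e e′)) (⇐ (I.≍-⇔ e e′) ∘′ ⇐ (J.≍-⇔ _ _)))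
  where
  module I = Iso i
  module J = Iso j

rename-cong : (φ : V → W) {G H : CohGraph V} → G ≅ H → rename φ G ≅ rename φ H
rename-cong φ i = record
  { edges↔ = edges↔ ; s-≡ = cong φ ∘′ s-≡ ; t-≡ = cong φ ∘′ t-≡ ; ≍-⇔ = ≍-⇔ }
  where open _≅_ i

rename-ext : {φ ψ : V → W} (G : CohGraph V) → (∀ v → φ v ≡ ψ v) → rename φ G ≅ rename ψ G
rename-ext G φ≗ψ = mk≅ id id (λ y → y , refl)
  (λ e → sym (φ≗ψ (s G e))) (λ e → sym (φ≗ψ (t G e))) (λ _ _ → mk⇔ id id)

rename-id : {φ : V → V} (G : CohGraph V) → (∀ v → φ v ≡ v) → rename φ G ≅ G
rename-id = rename-ext

□-cong : {G G′ H H′ : CohGraph V} → G ≅ G′ → H ≅ H′ → G □ H ≅ G′ □ H′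
□-cong i j = mk≅ (Sum.map I.to J.to)
  (λ { {inj₁ _} {inj₁ _} eq → cong inj₁ (I.to-injective (inj₁-injective eq))
     ; {inj₂ _} {inj₂ _} eq → cong inj₂ (J.to-injective (inj₂-injective eq)) })
  (λ { (inj₁ y) → inj₁ (I.from y) , cong inj₁ (I.to-from y)
     ; (inj₂ y) → inj₂ (J.from y) , cong inj₂ (J.to-from y) })
  (λ { (inj₁ e) → I.s-≡ e ; (inj₂ e) → J.s-≡ e })
  (λ { (inj₁ e) → I.t-≡ e ; (inj₂ e) → J.t-≡ e })
  (λ { (inj₁ e) (inj₁ e′) → I.≍-⇔ e e′ ; (inj₁ _) (inj₂ _) → mk⇔ id id
     ; (inj₂ _) (inj₁ _) → mk⇔ id id ; (inj₂ e) (inj₂ e′) → J.≍-⇔ e e′ })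
  where
  module I = Iso i
  module J = Iso j

⊗ᴳ-cong : {G G′ : CohGraph V} {H H′ : CohGraph W} → G ≅ G′ → H ≅ H′ → G ⊗ᴳ H ≅ G′ ⊗ᴳ H′
⊗ᴳ-cong i j = □-cong (rename-cong inj₁ i) (rename-cong inj₂ j)

□-comm : (G H : CohGraph V) → G □ H ≅ H □ G
□-comm G H = mk≅ Sum.swap
  (λ { {inj₁ _} {inj₁ _} refl → refl ; {inj₂ _} {inj₂ _} refl → refl })
  (λ { (inj₁ y) → inj₂ y , refl ; (inj₂ y) → inj₁ y , refl })
  (λ { (inj₁ _) → refl ; (inj₂ _) → refl })
  (λ { (inj₁ _) → refl ; (inj₂ _) → refl })
  (λ { (inj₁ _) (inj₁ _) → mk⇔ id id ; (inj₁ _) (inj₂ _) → mk⇔ id id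
     ; (inj₂ _) (inj₁ _) → mk⇔ id id ; (inj₂ _) (inj₂ _) → mk⇔ id id })

□-assoc : (G H K : CohGraph V) → (G □ H) □ K ≅ G □ (H □ K)
□-assoc G H K = mk≅ Sum.assocʳ
  (λ { {inj₁ (inj₁ _)} {inj₁ (inj₁ _)} refl → refl ; {inj₁ (inj₂ _)} {inj₁ (inj₂ _)} refl → refl
     ; {inj₂ _} {inj₂ _} refl → refl ; {inj₁ (inj₁ _)} {inj₂ _} () ; {inj₂ _} {inj₁ (inj₁ _)} () ; {inj₂ _} {inj₁ (inj₂ _)} () })
  (λ { (inj₁ y) → inj₁ (inj₁ y) , refl ; (inj₂ (inj₁ y)) → inj₁ (inj₂ y) , refl ; (inj₂ (inj₂ y)) → inj₂ y , refl })
  (λ { (inj₁ (inj₁ _)) → refl ; (inj₁ (inj₂ _)) → refl ; (inj₂ _) → refl })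
  (λ { (inj₁ (inj₁ _)) → refl ; (inj₁ (inj₂ _)) → refl ; (inj₂ _) → refl })
  (λ { (inj₁ (inj₁ _)) (inj₁ (inj₁ _)) → mk⇔ id id ; (inj₁ (inj₁ _)) (inj₁ (inj₂ _)) → mk⇔ id id
     ; (inj₁ (inj₂ _)) (inj₁ (inj₁ _)) → mk⇔ id id ; (inj₁ (inj₂ _)) (inj₁ (inj₂ _)) → mk⇔ id id
     ; (inj₁ (inj₁ _)) (inj₂ _) → mk⇔ id id ; (inj₁ (inj₂ _)) (inj₂ _) → mk⇔ id id
     ; (inj₂ _) (inj₁ (inj₁ _)) → mk⇔ id id ; (inj₂ _) (inj₁ (inj₂ _)) → mk⇔ id id
     ; (inj₂ _) (inj₂ _) → mk⇔ id id })

rename-□ : (φ : V → W) (G H : CohGraph V) → rename φ (G □ H) ≅ rename φ G □ rename φ H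
rename-□ φ G H = mk≅ id id (λ y → y , refl)
  (λ { (inj₁ _) → refl ; (inj₂ _) → refl })
  (λ { (inj₁ _) → refl ; (inj₂ _) → refl })
  (λ { (inj₁ _) (inj₁ _) → mk⇔ id id ; (inj₁ _) (inj₂ _) → mk⇔ id id
     ; (inj₂ _) (inj₁ _) → mk⇔ id id ; (inj₂ _) (inj₂ _) → mk⇔ id id })

-- Walks, and alternating paths as walks between states.

module _ {ℓ} {E X : Set ℓ} where

  -- The list of edges is an index, so mapping, concatenating and cutting lists act on walks
  -- directly. Unlike a `Path`, a walk may be empty. Vertices are joined by equations because they
  -- are mostly values of functions, on which unification would get stuck.
  data Walk (s t : E → X) : X → List E → X → Set ℓ where
    stop : ∀ {x y} → x ≡ y → Walk s t x [] y
    _∷_  : ∀ {x e es y} → s e ≡ x → Walk s t (t e) es y → Walk s t x (e ∷ es) y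

module _ {ℓ} {E X : Set ℓ} {s t : E → X} where

  _++ʷ_ : ∀ {x es y fs z} → Walk s t x es y → Walk s t y fs z → Walk s t x (es ++ fs) z
  stop refl ++ʷ q = q
  (eq ∷ p)  ++ʷ q = eq ∷ (p ++ʷ q)

  infixr 5 _++ʷ_

  recast : ∀ {x y x′ y′ es} → x ≡ x′ → y ≡ y′ → Walk s t x es y → Walk s t x′ es y′
  recast refl refl p = p

  walk-start : ∀ {x e es y} → Walk s t x (e ∷ es) y → s e ≡ x
  walk-start (eq ∷ _) = eq

  walk-end : ∀ {x es y} → es ≢ [] → Walk s t x es y → ∃[ e ] t e ≡ y
  walk-end ne (stop _) = contradiction refl ne
  walk-end {es = e ∷ []} _ (_ ∷ stop eq) = e , eq
  walk-end {es = e ∷ e′ ∷ es} _ (_ ∷ p) = walk-end (λ ()) p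

module _ {ℓ} {E X E′ X′ : Set ℓ} {s t : E → X} {s′ t′ : E′ → X′} (f : E → E′) (τ : X → X′) where

  walk-map : (∀ e → s′ (f e) ≡ τ (s e)) → (∀ e → t′ (f e) ≡ τ (t e)) →
             ∀ {x es y} → Walk s t x es y → Walk s′ t′ (τ x) (map f es) (τ y)
  walk-map s≡ t≡ (stop eq) = stop (cong τ eq)
  walk-map s≡ t≡ (_∷_ {e = e} eq p) = trans (s≡ e) (cong τ eq) ∷
    subst (λ z → Walk s′ t′ z _ _) (sym (t≡ e)) (walk-map s≡ t≡ p)

  -- A walk that starts in the image of `τ` never leaves it: the second hypothesis lifts the next
  -- edge, and the first puts its target into the image again.
  walk-lift : (∀ e → t′ (f e) ≡ τ (t e)) →
              (∀ e′ x → s′ e′ ≡ τ x → ∃[ e ] f e ≡ e′ × s e ≡ x) →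
              ∀ {x es′ y′} → Walk s′ t′ (τ x) es′ y′ →
              ∃[ es ] ∃[ y ] map f es ≡ es′ × Walk s t x es y × τ y ≡ y′
  walk-lift t≡ lift (stop eq) = [] , _ , refl , stop refl , eq
  walk-lift t≡ lift (_∷_ {e = e′} eq p) with lift e′ _ eq
  ... | e , refl , s≡ with walk-lift t≡ lift (subst (λ z → Walk s′ t′ z _ _) (t≡ e) p)
  ... | es , y , refl , q , eq′ = e ∷ es , y , refl , s≡ ∷ q , eq′

side : A ⊎ B → Bool
side (inj₁ _) = true
side (inj₂ _) = false

-- The second component of a state is the side of the next edge, true for G.
module _ {ℓ} {V : Set ℓ} (G H : CohGraph V) where

  srcᵃ tgtᵃ : E G ⊎ E H → V × Bool
  srcᵃ e = s (G □ H) e , side e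
  tgtᵃ e = t (G □ H) e , not (side e)

  AltWalk : V × Bool → List (E G ⊎ E H) → V × Bool → Set ℓ
  AltWalk = Walk srcᵃ tgtᵃ

Alternate⇒ : (x y : A ⊎ B) → Alternate x y → side y ≡ not (side x)
Alternate⇒ (inj₁ _) (inj₂ _) _ = refl
Alternate⇒ (inj₂ _) (inj₁ _) _ = refl

Alternate⇐ : (x y : A ⊎ B) → side y ≡ not (side x) → Alternate x y
Alternate⇐ (inj₁ _) (inj₂ _) _ = _
Alternate⇐ (inj₂ _) (inj₁ _) _ = _

module _ {ℓ} {V : Set ℓ} {G H : CohGraph V} where

  path⇒walk : ∀ {u v} (p : Path (G □ H) u v) → AlternatingPath G H p →
              AltWalk G H (u , side (firstEdge p)) (edges p) (v , not (side (lastEdge p)))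
  path⇒walk (edge e refl refl) _ = refl ∷ stop refl
  path⇒walk (step e refl refl (edge e′ eq refl)) (a ∷ _) =
    refl ∷ cong₂ _,_ eq (Alternate⇒ e e′ a) ∷ stop refl
  path⇒walk (step e refl refl p@(step e′ _ _ _)) (a ∷ as) =
    refl ∷ subst (λ b → AltWalk G H (_ , b) (edges p) (_ , not (side (lastEdge p)))) (Alternate⇒ e e′ a) (path⇒walk p as)

  walk⇒path : ∀ {u b e es v c} → AltWalk G H (u , b) (e ∷ es) (v , c) →
              Σ[ p ∈ Path (G □ H) u v ] edges p ≡ e ∷ es × AlternatingPath G H p ×
                side (firstEdge p) ≡ b × not (side (lastEdge p)) ≡ c
  walk⇒path {e = e} {[]} (refl ∷ stop refl) = edge e refl refl , refl , [-] , refl , refl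
  walk⇒path {e = e} {e′ ∷ es} (refl ∷ q) with walk⇒path q
  ... | edge .e′ s≡ t≡ , refl , a , b≡ , c≡ =
    step e refl refl (edge e′ s≡ t≡) , refl , Alternate⇐ e e′ b≡ ∷ a , refl , c≡
  ... | step .e′ s≡ t≡ p , refl , a , b≡ , c≡ =
    step e refl refl (step e′ s≡ t≡ p) , refl , Alternate⇐ e e′ b≡ ∷ a , refl , c≡

  edges-nonempty : ∀ {u v} (p : Path (G □ H) u v) → edges p ≢ []
  edges-nonempty (edge _ _ _) ()
  edges-nonempty (step _ _ _ _) ()

  path-≡ : ∀ {u v} (p q : Path (G □ H) u v) → edges p ≡ edges q → p ≡ q
  path-≡ (edge e refl refl) (edge .e refl refl) refl = refl
  path-≡ (edge _ _ _) (step _ _ _ q) eq = contradiction (sym (proj₂ (∷-injective eq))) (edges-nonempty q)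
  path-≡ (step _ _ _ p) (edge _ _ _) eq = contradiction (proj₂ (∷-injective eq)) (edges-nonempty p)
  path-≡ (step e refl refl p) (step e′ eq₁ eq₂ q) eq with ∷-injective eq
  path-≡ (step e refl refl p) (step .e refl refl q) eq | refl , eq′ = cong (step e refl refl) (path-≡ p q eq′)

-- Orthogonality in terms of closed walks.

module _ {ℓ} {V : Set ℓ} (G H : CohGraph V) where

  -- Returning to the same state includes the condition that the last and the first edge alternate,
  -- because a state names the side of the next edge.
  Cycle : Set ℓ
  Cycle = ∃[ x ] ∃[ es ] es ≢ [] × AltWalk G H x es x × (G □ H) [ es ≍* es ]

infix 4 _⫫_

-- A record, unlike _⟂_, so that the graphs can be inferred from the type.
record _⫫_ {ℓ} {V : Set ℓ} (G H : CohGraph V) : Set ℓ where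
  constructor acyclic
  field no-cycle : ¬ Cycle G H

open _⫫_ public

module _ {ℓ} {V : Set ℓ} {G H : CohGraph V} where

  ⫫⇒⟂ : G ⫫ H → G ⟂ H
  ⫫⇒⟂ (acyclic ¬c) (v , p , (alt , wrap) , coh) = ¬c
    ( _ , edges p , edges-nonempty p
    , recast (cong (v ,_) (Alternate⇒ (lastEdge p) _ wrap)) refl (path⇒walk p alt)
    , coh)

  ⟂⇒⫫ : G ⟂ H → G ⫫ H
  ⟂⇒⫫ G⟂H = acyclic λ
    { (x , [] , ne , _) → ne refl
    ; ((v , b) , e ∷ es , _ , w , coh) →
      let p , eq , alt , b≡ , c≡ = walk⇒path w
      in G⟂H (v , p , (alt , Alternate⇐ (lastEdge p) _ (trans b≡ (sym c≡))) ,
              subst (λ es → (G □ H) [ es ≍* es ]) (sym eq) coh) }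

-- Edges of an execution and their traces.

module _ {ℓ} {U W : Set ℓ} {o : W → U} {G H : CohGraph U} where
  open ExecEdge

  trace : ExecEdge o G H → List (E (G □ H))
  trace x = edges (path x)

  trace-walk : ∀ x → AltWalk G H (o (src x) , side (firstEdge (path x))) (trace x)
                               (o (tgt x) , not (side (lastEdge (path x))))
  trace-walk x = path⇒walk (path x) (alternating x)

  trace-nonempty : ∀ x → trace x ≢ []
  trace-nonempty x = edges-nonempty (path x)

  fromTrace : ∀ {w b es v c} → es ≢ [] → AltWalk G H (o w , b) es (o v , c) → (G □ H) [ es ≍* es ] →
              Σ[ x ∈ ExecEdge o G H ] src x ≡ w × tgt x ≡ v × trace x ≡ es
  fromTrace {es = []} ne _ _ = contradiction refl ne
  fromTrace {es = e ∷ es} ne p coh with walk⇒path p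
  ... | q , eq , alt , _ = execEdge q alt (subst (λ es → (G □ H) [ es ≍* es ]) (sym eq) coh) , refl , refl , eq

  private
    linked-irrelevant : ∀ (es : List (E G ⊎ E H)) (p q : Linked Alternate es) → p ≡ q
    linked-irrelevant _ Linked.[] Linked.[] = refl
    linked-irrelevant _ [-] [-] = refl
    linked-irrelevant (e ∷ e′ ∷ _) (a ∷ p) (a′ ∷ q) = cong₂ _∷_ (alt e e′ a a′) (linked-irrelevant _ p q)
      where
      alt : ∀ (x y : E G ⊎ E H) (a a′ : Alternate x y) → a ≡ a′
      alt (inj₁ _) (inj₂ _) _ _ = refl
      alt (inj₂ _) (inj₁ _) _ _ = refl

  start-unique : ∀ {u v u′ v′} (p : Path (G □ H) u v) (q : Path (G □ H) u′ v′) → edges p ≡ edges q → u ≡ u′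
  start-unique (edge _ refl _) (edge _ refl _) refl = refl
  start-unique (edge _ refl _) (step _ refl _ _) eq = cong (s (G □ H)) (proj₁ (∷-injective eq))
  start-unique (step _ refl _ _) (edge _ refl _) eq = cong (s (G □ H)) (proj₁ (∷-injective eq))
  start-unique (step _ refl _ _) (step _ refl _ _) eq = cong (s (G □ H)) (proj₁ (∷-injective eq))

  end-unique : ∀ {u v u′ v′} (p : Path (G □ H) u v) (q : Path (G □ H) u′ v′) → edges p ≡ edges q → v ≡ v′
  end-unique (edge _ _ refl) (edge _ _ refl) refl = refl
  end-unique (edge _ _ _) (step _ _ _ q) eq = contradiction (sym (proj₂ (∷-injective eq))) (edges-nonempty q)
  end-unique (step _ _ _ p) (edge _ _ _) eq = contradiction (proj₂ (∷-injective eq)) (edges-nonempty p)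
  end-unique (step _ _ _ p) (step _ _ _ q) eq = end-unique p q (proj₂ (∷-injective eq))

  -- The list of edges determines the path with its end points in U, injectivity of `o` recovers the
  -- end points in W, and the two remaining components are propositions.
  trace-injective : Inj o → Inj trace
  trace-injective o-inj {execEdge p a c} {execEdge q a′ c′} eq
    with o-inj (start-unique p q eq) | o-inj (end-unique p q eq)
  ... | refl | refl with path-≡ p q eq
  ... | refl rewrite linked-irrelevant _ a a′ | CohGraph.≍*-irrelevant (G □ H) c c′ = refl

module _ {ℓ} {U W U′ W′ : Set ℓ} {o : W → U} {o′ : W′ → U′} {G H : CohGraph U} {G′ H′ : CohGraph U′}
         (o-inj : Inj o) (o′-inj : Inj o′)
         (φ : W → W′) (g : List (E (G □ H)) → List (E (G′ □ H′)))
         (g-[] : g [] ≡ [])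
         (walk⁺ : ∀ {w b es v c} → es ≢ [] → AltWalk G H (o w , b) es (o v , c) →
                  g es ≢ [] × ∃[ b′ ] ∃[ c′ ] AltWalk G′ H′ (o′ (φ w) , b′) (g es) (o′ (φ v) , c′))
         (g-inj : ∀ {w b es v c w′ b′ fs v′ c′} → AltWalk G H (o w , b) es (o v , c) →
                  AltWalk G H (o w′ , b′) fs (o v′ , c′) → g es ≡ g fs → es ≡ fs)
         (walk⁻ : ∀ {w′ b′ es′ v′ c′} → AltWalk G′ H′ (o′ w′ , b′) es′ (o′ v′ , c′) → (G′ □ H′) [ es′ ≍* es′ ] →
                  ∃[ w ] ∃[ b ] ∃[ es ] ∃[ v ] ∃[ c ] AltWalk G H (o w , b) es (o v , c) × g es ≡ es′)
         (g-coh : ∀ es fs → (G □ H) [ es ≍* fs ] ⇔ (G′ □ H′) [ g es ≍* g fs ])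
         where

  private
    open ExecEdge

    image : (x : ExecEdge o G H) →
            Σ[ y ∈ ExecEdge o′ G′ H′ ] src y ≡ φ (src x) × tgt y ≡ φ (tgt x) × trace y ≡ g (trace x)
    image x with walk⁺ (trace-nonempty x) (trace-walk x)
    ... | ne , _ , _ , p = fromTrace ne p (⇒ (g-coh _ _) (coherent x))

    f : ExecEdge o G H → ExecEdge o′ G′ H′
    f x = proj₁ (image x)

    trace-f : ∀ x → trace (f x) ≡ g (trace x)
    trace-f x = proj₂ (proj₂ (proj₂ (image x)))

    f-inj : Inj f
    f-inj {x} {y} eq = trace-injective o-inj (g-inj (trace-walk x) (trace-walk y)
      (trans (sym (trace-f x)) (trans (cong trace eq) (trace-f y))))

    f-surj : ∀ y → ∃[ x ] f x ≡ y
    f-surj y with walk⁻ (trace-walk y) (coherent y)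
    ... | _ , _ , es , _ , _ , p , eq
      with fromTrace {o = o} (λ es≡[] → trace-nonempty y (trans (sym eq) (trans (cong g es≡[]) g-[]))) p
             (⇐ (g-coh es es) (subst (λ es → (G′ □ H′) [ es ≍* es ]) (sym eq) (coherent y)))
    ... | x , _ , _ , tr = x , trace-injective o′-inj (trans (trace-f x) (trans (cong g tr) eq))

  -- The translation `g` acts on whole lists so that one criterion covers renaming, where `g` is a
  -- `map`, and flattening, where it is a `concatMap`. The hypothesis `walk⁻` is given the coherence
  -- of the list because cutting a list into blocks yields edges of an execution only if the blocks
  -- are coherent.
  exec-≅ : rename φ (exec o G H) ≅ exec o′ G′ H′
  exec-≅ = mk≅ f f-inj f-surj
    (λ x → proj₁ (proj₂ (image x))) (λ x → proj₁ (proj₂ (proj₂ (image x))))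
    (λ x y → mk⇔
      (λ c → subst₂ ((G′ □ H′) [_≍*_]) (sym (trace-f x)) (sym (trace-f y)) (⇒ (g-coh _ _) c))
      (λ c → ⇐ (g-coh _ _) (subst₂ ((G′ □ H′) [_≍*_]) (trace-f x) (trace-f y) c)))

-- Transport of cycles and executions along renamings.

map-≍* : {G : CohGraph V} {H : CohGraph W} (f : E G → E H) →
         (∀ e e′ → G [ e ≍ e′ ] ⇔ H [ f e ≍ f e′ ]) →
         ∀ es es′ → G [ es ≍* es′ ] ⇔ H [ map f es ≍* map f es′ ]
map-≍* f f-coh es es′ = mk⇔
  (λ c → All.map⁺ (All.map (λ c′ → All.map⁺ (All.map (⇒ (f-coh _ _)) c′)) c))
  (λ c → All.map (λ c′ → All.map (⇐ (f-coh _ _)) (All.map⁻ c′)) (All.map⁻ c))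

map-≢[] : {f : A → B} {xs : List A} → xs ≢ [] → map f xs ≢ []
map-≢[] {xs = []} ne _ = ne refl
map-≢[] {xs = _ ∷ _} _ ()

map-≢[]⁻ : {f : A → B} {xs : List A} → map f xs ≢ [] → xs ≢ []
map-≢[]⁻ ne refl = ne refl

-- The laws of `flip` leave two possibilities, identity and negation: the isomorphism keeps the two
-- plugged graphs apart in the same way or exchanges them, uniformly over all edges. Renaming and
-- commutativity can thus be treated together.
record Plugging≅ {ℓ} {U U′ : Set ℓ} (θ : U → U′) (G H : CohGraph U) (G′ H′ : CohGraph U′) : Set ℓ where
  field
    □≅     : rename θ (G □ H) ≅ G′ □ H′
    flip   : Bool → Bool
    flip-injective : Inj flip
    flip-not : ∀ b → flip (not b) ≡ not (flip b)
    side-≡ : ∀ e → side (_≅_.to □≅ e) ≡ flip (side e)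
  open Iso □≅ public

plugging-cong : {G H : CohGraph U} {G′ H′ : CohGraph U′} (θ : U → U′) →
                rename θ G ≅ G′ → rename θ H ≅ H′ → Plugging≅ θ G H G′ H′
plugging-cong θ i j = record
  { □≅ = ≅-trans (rename-□ θ _ _) (□-cong i j)
  ; flip = id ; flip-injective = id ; flip-not = λ _ → refl
  ; side-≡ = λ { (inj₁ _) → refl ; (inj₂ _) → refl } }

plugging-comm : {G H : CohGraph U} {G′ H′ : CohGraph U′} (θ : U → U′) →
                rename θ G ≅ H′ → rename θ H ≅ G′ → Plugging≅ θ G H G′ H′
plugging-comm θ i j = record
  { □≅ = ≅-trans (rename-□ θ _ _) (≅-trans (□-comm _ _) (□-cong j i))
  ; flip = not ; flip-injective = not-injective ; flip-not = λ _ → refl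
  ; side-≡ = λ { (inj₁ _) → refl ; (inj₂ _) → refl } }

module _ {ℓ} {U U′ : Set ℓ} {θ : U → U′} {G H : CohGraph U} {G′ H′ : CohGraph U′}
         (θ-inj : Inj θ) (p : Plugging≅ θ G H G′ H′) where
  open Plugging≅ p

  private
    τ : U × Bool → U′ × Bool
    τ (u , b) = θ u , flip b

    τ-inj : Inj τ
    τ-inj eq = cong₂ _,_ (θ-inj (cong proj₁ eq)) (flip-injective (cong proj₂ eq))

    src-≡ : ∀ e → srcᵃ G′ H′ (to e) ≡ τ (srcᵃ G H e)
    src-≡ e = cong₂ _,_ (s-≡ e) (side-≡ e)

    tgt-≡ : ∀ e → tgtᵃ G′ H′ (to e) ≡ τ (tgtᵃ G H e)
    tgt-≡ e = cong₂ _,_ (t-≡ e) (trans (cong not (side-≡ e)) (sym (flip-not _)))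

    forth : ∀ {x es y} → AltWalk G H x es y → AltWalk G′ H′ (τ x) (map to es) (τ y)
    forth = walk-map to τ src-≡ tgt-≡

    back : ∀ {x es′ y′} → AltWalk G′ H′ (τ x) es′ y′ →
           ∃[ es ] ∃[ y ] map to es ≡ es′ × AltWalk G H x es y × τ y ≡ y′
    back = walk-lift to τ tgt-≡ λ e′ x eq → from e′ , to-from e′ ,
      τ-inj (trans (sym (src-≡ _)) (trans (cong (srcᵃ G′ H′) (to-from e′)) eq))

    coh : ∀ es fs → (G □ H) [ es ≍* fs ] ⇔ (G′ □ H′) [ map to es ≍* map to fs ]
    coh = map-≍* {G = G □ H} {H = G′ □ H′} to ≍-⇔

  ⫫-map⁻ : G′ ⫫ H′ → G ⫫ H
  ⫫-map⁻ G′⫫H′ = acyclic λ { (x , es , ne , w , c) →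
    no-cycle G′⫫H′ (τ x , map to es , map-≢[] ne , forth w , ⇒ (coh _ _) c) }

  ⫫-map : G ⫫ H → G′ ⫫ H′
  ⫫-map G⫫H = acyclic λ
    { (x′ , [] , ne , _) → ne refl
    ; (x′ , e′ ∷ es′ , ne , w , c) →
      -- The vertex map need not be surjective, but the start of a nonempty cycle is the source of
      -- an edge and hence in the image.
      let x    = srcᵃ G H (from e′)
          x≡   = trans (sym (walk-start w)) (trans (cong (srcᵃ G′ H′) (sym (to-from e′))) (src-≡ (from e′)))
          es , y , es≡ , w′ , y≡ = back {x} (recast x≡ refl w)
      in no-cycle G⫫H
        ( x , es , map-≢[]⁻ (λ eq → ne (trans (sym es≡) eq))
        , recast refl (τ-inj (trans y≡ x≡)) w′
        , ⇐ (coh es es) (subst (λ es → (G′ □ H′) [ es ≍* es ]) (sym es≡) c) ) }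

  module _ {W W′ : Set ℓ} {o : W → U} {o′ : W′ → U′} (o-inj : Inj o) (o′-inj : Inj o′) (φ : W ↔ W′)
           (commutes : ∀ w → o′ (Inverse.to φ w) ≡ θ (o w)) where
    private
      module φ = Inverse φ

      outer : ∀ w′ → o′ w′ ≡ θ (o (φ.from w′))
      outer w′ = trans (cong o′ (sym (φ.strictlyInverseˡ w′))) (commutes _)

      walk⁺ : ∀ {w b es v c} → es ≢ [] → AltWalk G H (o w , b) es (o v , c) →
              map to es ≢ [] × ∃[ b′ ] ∃[ c′ ] AltWalk G′ H′ (o′ (φ.to w) , b′) (map to es) (o′ (φ.to v) , c′)
      walk⁺ {w} {b} {es} {v} {c} ne p = map-≢[] ne , _ , _ ,
        recast (cong (_, flip b) (sym (commutes w))) (cong (_, flip c) (sym (commutes v))) (forth p)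

      walk⁻ : ∀ {w′ b′ es′ v′ c′} → AltWalk G′ H′ (o′ w′ , b′) es′ (o′ v′ , c′) → (G′ □ H′) [ es′ ≍* es′ ] →
              ∃[ w ] ∃[ b ] ∃[ es ] ∃[ v ] ∃[ c ] AltWalk G H (o w , b) es (o v , c) × map to es ≡ es′
      walk⁻ (stop eq) _ with o′-inj (cong proj₁ eq)
      -- No edge fixes the side of an empty walk; `true` is a default.
      walk⁻ {w′} _ _ | refl = φ.from w′ , true , [] , φ.from w′ , true , stop refl , refl
      walk⁻ {w′} {v′ = v′} {c′} p@(_∷_ {e = e′} eq _) _ with
        back {o (φ.from w′) , side (from e′)} (recast
          (cong₂ _,_ (outer w′) (trans (sym (cong proj₂ eq))
            (trans (cong side (sym (to-from e′))) (side-≡ (from e′))))) refl p)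
      ... | es , (u , c) , es≡ , q , y≡ = _ , _ , es , φ.from v′ , c ,
        recast refl (cong (_, c) (θ-inj (trans (cong proj₁ y≡) (outer v′)))) q , es≡

    exec-map : rename φ.to (exec o G H) ≅ exec o′ G′ H′
    exec-map = exec-≅ o-inj o′-inj φ.to (map to) refl walk⁺
      (λ _ _ → map-injective to-injective) walk⁻ coh

-- Tensors: pluggings that fall into two disjoint components.

record Component {ℓ} {U U′ : Set ℓ} (G H : CohGraph U) (G′ H′ : CohGraph U′) : Set ℓ where
  field
    vertex     : U → U′
    vertex-inj : Inj vertex
    edge⁺      : E (G □ H) → E (G′ □ H′)
    edge⁺-inj  : Inj edge⁺
    src-≡      : ∀ e → srcᵃ G′ H′ (edge⁺ e) ≡ (vertex (s (G □ H) e) , side e)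
    tgt-≡      : ∀ e → tgtᵃ G′ H′ (edge⁺ e) ≡ (vertex (t (G □ H) e) , not (side e))
    ≍-⇔        : ∀ e e′ → (G □ H) [ e ≍ e′ ] ⇔ (G′ □ H′) [ edge⁺ e ≍ edge⁺ e′ ]
    closed     : ∀ e′ u → s (G′ □ H′) e′ ≡ vertex u → ∃[ e ] edge⁺ e ≡ e′

  state : U × Bool → U′ × Bool
  state (u , b) = vertex u , b

  state-inj : Inj state
  state-inj eq = cong₂ _,_ (vertex-inj (cong proj₁ eq)) (cong proj₂ eq)

  forth : ∀ {x es y} → AltWalk G H x es y → AltWalk G′ H′ (state x) (map edge⁺ es) (state y)
  forth = walk-map edge⁺ state src-≡ tgt-≡

  -- By `closed`, an edge that starts in the image of `vertex` comes from the component and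
  -- therefore also ends in that image.
  back : ∀ {x es′ y′} → AltWalk G′ H′ (state x) es′ y′ →
         ∃[ es ] ∃[ y ] map edge⁺ es ≡ es′ × AltWalk G H x es y × state y ≡ y′
  back = walk-lift edge⁺ state tgt-≡ λ e′ x eq →
    let e , e≡ = closed e′ (proj₁ x) (cong proj₁ eq)
    in e , e≡ , state-inj (trans (sym (src-≡ e)) (trans (cong (srcᵃ G′ H′) e≡) eq))

  coh : ∀ es fs → (G □ H) [ es ≍* fs ] ⇔ (G′ □ H′) [ map edge⁺ es ≍* map edge⁺ fs ]
  coh = map-≍* {G = G □ H} {H = G′ □ H′} edge⁺ ≍-⇔

  no-closed : G ⫫ H → ∀ {u b es} → es ≢ [] → AltWalk G′ H′ (vertex u , b) es (vertex u , b) →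
             ¬ (G′ □ H′) [ es ≍* es ]
  no-closed G⫫H ne w c with back w
  ... | es , y , refl , q , eq = no-cycle G⫫H
    (_ , es , map-≢[]⁻ ne , recast refl (state-inj eq) q , ⇐ (coh es es) c)

module _ {ℓ} {U U′ : Set ℓ} (G H : CohGraph U) (G′ H′ : CohGraph U′) where

  component₁ : Component G H (G ⊗ᴳ G′) (H ⊗ᴳ H′)
  component₁ = record
    { vertex = inj₁ ; vertex-inj = λ { refl → refl }
    ; edge⁺ = Sum.map inj₁ inj₁
    ; edge⁺-inj = λ { {inj₁ _} {inj₁ _} refl → refl ; {inj₂ _} {inj₂ _} refl → refl }
    ; src-≡ = λ { (inj₁ _) → refl ; (inj₂ _) → refl }
    ; tgt-≡ = λ { (inj₁ _) → refl ; (inj₂ _) → refl }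
    ; ≍-⇔ = λ { (inj₁ _) (inj₁ _) → mk⇔ id id ; (inj₁ _) (inj₂ _) → mk⇔ id id
              ; (inj₂ _) (inj₁ _) → mk⇔ id id ; (inj₂ _) (inj₂ _) → mk⇔ id id }
    ; closed = λ { (inj₁ (inj₁ e)) _ _ → inj₁ e , refl ; (inj₂ (inj₁ e)) _ _ → inj₂ e , refl
                 ; (inj₁ (inj₂ _)) _ () ; (inj₂ (inj₂ _)) _ () } }

  component₂ : Component G′ H′ (G ⊗ᴳ G′) (H ⊗ᴳ H′)
  component₂ = record
    { vertex = inj₂ ; vertex-inj = λ { refl → refl }
    ; edge⁺ = Sum.map inj₂ inj₂
    ; edge⁺-inj = λ { {inj₁ _} {inj₁ _} refl → refl ; {inj₂ _} {inj₂ _} refl → refl }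
    ; src-≡ = λ { (inj₁ _) → refl ; (inj₂ _) → refl }
    ; tgt-≡ = λ { (inj₁ _) → refl ; (inj₂ _) → refl }
    ; ≍-⇔ = λ { (inj₁ _) (inj₁ _) → mk⇔ id id ; (inj₁ _) (inj₂ _) → mk⇔ id id
              ; (inj₂ _) (inj₁ _) → mk⇔ id id ; (inj₂ _) (inj₂ _) → mk⇔ id id }
    ; closed = λ { (inj₁ (inj₂ e)) _ _ → inj₁ e , refl ; (inj₂ (inj₂ e)) _ _ → inj₂ e , refl
                 ; (inj₁ (inj₁ _)) _ () ; (inj₂ (inj₁ _)) _ () } }

  private
    module C₁ = Component component₁
    module C₂ = Component component₂

  ⫫-⊗ : G ⫫ H → G′ ⫫ H′ → G ⊗ᴳ G′ ⫫ H ⊗ᴳ H′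
  ⫫-⊗ G⫫H G′⫫H′ = acyclic λ
    { ((inj₁ u , b) , es , ne , w , c) → C₁.no-closed G⫫H ne w c
    ; ((inj₂ u , b) , es , ne , w , c) → C₂.no-closed G′⫫H′ ne w c }

  module _ {W W′ : Set ℓ} {o : W → U} {o′ : W′ → U′} (o-inj : Inj o) (o′-inj : Inj o′) where
    private
      open ExecEdge
      K : CohGraph (W ⊎ W′)
      K = exec (Sum.map o o′) (G ⊗ᴳ G′) (H ⊗ᴳ H′)

      image : (x : ExecEdge o G H ⊎ ExecEdge o′ G′ H′) →
              Σ[ y ∈ E K ] src y ≡ [ inj₁ ∘′ src , inj₂ ∘′ src ] x × tgt y ≡ [ inj₁ ∘′ tgt , inj₂ ∘′ tgt ] x ×
                trace y ≡ [ map C₁.edge⁺ ∘′ trace , map C₂.edge⁺ ∘′ trace ] x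
      image (inj₁ x) =
        fromTrace (map-≢[] (trace-nonempty x)) (C₁.forth (trace-walk x)) (⇒ (C₁.coh _ _) (coherent x))
      image (inj₂ x) =
        fromTrace (map-≢[] (trace-nonempty x)) (C₂.forth (trace-walk x)) (⇒ (C₂.coh _ _) (coherent x))

      f : ExecEdge o G H ⊎ ExecEdge o′ G′ H′ → E K
      f x = proj₁ (image x)

      src-f : ∀ x → src (f x) ≡ [ inj₁ ∘′ src , inj₂ ∘′ src ] x
      src-f x = proj₁ (proj₂ (image x))

      tgt-f : ∀ x → tgt (f x) ≡ [ inj₁ ∘′ tgt , inj₂ ∘′ tgt ] x
      tgt-f x = proj₁ (proj₂ (proj₂ (image x)))

      trace-f : ∀ x → trace (f x) ≡ [ map C₁.edge⁺ ∘′ trace , map C₂.edge⁺ ∘′ trace ] x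
      trace-f x = proj₂ (proj₂ (proj₂ (image x)))

      f-inj : Inj f
      f-inj {inj₁ x} {inj₁ y} eq = cong inj₁ (trace-injective o-inj (map-injective C₁.edge⁺-inj
        (trans (sym (trace-f (inj₁ x))) (trans (cong trace eq) (trace-f (inj₁ y))))))
      f-inj {inj₂ x} {inj₂ y} eq = cong inj₂ (trace-injective o′-inj (map-injective C₂.edge⁺-inj
        (trans (sym (trace-f (inj₂ x))) (trans (cong trace eq) (trace-f (inj₂ y))))))
      f-inj {inj₁ x} {inj₂ y} eq with () ← trans (sym (src-f (inj₁ x))) (trans (cong src eq) (src-f (inj₂ y)))
      f-inj {inj₂ x} {inj₁ y} eq with () ← trans (sym (src-f (inj₂ x))) (trans (cong src eq) (src-f (inj₁ y)))

      o⊎o′-inj : Inj (Sum.map o o′)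
      o⊎o′-inj {inj₁ _} {inj₁ _} eq = cong inj₁ (o-inj (inj₁-injective eq))
      o⊎o′-inj {inj₂ _} {inj₂ _} eq = cong inj₂ (o′-inj (inj₂-injective eq))

      -- The end points enter as variables so that matching on `w` selects the component; the walk
      -- stays in it, which forces `v` into the same summand.
      surj : ∀ (y : E K) w v {b c} → src y ≡ w → tgt y ≡ v →
             AltWalk (G ⊗ᴳ G′) (H ⊗ᴳ H′) (Sum.map o o′ w , b) (trace y) (Sum.map o o′ v , c) → ∃[ x ] f x ≡ y
      surj y (inj₁ w) v {b} refl refl p with C₁.back {o w , b} p
      surj y (inj₁ w) (inj₁ v) {b} refl refl p | es , (z , c) , es≡ , q , eq
        with fromTrace {o = o} (map-≢[]⁻ (subst (_≢ []) (sym es≡) (trace-nonempty y)))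
               (recast refl (C₁.state-inj eq) q)
               (⇐ (C₁.coh es es) (subst (λ es → ((G ⊗ᴳ G′) □ (H ⊗ᴳ H′)) [ es ≍* es ]) (sym es≡) (coherent y)))
      ... | x , _ , _ , refl = inj₁ x , trace-injective o⊎o′-inj (trans (trace-f (inj₁ x)) es≡)
      surj y (inj₂ w) v {b} refl refl p with C₂.back {o′ w , b} p
      surj y (inj₂ w) (inj₂ v) {b} refl refl p | es , (z , c) , es≡ , q , eq
        with fromTrace {o = o′} (map-≢[]⁻ (subst (_≢ []) (sym es≡) (trace-nonempty y)))
               (recast refl (C₂.state-inj eq) q)
               (⇐ (C₂.coh es es) (subst (λ es → ((G ⊗ᴳ G′) □ (H ⊗ᴳ H′)) [ es ≍* es ]) (sym es≡) (coherent y)))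
      ... | x , _ , _ , refl = inj₂ x , trace-injective o⊎o′-inj (trans (trace-f (inj₂ x)) es≡)

      apart : ∀ e e′ → ((G ⊗ᴳ G′) □ (H ⊗ᴳ H′)) [ C₁.edge⁺ e ≍ C₂.edge⁺ e′ ]
      apart (inj₁ _) (inj₁ _) = ttₗ
      apart (inj₁ _) (inj₂ _) = ttₗ
      apart (inj₂ _) (inj₁ _) = ttₗ
      apart (inj₂ _) (inj₂ _) = ttₗ

      apart* : ∀ es es′ → ((G ⊗ᴳ G′) □ (H ⊗ᴳ H′)) [ map C₁.edge⁺ es ≍* map C₂.edge⁺ es′ ]
      apart* es es′ = All.map⁺ (All.universal (λ e → All.map⁺ (All.universal (apart e) es′)) es)

      via-trace : ∀ x y {es es′} → trace (f x) ≡ es → trace (f y) ≡ es′ →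
                  ((G ⊗ᴳ G′) □ (H ⊗ᴳ H′)) [ es ≍* es′ ] ⇔ K [ f x ≍ f y ]
      via-trace x y refl refl = mk⇔ id id

      ≍⇔ : ∀ x y → (exec o G H ⊗ᴳ exec o′ G′ H′) [ x ≍ y ] ⇔ K [ f x ≍ f y ]
      ≍⇔ x@(inj₁ x′) y@(inj₁ y′) = mk⇔
        (λ c → ⇒ (via-trace x y (trace-f x) (trace-f y)) (⇒ (C₁.coh (trace x′) (trace y′)) c))
        (λ c → ⇐ (C₁.coh (trace x′) (trace y′)) (⇐ (via-trace x y (trace-f x) (trace-f y)) c))
      ≍⇔ x@(inj₂ x′) y@(inj₂ y′) = mk⇔
        (λ c → ⇒ (via-trace x y (trace-f x) (trace-f y)) (⇒ (C₂.coh (trace x′) (trace y′)) c))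
        (λ c → ⇐ (C₂.coh (trace x′) (trace y′)) (⇐ (via-trace x y (trace-f x) (trace-f y)) c))
      ≍⇔ x@(inj₁ x′) y@(inj₂ y′) = mk⇔
        (λ _ → ⇒ (via-trace x y (trace-f x) (trace-f y)) (apart* (trace x′) (trace y′))) (λ _ → ttₗ)
      ≍⇔ x@(inj₂ x′) y@(inj₁ y′) = mk⇔
        (λ _ → CohGraph.≍-sym K {f y} {f x}
          (⇒ (via-trace y x (trace-f y) (trace-f x)) (apart* (trace y′) (trace x′)))) (λ _ → ttₗ)

    -- No path crosses between the components, and edges of different components are always
    -- coherent, which is the coherence of a tensor.
    exec-⊗ : exec o G H ⊗ᴳ exec o′ G′ H′ ≅ exec (Sum.map o o′) (G ⊗ᴳ G′) (H ⊗ᴳ H′)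
    exec-⊗ = mk≅ f f-inj (λ y → surj y (src y) (tgt y) refl refl (trace-walk y))
      (λ { x@(inj₁ _) → src-f x ; x@(inj₂ _) → src-f x })
      (λ { x@(inj₁ _) → tgt-f x ; x@(inj₂ _) → tgt-f x })
      ≍⇔

-- Coherence of concatenated lists of edges.

module _ {ℓ} {V : Set ℓ} (G : CohGraph V) where

  ≍*-++⁻ : ∀ es {fs} → G [ es ++ fs ≍* es ++ fs ] →
           G [ es ≍* es ] × G [ fs ≍* fs ] × G [ es ≍* fs ]
  ≍*-++⁻ es c =
    All.map (All.++⁻ˡ es) (All.++⁻ˡ es c) ,
    All.map (All.++⁻ʳ es) (All.++⁻ʳ es c) ,
    All.map (All.++⁻ʳ es) (All.++⁻ˡ es c)

  ≍*-++⁺ : ∀ {es fs} → G [ es ≍* es ] → G [ fs ≍* fs ] → G [ es ≍* fs ] →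
           G [ es ++ fs ≍* es ++ fs ]
  ≍*-++⁺ c₁ c₂ c = All.++⁺ (All.zipWith (λ (p , q) → All.++⁺ p q) (c₁ , c))
    (All.zipWith (λ (p , q) → All.++⁺ p q) (CohGraph.≍*-sym G c , c₂))

  ≍*-rotate : ∀ es {fs} → G [ es ++ fs ≍* es ++ fs ] → G [ fs ++ es ≍* fs ++ es ]
  ≍*-rotate es c with c₁ , c₂ , c₁₂ ← ≍*-++⁻ es c = ≍*-++⁺ c₂ c₁ (CohGraph.≍*-sym G c₁₂)

module _ {ℓ} {V W : Set ℓ} (G : CohGraph V) (H : CohGraph W) (f : E G → List (E H)) where

  concatMap-≍* : (∀ e e′ → G [ e ≍ e′ ] ⇔ H [ f e ≍* f e′ ]) →
                 ∀ es es′ → G [ es ≍* es′ ] ⇔ H [ concatMap f es ≍* concatMap f es′ ]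
  concatMap-≍* f-coh es es′ = mk⇔ (λ c → columns es c) (λ c → columns⁻ es c)
    where
    row : ∀ e es′ → All (G [ e ≍_]) es′ → H [ f e ≍* concatMap f es′ ]
    row e [] [] = All.universal (λ _ → []) (f e)
    row e (e′ ∷ es′) (c ∷ cs) = All.zipWith (λ (p , q) → All.++⁺ p q) (⇒ (f-coh e e′) c , row e es′ cs)

    row⁻ : ∀ e es′ → H [ f e ≍* concatMap f es′ ] → All (G [ e ≍_]) es′
    row⁻ e [] _ = []
    row⁻ e (e′ ∷ es′) c =
      ⇐ (f-coh e e′) (All.map (All.++⁻ˡ (f e′)) c) ∷ row⁻ e es′ (All.map (All.++⁻ʳ (f e′)) c)

    columns : ∀ es → G [ es ≍* es′ ] → H [ concatMap f es ≍* concatMap f es′ ]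
    columns [] [] = []
    columns (e ∷ es) (c ∷ cs) = All.++⁺ (row e es′ c) (columns es cs)

    columns⁻ : ∀ es → H [ concatMap f es ≍* concatMap f es′ ] → G [ es ≍* es′ ]
    columns⁻ [] _ = []
    columns⁻ (e ∷ es) c = row⁻ e es′ (All.++⁻ˡ (f e) c) ∷ columns⁻ es (All.++⁻ʳ (f e) c)

-- Flattening an iterated execution.

module Flattening {ℓ} {P Q R S : Set ℓ} (F : CohGraph (P ⊎ Q)) (G : CohGraph (Q ⊎ R)) (H : CohGraph (R ⊎ S)) where
  open ExecEdge

  Fⁱ Gⁱ : CohGraph (P ⊎ (Q ⊎ R))
  Fⁱ = rename (Sum.map₂ inj₁) F
  Gⁱ = rename inj₂ G

  FG H° : CohGraph (P ⊎ (R ⊎ S))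
  FG = rename (Sum.map₂ inj₁) (F ∷∷ G)
  H° = rename inj₂ H

  Gᵗ : CohGraph ((P ⊎ Q) ⊎ (R ⊎ S))
  Gᵗ = rename (Sum.map inj₂ inj₁) G

  private
    border : P ⊎ R → P ⊎ (Q ⊎ R)
    border = Sum.map₂ inj₂

    border-inj : Inj border
    border-inj {inj₁ _} {inj₁ _} refl = refl
    border-inj {inj₂ _} {inj₂ _} refl = refl

    -- At P-vertices the blocks of F ∷∷ G begin with an edge of F, at R-vertices with an edge of G.
    enter : P ⊎ R → Bool
    enter (inj₁ _) = true
    enter (inj₂ _) = false

    -- Converts a side of `Fⁱ □ Gⁱ` at a border vertex into a side of `FG □ H°`. At an R-vertex,
    -- `FG` goes on with an edge of `G`, which is on the false side inside a block but on the true
    -- side outside; hence the negation.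
    turn : P ⊎ R → Bool → Bool
    turn (inj₁ _) b = b
    turn (inj₂ _) b = not b

    turn-enter : ∀ w → turn w (enter w) ≡ true
    turn-enter (inj₁ _) = refl
    turn-enter (inj₂ _) = refl

    turn-exit : ∀ w → turn w (not (enter w)) ≡ false
    turn-exit (inj₁ _) = refl
    turn-exit (inj₂ _) = refl

    κ : P ⊎ (Q ⊎ R) → (P ⊎ Q) ⊎ (R ⊎ S)
    κ (inj₁ p)        = inj₁ (inj₁ p)
    κ (inj₂ (inj₁ q)) = inj₁ (inj₂ q)
    κ (inj₂ (inj₂ r)) = inj₂ (inj₁ r)

    inner : (P ⊎ (Q ⊎ R)) × Bool → ((P ⊎ Q) ⊎ (R ⊎ S)) × Bool
    inner (v , b) = κ v , b

    -- The flat plugging puts `H` on the side of `F`, opposite to `G`. At a P-vertex `FG` continues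
    -- with `F`, so the side is kept; at vertices of R and S the side of `H` turns from false to
    -- true.
    outer : (P ⊎ (R ⊎ S)) × Bool → ((P ⊎ Q) ⊎ (R ⊎ S)) × Bool
    outer (inj₁ p , b) = inj₁ (inj₁ p) , b
    outer (inj₂ y , b) = inj₂ y , not b

    κ-F : ∀ x → κ (Sum.map₂ inj₁ x) ≡ inj₁ x
    κ-F (inj₁ _) = refl
    κ-F (inj₂ _) = refl

    κ-G : ∀ y → κ (inj₂ y) ≡ Sum.map inj₂ inj₁ y
    κ-G (inj₁ _) = refl
    κ-G (inj₂ _) = refl

    κ-inj : Inj κ
    κ-inj {inj₁ _} {inj₁ _} refl = refl
    κ-inj {inj₁ _} {inj₂ (inj₁ _)} ()
    κ-inj {inj₁ _} {inj₂ (inj₂ _)} ()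
    κ-inj {inj₂ (inj₁ _)} {inj₁ _} ()
    κ-inj {inj₂ (inj₂ _)} {inj₁ _} ()
    κ-inj {inj₂ (inj₁ _)} {inj₂ (inj₁ _)} refl = refl
    κ-inj {inj₂ (inj₂ _)} {inj₂ (inj₂ _)} refl = refl
    κ-inj {inj₂ (inj₁ _)} {inj₂ (inj₂ _)} ()
    κ-inj {inj₂ (inj₂ _)} {inj₂ (inj₁ _)} ()

    inner-inj : Inj inner
    inner-inj eq = cong₂ _,_ (κ-inj (cong proj₁ eq)) (cong proj₂ eq)

    outer-inj : Inj outer
    outer-inj {inj₁ _ , _} {inj₁ _ , _} refl = refl
    outer-inj {inj₂ _ , _} {inj₂ _ , _} eq =
      cong₂ _,_ (cong inj₂ (inj₂-injective (cong proj₁ eq))) (not-injective (cong proj₂ eq))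
    outer-inj {inj₁ _ , _} {inj₂ _ , _} ()
    outer-inj {inj₂ _ , _} {inj₁ _ , _} ()

    outer-border : ∀ w b → outer (Sum.map₂ inj₁ w , turn w b) ≡ inner (border w , b)
    outer-border (inj₁ _) b = refl
    outer-border (inj₂ r) b = cong (inj₂ (inj₁ r) ,_) (not-involutive b)

    outer-enter : ∀ w → outer (Sum.map₂ inj₁ w , true) ≡ inner (border w , enter w)
    outer-enter w =
      subst (λ b → outer (Sum.map₂ inj₁ w , b) ≡ inner (border w , enter w)) (turn-enter w) (outer-border w _)

    outer-exit : ∀ w → outer (Sum.map₂ inj₁ w , false) ≡ inner (border w , not (enter w))
    outer-exit w =
      subst (λ b → outer (Sum.map₂ inj₁ w , b) ≡ inner (border w , not (enter w))) (turn-exit w) (outer-border w _)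

    inner-outer : ∀ v b x → inner (v , b) ≡ outer x → ∃[ w ] v ≡ border w × x ≡ (Sum.map₂ inj₁ w , turn w b)
    inner-outer (inj₁ p) b (inj₁ p , b) refl = inj₁ p , refl , refl
    inner-outer (inj₂ (inj₂ r)) b (inj₂ (inj₁ r) , b′) refl =
      inj₂ r , refl , cong (_ ,_) (sym (not-involutive b′))
    inner-outer (inj₁ _) _ (inj₂ _ , _) ()
    inner-outer (inj₂ (inj₁ _)) _ (inj₁ _ , _) ()
    inner-outer (inj₂ (inj₁ _)) _ (inj₂ _ , _) ()
    inner-outer (inj₂ (inj₂ _)) _ (inj₁ _ , _) ()

    border-F : ∀ x w → Sum.map₂ inj₁ x ≡ border w → enter w ≡ true
    border-F _ (inj₁ _) _ = refl
    border-F (inj₁ _) (inj₂ _) ()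
    border-F (inj₂ _) (inj₂ _) ()

    border-G : ∀ y w → inj₂ y ≡ border w → enter w ≡ false
    border-G _ (inj₂ _) _ = refl

    -- At a border vertex only one of the two graphs can have edges, `F` in P and `G` in R, so the
    -- vertex fixes the side.
    side-source : ∀ e w b → srcᵃ Fⁱ Gⁱ e ≡ (border w , b) → b ≡ enter w
    side-source (inj₁ f) w b eq = trans (sym (cong proj₂ eq)) (sym (border-F (s F f) w (cong proj₁ eq)))
    side-source (inj₂ g) w b eq = trans (sym (cong proj₂ eq)) (sym (border-G (s G g) w (cong proj₁ eq)))

    side-target : ∀ e w b → tgtᵃ Fⁱ Gⁱ e ≡ (border w , b) → b ≡ not (enter w)
    side-target (inj₁ f) w b eq =
      trans (sym (cong proj₂ eq)) (cong not (sym (border-F (t F f) w (cong proj₁ eq))))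
    side-target (inj₂ g) w b eq =
      trans (sym (cong proj₂ eq)) (cong not (sym (border-G (t G g) w (cong proj₁ eq))))

    Eᵗ : Set ℓ
    Eᵗ = E ((F ⊗ᴳ H) □ Gᵗ)

    j : E F ⊎ E G → Eᵗ
    j = Sum.map₁ inj₁

    j-inj : Inj j
    j-inj {inj₁ _} {inj₁ _} refl = refl
    j-inj {inj₂ _} {inj₂ _} refl = refl

    j-src : ∀ e → srcᵃ (F ⊗ᴳ H) Gᵗ (j e) ≡ inner (srcᵃ Fⁱ Gⁱ e)
    j-src (inj₁ f) = cong (_, true) (sym (κ-F (s F f)))
    j-src (inj₂ g) = cong (_, false) (sym (κ-G (s G g)))

    j-tgt : ∀ e → tgtᵃ (F ⊗ᴳ H) Gᵗ (j e) ≡ inner (tgtᵃ Fⁱ Gⁱ e)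
    j-tgt (inj₁ f) = cong (_, false) (sym (κ-F (t F f)))
    j-tgt (inj₂ g) = cong (_, true) (sym (κ-G (t G g)))

    j-coh : ∀ e e′ → (Fⁱ □ Gⁱ) [ e ≍ e′ ] ⇔ ((F ⊗ᴳ H) □ Gᵗ) [ j e ≍ j e′ ]
    j-coh (inj₁ _) (inj₁ _) = mk⇔ id id
    j-coh (inj₁ _) (inj₂ _) = mk⇔ id id
    j-coh (inj₂ _) (inj₁ _) = mk⇔ id id
    j-coh (inj₂ _) (inj₂ _) = mk⇔ id id

    data Origin : Eᵗ → Set ℓ where
      blockEdge : ∀ e → Origin (j e)
      outerEdge : ∀ h → Origin (inj₁ (inj₂ h))

    origin : ∀ e → Origin e
    origin (inj₁ (inj₁ f)) = blockEdge (inj₁ f)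
    origin (inj₁ (inj₂ h)) = outerEdge h
    origin (inj₂ g)        = blockEdge (inj₂ g)

    InnerWalk : (P ⊎ (Q ⊎ R)) × Bool → List (E F ⊎ E G) → (P ⊎ (Q ⊎ R)) × Bool → Set ℓ
    InnerWalk = AltWalk Fⁱ Gⁱ

    OuterWalk : (P ⊎ (R ⊎ S)) × Bool → List (E (FG □ H°)) → (P ⊎ (R ⊎ S)) × Bool → Set ℓ
    OuterWalk = AltWalk FG H°

    FlatWalk : ((P ⊎ Q) ⊎ (R ⊎ S)) × Bool → List Eᵗ → ((P ⊎ Q) ⊎ (R ⊎ S)) × Bool → Set ℓ
    FlatWalk = AltWalk (F ⊗ᴳ H) Gᵗ

    Coherentᵗ : List Eᵗ → Set ℓ
    Coherentᵗ es = ((F ⊗ᴳ H) □ Gᵗ) [ es ≍* es ]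

    inner⇒flat : ∀ {x es y} → InnerWalk x es y → FlatWalk (inner x) (map j es) (inner y)
    inner⇒flat = walk-map j inner j-src j-tgt

    jcoh : ∀ es fs → (Fⁱ □ Gⁱ) [ es ≍* fs ] ⇔ ((F ⊗ᴳ H) □ Gᵗ) [ map j es ≍* map j fs ]
    jcoh = map-≍* {G = Fⁱ □ Gⁱ} {H = (F ⊗ᴳ H) □ Gᵗ} j j-coh

    block-walk : ∀ (x : E (F ∷∷ G)) → InnerWalk (border (src x) , enter (src x)) (trace x)
                 (border (tgt x) , not (enter (tgt x)))
    block-walk x = let p = trace-walk x in recast (start _ (trace-nonempty x) p) (end _ (trace-nonempty x) p) p
      where
      start : ∀ {y b} es → es ≢ [] → InnerWalk (border (src x) , b) es y →
              (border (src x) , b) ≡ (border (src x) , enter (src x))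
      start [] ne _ = contradiction refl ne
      start (e ∷ _) _ p = cong (_ ,_) (side-source e (src x) _ (walk-start p))
      end : ∀ {y c} es → es ≢ [] → InnerWalk y es (border (tgt x) , c) →
            (border (tgt x) , c) ≡ (border (tgt x) , not (enter (tgt x)))
      end es ne p with e , eq ← walk-end ne p = cong (_ ,_) (side-target e (tgt x) _ eq)

    expand : E (FG □ H°) → List Eᵗ
    expand (inj₁ x) = map j (trace x)
    expand (inj₂ h) = inj₁ (inj₂ h) ∷ []

    flatten : List (E (FG □ H°)) → List Eᵗ
    flatten = concatMap expand

    expand-≢[] : ∀ e {es} → expand e ++ es ≢ []
    expand-≢[] (inj₁ x) eq = map-≢[] (trace-nonempty x) (++-conicalˡ _ _ eq)
    expand-≢[] (inj₂ _) ()

    flatten-≢[] : ∀ {es} → es ≢ [] → flatten es ≢ []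
    flatten-≢[] {[]} ne _ = ne refl
    flatten-≢[] {e ∷ es} _ = expand-≢[] e

    outer⇒flat : ∀ {x es y} → OuterWalk x es y → FlatWalk (outer x) (flatten es) (outer y)
    outer⇒flat (stop refl) = stop refl
    outer⇒flat (_∷_ {e = inj₁ x} refl p) =
      recast (sym (outer-enter (src x))) (sym (outer-exit (tgt x))) (inner⇒flat (block-walk x)) ++ʷ outer⇒flat p
    outer⇒flat (_∷_ {e = inj₂ h} refl p) = refl ∷ outer⇒flat p

    expand-coh : ∀ e e′ → (FG □ H°) [ e ≍ e′ ] ⇔ ((F ⊗ᴳ H) □ Gᵗ) [ expand e ≍* expand e′ ]
    expand-coh (inj₁ x) (inj₁ y) = jcoh (trace x) (trace y)
    expand-coh (inj₁ x) (inj₂ h) =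
      mk⇔ (λ _ → All.map⁺ (All.universal (λ { (inj₁ _) → ttₗ ∷ [] ; (inj₂ _) → ttₗ ∷ [] }) (trace x))) (λ _ → ttₗ)
    expand-coh (inj₂ h) (inj₁ x) =
      mk⇔ (λ _ → All.map⁺ (All.universal (λ { (inj₁ _) → ttₗ ; (inj₂ _) → ttₗ }) (trace x)) ∷ []) (λ _ → ttₗ)
    expand-coh (inj₂ h) (inj₂ h′) = mk⇔ (λ c → (c ∷ []) ∷ []) (λ { ((c ∷ []) ∷ []) → c })

    flatten-coh : ∀ es fs → (FG □ H°) [ es ≍* fs ] ⇔ ((F ⊗ᴳ H) □ Gᵗ) [ flatten es ≍* flatten fs ]
    flatten-coh = concatMap-≍* (FG □ H°) ((F ⊗ᴳ H) □ Gᵗ) expand expand-coh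

    OutsideBlock : List Eᵗ → Set ℓ
    OutsideBlock rs = ∀ e {rs′} → rs ≢ j e ∷ rs′

    -- Neither remainder begins with an edge of `F` or `G`, so both blocks are the longest possible
    -- prefixes.
    block-unique : ∀ xs ys {rs rs′} → OutsideBlock rs → OutsideBlock rs′ →
                   map j xs ++ rs ≡ map j ys ++ rs′ → xs ≡ ys × rs ≡ rs′
    block-unique [] [] _ _ eq = refl , eq
    block-unique [] (y ∷ _) out _ eq = contradiction eq (out y)
    block-unique (x ∷ _) [] _ out eq = contradiction (sym eq) (out x)
    block-unique (x ∷ xs) (y ∷ ys) out out′ eq with ∷-injective eq
    ... | eq₁ , eq₂ with block-unique xs ys out out′ eq₂
    ... | xs≡ys , eq₃ = cong₂ _∷_ (j-inj {x} {y} eq₁) xs≡ys , eq₃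

    outside-outerEdge : ∀ h {rs} → OutsideBlock (inj₁ (inj₂ h) ∷ rs)
    outside-outerEdge h (inj₁ _) ()
    outside-outerEdge h (inj₂ _) ()

    -- After a block, alternation in the outer plugging demands an edge of `H`. Two blocks are
    -- therefore never adjacent, and concatenation does not blur where one ends; this is what makes
    -- `flatten` injective on walks.
    outside-after : ∀ {v es y} → OuterWalk (v , false) es y → OutsideBlock (flatten es)
    outside-after (stop _) _ ()
    outside-after (_∷_ {e = inj₂ h} _ _) = outside-outerEdge h
    outside-after (_∷_ {e = inj₁ _} () _)

    flatten-inj : ∀ {x es y x′ fs y′} → OuterWalk x es y → OuterWalk x′ fs y′ → flatten es ≡ flatten fs →
                  es ≡ fs
    flatten-inj (stop _) (stop _) _ = refl
    flatten-inj (stop _) (_∷_ {e = e} _ _) eq = contradiction (sym eq) (expand-≢[] e)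
    flatten-inj (_∷_ {e = e} _ _) (stop _) eq = contradiction eq (expand-≢[] e)
    flatten-inj (_∷_ {e = inj₂ h} _ p) (_∷_ {e = inj₂ h′} _ q) eq with ∷-injective eq
    ... | refl , eq′ = cong (_ ∷_) (flatten-inj p q eq′)
    flatten-inj (_∷_ {e = inj₁ x} _ p) (_∷_ {e = inj₂ h} _ q) eq =
      contradiction (proj₁ (block-unique (trace x) [] (outside-after p) (outside-outerEdge h) eq)) (trace-nonempty x)
    flatten-inj (_∷_ {e = inj₂ h} _ p) (_∷_ {e = inj₁ x} _ q) eq =
      contradiction (proj₁ (block-unique (trace x) [] (outside-after q) (outside-outerEdge h) (sym eq))) (trace-nonempty x)
    flatten-inj (_∷_ {e = inj₁ x} _ p) (_∷_ {e = inj₁ y} _ q) eq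
      with block-unique (trace x) (trace y) (outside-after p) (outside-after q) eq
    ... | eq₁ , eq₂ = cong₂ _∷_ (cong inj₁ (trace-injective border-inj eq₁)) (flatten-inj p q eq₂)

    -- In `upTo` the walk resumes in an outer state of side false, that is, with `H` about to move.
    data FirstBlock (z : (P ⊎ (Q ⊎ R)) × Bool) (y : ((P ⊎ Q) ⊎ (R ⊎ S)) × Bool) : List Eᵗ → Set ℓ where
      whole : ∀ {as z′} → InnerWalk z as z′ → inner z′ ≡ y → FirstBlock z y (map j as)
      upTo  : ∀ {as rs} w → InnerWalk z as (border w , not (enter w)) →
              FlatWalk (outer (Sum.map₂ inj₁ w , false)) rs y → FirstBlock z y (map j as ++ rs)

    -- Among the vertices of `F` and `G`, an edge of `H` can start only at those in R, and there its
    -- side is the one on which a block ends; so the first edge of `H` is always preceded by a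
    -- complete block.
    firstBlock : ∀ {z es y} → FlatWalk (inner z) es y → FirstBlock z y es
    firstBlock (stop eq) = whole (stop refl) eq
    firstBlock {z} (_∷_ {e = e} eq p) with origin e
    ... | blockEdge e′ with inner-inj (trans (sym (j-src e′)) eq) | firstBlock (recast (j-tgt e′) refl p)
    ... | refl | whole q eq′ = whole (refl ∷ q) eq′
    ... | refl | upTo w q r = upTo w (refl ∷ q) r
    firstBlock {z} (eq ∷ p) | outerEdge h with z
    ... | inj₂ (inj₂ r) , b with eq
    ... | eq′ =
      upTo (inj₂ r) (stop (cong (_ ,_) (sym (cong proj₂ eq′)))) (trans eq′ (cong (_ ,_) (sym (cong proj₂ eq′))) ∷ p)
    firstBlock {z} (eq ∷ p) | outerEdge h | inj₁ _ , _ with () ← eq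
    firstBlock {z} (eq ∷ p) | outerEdge h | inj₂ (inj₁ _) , _ with () ← eq

    Unflatten : (x : (P ⊎ (R ⊎ S)) × Bool) → List Eᵗ → (y : (P ⊎ (R ⊎ S)) × Bool) → Set ℓ
    Unflatten x es y = ∃[ es′ ] flatten es′ ≡ es × OuterWalk x es′ y

    consBlock : ∀ {e as x w rs y} → inner (srcᵃ Fⁱ Gⁱ e) ≡ outer x →
                InnerWalk (tgtᵃ Fⁱ Gⁱ e) as (border w , not (enter w)) →
                Coherentᵗ (j e ∷ map j as) → Unflatten (Sum.map₂ inj₁ w , false) rs y →
                Unflatten x (j e ∷ map j as ++ rs) y
    consBlock {e} {as} {x} {w} eq q c (es′ , refl , r) with inner-outer _ (side e) x eq
    ... | w₀ , v≡ , refl with side-source e w₀ _ (cong₂ _,_ v≡ refl)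
    ... | b≡ with fromTrace {o = border} {w = w₀} {es = e ∷ as} {v = w} (λ ()) (cong₂ _,_ v≡ refl ∷ q) (⇐ (jcoh (e ∷ as) (e ∷ as)) c)
    ... | k , refl , refl , tr = inj₁ k ∷ es′ , cong (λ as → map j as ++ flatten es′) tr ,
      cong (Sum.map₂ inj₁ w₀ ,_) (sym (trans (cong (turn w₀) b≡) (turn-enter w₀))) ∷ r

    -- The recursion runs on a bound for the length, because the remainder after a block is not a
    -- structural part of the list.
    unflatten : ∀ n {x es y} → length es ≤ n → FlatWalk (outer x) es (outer y) → Coherentᵗ es → Unflatten x es y
    unflatten n _ (stop eq) _ = [] , refl , stop (outer-inj eq)
    unflatten (suc n) (s≤s n≤) (_∷_ {e = e} eq p) c with origin e
    unflatten (suc n) {x} (s≤s n≤) (_∷_ {es = es} eq p) c | outerEdge h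
      with es′ , fl , q ← unflatten n n≤ p (proj₁ (proj₂ (≍*-++⁻ ((F ⊗ᴳ H) □ Gᵗ) (_ ∷ []) c)))
      = inj₂ h ∷ es′ , cong (_ ∷_) fl , outer-inj {inj₂ (s H h) , false} eq ∷ q
    unflatten (suc n) {x} {y = y} (s≤s n≤) (_∷_ {es = es} eq p) c | blockEdge e
      with firstBlock (recast (j-tgt e) refl p)
    ... | upTo {as} {rs} w q r =
      consBlock (trans (sym (j-src e)) eq) q (proj₁ (≍*-++⁻ ((F ⊗ᴳ H) □ Gᵗ) (j e ∷ map j as) c))
      (unflatten n (≤-trans (≤-trans (m≤n+m _ _) (≤-reflexive (sym (length-++ (map j as))))) n≤) r
        (proj₁ (proj₂ (≍*-++⁻ ((F ⊗ᴳ H) □ Gᵗ) (j e ∷ map j as) c))))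
    -- The block runs to the end of the list. The final state is inner and outer at once, hence at a
    -- border vertex, and the remainder is the empty walk there.
    ... | whole {as} {z′} q eq′ with inner-outer (proj₁ z′) (proj₂ z′) y eq′
    ... | w , refl , refl with walk-end {es = e ∷ as} (λ ()) (refl ∷ q)
    ... | e′ , eq″ with side-target e′ w _ eq″
    ... | refl = subst (λ es → Unflatten x (j e ∷ es) _) (++-identityʳ (map j as))
      (consBlock (trans (sym (j-src e)) eq) q c ([] , refl , stop (cong (_ ,_) (sym (turn-exit w)))))

  flat-⫫ : F ⊗ᴳ H ⫫ Gᵗ → FG ⫫ H°
  flat-⫫ ⫫ᵗ = acyclic λ (x , es , ne , p , c) → no-cycle ⫫ᵗ
    (outer x , flatten es , flatten-≢[] ne , outer⇒flat p , ⇒ (flatten-coh es es) c)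

  private
    -- A closed walk can be cut into whole blocks only if it starts in an outer state.
    outer-cycle : FG ⫫ H° → ∀ {x es} → es ≢ [] → FlatWalk (outer x) es (outer x) → ¬ Coherentᵗ es
    outer-cycle ⫫° ne p c with unflatten _ ≤-refl p c
    ... | es′ , refl , q = no-cycle ⫫° (_ , es′ , (λ { refl → ne refl }) , q , ⇐ (flatten-coh es′ es′) c)

  -- A cycle with an edge of H is rotated so that it starts at the end of a block.
  unflat-⫫ : Fⁱ ⫫ Gⁱ → FG ⫫ H° → F ⊗ᴳ H ⫫ Gᵗ
  unflat-⫫ ⫫ⁱ ⫫° = acyclic ¬cycle
    where
    ¬cycle : ¬ Cycle (F ⊗ᴳ H) Gᵗ
    ¬cycle (x , [] , ne , _) = ne refl
    ¬cycle (x , e ∷ es , ne , eq ∷ p , c) with origin e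
    ... | outerEdge h = outer-cycle ⫫° {inj₂ (s H h) , false} ne (refl ∷ recast refl (sym eq) p) c
    ... | blockEdge e′ with trans (sym eq) (j-src e′)
    ... | refl with firstBlock (recast (j-tgt e′) refl p)
    ... | whole {as} q eq′ = no-cycle ⫫ⁱ
      (_ , e′ ∷ as , (λ ()) , recast refl (inner-inj eq′) (refl ∷ q) , ⇐ (jcoh (e′ ∷ as) (e′ ∷ as)) c)
    ... | upTo {as} {rs} w q r = outer-cycle ⫫° {Sum.map₂ inj₁ w , false}
      (λ eq′ → contradiction (++-conicalʳ rs _ eq′) λ ())
      (r ++ʷ recast refl (sym (outer-exit w)) (inner⇒flat {es = e′ ∷ as} (refl ∷ q)))
      (≍*-rotate ((F ⊗ᴳ H) □ Gᵗ) (j e′ ∷ map j as) c)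

  private
    outer-end : ∀ w b → ∃[ c ] outer (Sum.map₂ inj₂ w , b) ≡ (Sum.map inj₁ inj₂ w , c)
    outer-end (inj₁ _) b = b , refl
    outer-end (inj₂ _) b = not b , refl

    outer-end⁻ : ∀ w c → ∃[ b ] outer (Sum.map₂ inj₂ w , b) ≡ (Sum.map inj₁ inj₂ w , c)
    outer-end⁻ (inj₁ _) c = c , refl
    outer-end⁻ (inj₂ _) c = not c , cong (_ ,_) (not-involutive c)

    end-inj : Inj (Sum.map₂ {A = P} (inj₂ {A = R} {B = S}))
    end-inj {inj₁ _} {inj₁ _} refl = refl
    end-inj {inj₂ _} {inj₂ _} refl = refl

    end′-inj : Inj (Sum.map (inj₁ {A = P} {B = Q}) (inj₂ {A = R} {B = S}))
    end′-inj {inj₁ _} {inj₁ _} refl = refl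
    end′-inj {inj₂ _} {inj₂ _} refl = refl

    walk⁺ : ∀ {w b es v c} → es ≢ [] → OuterWalk (Sum.map₂ inj₂ w , b) es (Sum.map₂ inj₂ v , c) →
            flatten es ≢ [] × ∃[ b′ ] ∃[ c′ ] FlatWalk (Sum.map inj₁ inj₂ w , b′) (flatten es) (Sum.map inj₁ inj₂ v , c′)
    walk⁺ {w} {b} {v = v} {c} ne p = flatten-≢[] ne , _ , _ ,
      recast (proj₂ (outer-end w b)) (proj₂ (outer-end v c)) (outer⇒flat p)

    walk⁻ : ∀ {w b es v c} → FlatWalk (Sum.map inj₁ inj₂ w , b) es (Sum.map inj₁ inj₂ v , c) → Coherentᵗ es →
            ∃[ w′ ] ∃[ b′ ] ∃[ es′ ] ∃[ v′ ] ∃[ c′ ] OuterWalk (Sum.map₂ inj₂ w′ , b′) es′ (Sum.map₂ inj₂ v′ , c′) × flatten es′ ≡ es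
    walk⁻ {w} {b} {v = v} {c} p coh
      with es′ , fl , q ← unflatten _ ≤-refl (recast (sym (proj₂ (outer-end⁻ w b))) (sym (proj₂ (outer-end⁻ v c))) p) coh
      = w , _ , es′ , v , _ , q , fl

  flat-≅ : (F ∷∷ G) ∷∷ H ≅ exec (Sum.map inj₁ inj₂) (F ⊗ᴳ H) Gᵗ
  flat-≅ = exec-≅ end-inj end′-inj id flatten refl
    (λ {w} {b} {es} {v} {c} → walk⁺ {w} {b} {es} {v} {c}) flatten-inj
    (λ {w} {b} {es} {v} {c} → walk⁻ {w} {b} {es} {v} {c}) flatten-coh

-- Execution as composition: functoriality, symmetry, associativity.

map-inj : {f : A → C} {g : B → D} → Inj f → Inj g → Inj (Sum.map f g)
map-inj f-inj g-inj {inj₁ _} {inj₁ _} eq = cong inj₁ (f-inj (inj₁-injective eq))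
map-inj f-inj g-inj {inj₂ _} {inj₂ _} eq = cong inj₂ (g-inj (inj₂-injective eq))

↔-inj : (φ : A ↔ B) → Inj (Inverse.to φ)
↔-inj φ {x} {y} eq = trans (sym (φ.strictlyInverseʳ x)) (trans (cong φ.from eq) (φ.strictlyInverseʳ y))
  where module φ = Inverse φ

rename-square : (θ : V → W) (φ : U → V) (θ′ : V′ → W) (φ′ : U → V′) (G : CohGraph U) →
                (∀ u → θ (φ u) ≡ θ′ (φ′ u)) → rename θ (rename φ G) ≅ rename θ′ (rename φ′ G)
rename-square θ φ θ′ φ′ G = rename-ext {φ = θ ∘′ φ} {ψ = θ′ ∘′ φ′} G

rename-inverse : (φ : V → W) (ψ : W → V) (G : CohGraph V) → (∀ v → ψ (φ v) ≡ v) → rename ψ (rename φ G) ≅ G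
rename-inverse φ ψ G = rename-id {φ = ψ ∘′ φ} G

map₂-inj₂-injective : Inj (Sum.map₂ {A = A} (inj₂ {A = B} {B = C}))
map₂-inj₂-injective = map-inj id inj₂-injective

∷∷-map : (φ : P ↔ P′) (χ : Q ↔ Q′) (ψ : R ↔ R′) (F : CohGraph (P ⊎ Q)) {F′ : CohGraph (P′ ⊎ Q′)}
         (G : CohGraph (Q ⊎ R)) {G′ : CohGraph (Q′ ⊎ R′)} →
         rename (Sum.map (Inverse.to φ) (Inverse.to χ)) F ≅ F′ →
         rename (Sum.map (Inverse.to χ) (Inverse.to ψ)) G ≅ G′ →
         rename (Sum.map (Inverse.to φ) (Inverse.to ψ)) (F ∷∷ G) ≅ F′ ∷∷ G′
∷∷-map φ χ ψ F {F′} G {G′} i j = exec-map θ-inj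
  (plugging-cong θ
    (≅-trans (rename-square θ (Sum.map₂ inj₁) (Sum.map₂ inj₁) (Sum.map φ.to χ.to) F
      λ { (inj₁ _) → refl ; (inj₂ _) → refl }) (rename-cong (Sum.map₂ inj₁) i))
    (≅-trans (rename-square θ inj₂ inj₂ (Sum.map χ.to ψ.to) G
      λ { (inj₁ _) → refl ; (inj₂ _) → refl }) (rename-cong inj₂ j)))
  map₂-inj₂-injective map₂-inj₂-injective (⊎-cong φ ψ) (λ { (inj₁ _) → refl ; (inj₂ _) → refl })
  where
  module φ = Inverse φ
  module χ = Inverse χ
  module ψ = Inverse ψ
  θ = Sum.map φ.to (Sum.map χ.to ψ.to)
  θ-inj : Inj θ
  θ-inj = map-inj (↔-inj φ) (map-inj (↔-inj χ) (↔-inj ψ))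

∷∷-cong : {F F′ : CohGraph (P ⊎ Q)} {G G′ : CohGraph (Q ⊎ R)} → F ≅ F′ → G ≅ G′ → F ∷∷ G ≅ F′ ∷∷ G′
∷∷-cong {F = F} {F′} {G} {G′} i j = exec-map {θ = id} id
  (plugging-cong id (rename-cong (Sum.map₂ inj₁) i) (rename-cong inj₂ j))
  map₂-inj₂-injective map₂-inj₂-injective (↔-id _) (λ _ → refl)

∷∷-swap : (F : CohGraph (P ⊎ Q)) (G : CohGraph (Q ⊎ R)) →
          rename Sum.swap (F ∷∷ G) ≅ rename Sum.swap G ∷∷ rename Sum.swap F
∷∷-swap {P = P} {Q = Q} {R = R} F G = exec-map θ-inj
  (plugging-comm θ (rename-square θ (Sum.map₂ inj₁) inj₂ Sum.swap F λ { (inj₁ _) → refl ; (inj₂ _) → refl })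
                   (rename-square θ inj₂ (Sum.map₂ inj₁) Sum.swap G λ { (inj₁ _) → refl ; (inj₂ _) → refl }))
  map₂-inj₂-injective map₂-inj₂-injective (⊎-comm P R) (λ { (inj₁ _) → refl ; (inj₂ _) → refl })
  where
  θ : P ⊎ (Q ⊎ R) → R ⊎ (Q ⊎ P)
  θ (inj₁ p)        = inj₂ (inj₂ p)
  θ (inj₂ (inj₁ q)) = inj₂ (inj₁ q)
  θ (inj₂ (inj₂ r)) = inj₁ r
  θ-inj : Inj θ
  θ-inj {inj₁ _} {inj₁ _} refl = refl
  θ-inj {inj₁ _} {inj₂ (inj₁ _)} ()
  θ-inj {inj₁ _} {inj₂ (inj₂ _)} ()
  θ-inj {inj₂ (inj₁ _)} {inj₁ _} ()
  θ-inj {inj₂ (inj₂ _)} {inj₁ _} ()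
  θ-inj {inj₂ (inj₁ _)} {inj₂ (inj₁ _)} refl = refl
  θ-inj {inj₂ (inj₂ _)} {inj₂ (inj₂ _)} refl = refl
  θ-inj {inj₂ (inj₁ _)} {inj₂ (inj₂ _)} ()
  θ-inj {inj₂ (inj₂ _)} {inj₂ (inj₁ _)} ()

-- The flat form treats the two outer graphs alike, and `∷∷-swap` turns the right bracketing into
-- the left bracketing of the reversed chain. One flattening therefore serves both bracketings, up
-- to a renaming `θ` of the flat vertices.
∷∷-assoc : (F : CohGraph (P ⊎ Q)) (G : CohGraph (Q ⊎ R)) (H : CohGraph (R ⊎ S)) →
           (F ∷∷ G) ∷∷ H ≅ F ∷∷ (G ∷∷ H)
∷∷-assoc {P = P} {Q = Q} {R = R} {S = S} F G H = ≅-trans (Flattening.flat-≅ F G H) (≅-sym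
  (≅-trans (≅-sym (rename-inverse Sum.swap Sum.swap (F ∷∷ (G ∷∷ H)) swap-involutive))
  (≅-trans (rename-cong Sum.swap {rename Sum.swap (F ∷∷ (G ∷∷ H))} {reversed}
    (≅-trans (∷∷-swap F (G ∷∷ H))
    (≅-trans (∷∷-cong {F = rename Sum.swap (G ∷∷ H)} {Hᵒ ∷∷ Gᵒ} {Fᵒ} {Fᵒ} (∷∷-swap G H) ≅-refl)
    (Flattening.flat-≅ Hᵒ Gᵒ Fᵒ))))
  (exec-map θ-inj
    (plugging-cong θ
      (≅-trans (rename-□ θ (rename inj₁ Hᵒ) (rename inj₂ Fᵒ)) (≅-trans (□-comm _ _) (□-cong
        (rename-ext {φ = θ ∘′ inj₂ ∘′ Sum.swap} {ψ = inj₁} F λ { (inj₁ _) → refl ; (inj₂ _) → refl })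
        (rename-ext {φ = θ ∘′ inj₁ ∘′ Sum.swap} {ψ = inj₂} H λ { (inj₁ _) → refl ; (inj₂ _) → refl }))))
      (rename-ext {φ = θ ∘′ Sum.map inj₂ inj₁ ∘′ Sum.swap} {ψ = Sum.map inj₂ inj₁} G
        λ { (inj₁ _) → refl ; (inj₂ _) → refl }))
    (map-inj inj₁-injective inj₂-injective) (map-inj inj₁-injective inj₂-injective)
    (⊎-comm S P) (λ { (inj₁ _) → refl ; (inj₂ _) → refl })))))
  where
  Fᵒ = rename Sum.swap F
  Gᵒ = rename Sum.swap G
  Hᵒ = rename Sum.swap H
  reversed : CohGraph (S ⊎ P)
  reversed = exec (Sum.map inj₁ inj₂) (Hᵒ ⊗ᴳ Fᵒ) (rename (Sum.map inj₂ inj₁) Gᵒ)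
  θ : (S ⊎ R) ⊎ (Q ⊎ P) → (P ⊎ Q) ⊎ (R ⊎ S)
  θ x = Sum.swap (Sum.map Sum.swap Sum.swap x)
  swap-inj : {A B : Set ℓ} → Inj (Sum.swap {A = A} {B = B})
  swap-inj {A = A} {B} = ↔-inj (⊎-comm A B)
  θ-inj : Inj θ
  θ-inj eq = map-inj swap-inj swap-inj (swap-inj eq)

-- Wires and composition with them.

wire : {V W : Set ℓ} → V ↔ W → CohGraph (V ⊎ W)
wire {V = V} φ = record
  { E = V ⊎ V
  ; s = [ inj₁ , inj₂ ∘′ Inverse.to φ ]
  ; t = [ inj₂ ∘′ Inverse.to φ , inj₁ ]
  ; _≍_ = λ _ _ → ⊤ₗ ; ≍-refl = ttₗ ; ≍-sym = λ _ → ttₗ ; ≍-irrelevant = λ _ _ → refl }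

module _ {ℓ} {P Q R : Set ℓ} (F : CohGraph (P ⊎ Q)) (φ : Q ↔ R) where
  private
    open ExecEdge
    module φ = Inverse φ

    Fⁱ Wⁱ : CohGraph (P ⊎ (Q ⊎ R))
    Fⁱ = rename (Sum.map₂ inj₁) F
    Wⁱ = rename inj₂ (wire φ)

    border : P ⊎ R → P ⊎ (Q ⊎ R)
    border = Sum.map₂ inj₂

    moved : P ⊎ Q → P ⊎ R
    moved = Sum.map₂ φ.to

    enter : P ⊎ Q → Bool
    enter (inj₁ _) = true
    enter (inj₂ _) = false

    before after : P ⊎ Q → List (E F ⊎ (Q ⊎ Q))
    before (inj₁ _) = []
    before (inj₂ q) = inj₂ (inj₂ q) ∷ []
    after (inj₁ _) = []
    after (inj₂ q) = inj₂ (inj₁ q) ∷ []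

    -- The only path of `F ∷∷ wire φ` through `e`: a wire edge is attached at each end that lies in
    -- Q, and nothing at an end in P.
    around : E F → List (E F ⊎ (Q ⊎ Q))
    around e = before (s F e) ++ inj₁ e ∷ after (t F e)

    WireWalk : (P ⊎ (Q ⊎ R)) × Bool → List (E F ⊎ (Q ⊎ Q)) → (P ⊎ (Q ⊎ R)) × Bool → Set ℓ
    WireWalk = AltWalk Fⁱ Wⁱ

    before-walk : ∀ x → WireWalk (border (moved x) , enter x) (before x) (Sum.map₂ inj₁ x , true)
    before-walk (inj₁ _) = stop refl
    before-walk (inj₂ _) = refl ∷ stop refl

    after-walk : ∀ x → WireWalk (Sum.map₂ inj₁ x , false) (after x) (border (moved x) , not (enter x))
    after-walk (inj₁ _) = stop refl
    after-walk (inj₂ _) = refl ∷ stop refl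

    around-walk : ∀ e → WireWalk (border (moved (s F e)) , enter (s F e)) (around e)
                  (border (moved (t F e)) , not (enter (t F e)))
    around-walk e = before-walk (s F e) ++ʷ refl ∷ after-walk (t F e)

    around-≢[] : ∀ e → around e ≢ []
    around-≢[] e eq with () ← ++-conicalʳ (before (s F e)) _ eq

    around-inj : Inj around
    around-inj {e} {e′} = go (s F e) (s F e′)
      where
      go : ∀ x x′ → before x ++ inj₁ e ∷ after (t F e) ≡ before x′ ++ inj₁ e′ ∷ after (t F e′) → e ≡ e′
      go (inj₁ _) (inj₁ _) eq = inj₁-injective (∷-injectiveˡ eq)
      go (inj₂ _) (inj₂ _) eq = inj₁-injective (∷-injectiveˡ (∷-injectiveʳ eq))
      go (inj₁ _) (inj₂ _) eq with () ← ∷-injectiveˡ eq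
      go (inj₂ _) (inj₁ _) eq with () ← ∷-injectiveˡ eq

    -- No wire starts in P, so the path stops there. From Q it has to take the wire forward to R,
    -- where `F` has no edge to continue with.
    after-unique : ∀ x w {es c} → WireWalk (Sum.map₂ inj₁ x , false) es (border w , c) → es ≡ after x
    after-unique (inj₁ _) w (stop _) = refl
    after-unique (inj₁ _) w (_∷_ {e = inj₁ _} () _)
    after-unique (inj₁ _) w (_∷_ {e = inj₂ _} () _)
    after-unique (inj₂ _) (inj₁ _) (stop ())
    after-unique (inj₂ _) (inj₂ _) (stop ())
    after-unique (inj₂ _) w (_∷_ {e = inj₁ _} () _)
    after-unique (inj₂ _) w (_∷_ {e = inj₂ (inj₁ q)} refl (stop _)) = refl
    after-unique (inj₂ _) w (_∷_ {e = inj₂ (inj₁ q)} refl (_∷_ {e = inj₂ _} () _))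
    after-unique (inj₂ _) w (_∷_ {e = inj₂ (inj₁ q)} refl (_∷_ {e = inj₁ e} eq _)) with s F e
    ... | inj₁ _ with () ← eq
    ... | inj₂ _ with () ← eq
    after-unique (inj₂ _) w (_∷_ {e = inj₂ (inj₂ q)} () _)

    from-source : ∀ e x w {es c} → s F e ≡ x → WireWalk (Sum.map₂ inj₁ (t F e) , false) es (border w , c) →
                  before x ++ inj₁ e ∷ es ≡ around e
    from-source e x w refl p = cong (λ es → before x ++ inj₁ e ∷ es) (after-unique (t F e) w p)

    around-all : ∀ w b v {es c} → es ≢ [] → WireWalk (border w , b) es (border v , c) → ∃[ e ] around e ≡ es
    around-all w b v ne (stop _) = contradiction refl ne
    around-all w b v _ (_∷_ {e = inj₁ e} eq p) = e , sym (start (s F e) w refl (cong proj₁ eq))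
      where
      start : ∀ x w → s F e ≡ x → Sum.map₂ inj₁ x ≡ border w → _ ≡ around e
      start (inj₁ _) (inj₁ _) s≡ _ = from-source e _ v s≡ p
      start (inj₁ _) (inj₂ _) _ ()
      start (inj₂ _) (inj₁ _) _ ()
      start (inj₂ _) (inj₂ _) _ ()
    around-all (inj₁ _) b v _ (_∷_ {e = inj₂ (inj₁ _)} () _)
    around-all (inj₂ _) b v _ (_∷_ {e = inj₂ (inj₁ _)} () _)
    around-all w b v _ (_∷_ {e = inj₂ (inj₂ q)} _ (_∷_ {e = inj₂ _} () _))
    around-all w b (inj₁ _) _ (_∷_ {e = inj₂ (inj₂ q)} _ (stop ()))
    around-all w b (inj₂ _) _ (_∷_ {e = inj₂ (inj₂ q)} _ (stop ()))
    around-all w b v _ (_∷_ {e = inj₂ (inj₂ q)} _ (_∷_ {e = inj₁ e} eq p)) = e , sym (start (s F e) refl (cong proj₁ eq))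
      where
      start : ∀ x → s F e ≡ x → Sum.map₂ inj₁ x ≡ inj₂ (inj₁ q) → _ ≡ around e
      start (inj₂ _) s≡ refl = from-source e _ v s≡ p

    border-inj : Inj border
    border-inj = map₂-inj₂-injective

    -- Wire edges are coherent with everything, so only `e` and `e′` matter.
    around-coh : ∀ e e′ → F [ e ≍ e′ ] ⇔ (Fⁱ □ Wⁱ) [ around e ≍* around e′ ]
    around-coh e e′ = mk⇔
      (λ c → All.++⁺ (wires (before-wires (s F e)) _) (row c ∷ wires (after-wires (t F e)) _))
      (λ c → All.head (All.++⁻ʳ (before (s F e′)) (All.head (All.++⁻ʳ (before (s F e)) c))))
      where
      IsWire : E F ⊎ (Q ⊎ Q) → Set ℓ
      IsWire x = ∀ y → (Fⁱ □ Wⁱ) [ x ≍ y ]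
      isWire : ∀ k → IsWire (inj₂ k)
      isWire k (inj₁ _) = ttₗ
      isWire k (inj₂ _) = ttₗ
      before-wires : ∀ x → All IsWire (before x)
      before-wires (inj₁ _) = []
      before-wires (inj₂ q) = isWire _ ∷ []
      after-wires : ∀ x → All IsWire (after x)
      after-wires (inj₁ _) = []
      after-wires (inj₂ q) = isWire _ ∷ []
      wires : ∀ {xs} → All IsWire xs → ∀ ys → (Fⁱ □ Wⁱ) [ xs ≍* ys ]
      wires ws ys = All.map (λ w → All.universal w ys) ws
      row : F [ e ≍ e′ ] → All ((Fⁱ □ Wⁱ) [ inj₁ e ≍_]) (around e′)
      row c = All.++⁺ (All.map (λ {x} w → CohGraph.≍-sym (Fⁱ □ Wⁱ) {x} {inj₁ e} (w _)) (before-wires (s F e′)))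
        (c ∷ All.map (λ {x} w → CohGraph.≍-sym (Fⁱ □ Wⁱ) {x} {inj₁ e} (w _)) (after-wires (t F e′)))

    image : (e : E F) →
            Σ[ y ∈ E (F ∷∷ wire φ) ] src y ≡ moved (s F e) × tgt y ≡ moved (t F e) × trace y ≡ around e
    image e = fromTrace (around-≢[] e) (around-walk e) (⇒ (around-coh e e) (CohGraph.≍-refl F))

    f : E F → E (F ∷∷ wire φ)
    f e = proj₁ (image e)

    trace-f : ∀ e → trace (f e) ≡ around e
    trace-f e = proj₂ (proj₂ (proj₂ (image e)))

  ∷∷-wire : F ∷∷ wire φ ≅ rename (Sum.map₂ (Inverse.to φ)) F
  ∷∷-wire = ≅-sym (mk≅ f
    (λ {e} {e′} eq → around-inj (trans (sym (trace-f e)) (trans (cong trace eq) (trace-f e′))))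
    (λ y → let e , eq = around-all (src y) _ (tgt y) (trace-nonempty y) (trace-walk y)
           in e , trace-injective border-inj (trans (trace-f e) eq))
    (λ e → proj₁ (proj₂ (image e))) (λ e → proj₁ (proj₂ (proj₂ (image e))))
    (λ e e′ → mk⇔
      (λ c → subst₂ ((Fⁱ □ Wⁱ) [_≍*_]) (sym (trace-f e)) (sym (trace-f e′)) (⇒ (around-coh e e′) c))
      (λ c → ⇐ (around-coh e e′) (subst₂ ((Fⁱ □ Wⁱ) [_≍*_]) (trace-f e) (trace-f e′) c))))

-- Seen from the other end, a forward edge of the wire is a backward one; hence the exchange of the
-- two summands of the edge set.
wire-swap : {V W : Set ℓ} (φ : V ↔ W) → rename Sum.swap (wire φ) ≅ wire (↔-sym φ)
wire-swap φ = mk≅ (λ { (inj₁ v) → inj₂ (φ.to v) ; (inj₂ v) → inj₁ (φ.to v) })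
  (λ { {inj₁ _} {inj₁ _} eq → cong inj₁ (↔-inj φ (inj₂-injective eq))
     ; {inj₂ _} {inj₂ _} eq → cong inj₂ (↔-inj φ (inj₁-injective eq)) })
  (λ { (inj₁ w) → inj₂ (φ.from w) , cong inj₁ (φ.strictlyInverseˡ w)
     ; (inj₂ w) → inj₁ (φ.from w) , cong inj₂ (φ.strictlyInverseˡ w) })
  (λ { (inj₁ v) → cong inj₂ (φ.strictlyInverseʳ v) ; (inj₂ v) → refl })
  (λ { (inj₁ v) → refl ; (inj₂ v) → cong inj₂ (φ.strictlyInverseʳ v) })
  (λ _ _ → mk⇔ id id)
  where module φ = Inverse φ

wire-∷∷ : {P Q R : Set ℓ} (φ : P ↔ Q) (G : CohGraph (Q ⊎ R)) →
          wire φ ∷∷ G ≅ rename (Sum.map₁ (Inverse.from φ)) G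
wire-∷∷ φ G =
  ≅-trans (≅-sym (rename-inverse Sum.swap Sum.swap (wire φ ∷∷ G) swap-involutive))
  (≅-trans (rename-cong Sum.swap (≅-trans (∷∷-swap (wire φ) G)
    (≅-trans (∷∷-cong (≅-refl {G = rename Sum.swap G}) (wire-swap φ)) (∷∷-wire (rename Sum.swap G) (↔-sym φ)))))
  (rename-ext {φ = Sum.swap ∘′ Sum.map₂ φ.from ∘′ Sum.swap} {ψ = Sum.map₁ φ.from} G
    λ { (inj₁ _) → refl ; (inj₂ _) → refl }))
  where module φ = Inverse φ

wire-cong : {V W : Set ℓ} (φ ψ : V ↔ W) → (∀ v → Inverse.to φ v ≡ Inverse.to ψ v) → wire φ ≅ wire ψ
wire-cong φ ψ eq = mk≅ id id (λ y → y , refl)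
  (λ { (inj₁ _) → refl ; (inj₂ v) → cong inj₂ (sym (eq v)) })
  (λ { (inj₁ v) → cong inj₂ (sym (eq v)) ; (inj₂ _) → refl })
  (λ _ _ → mk⇔ id id)

wire-∘ : {P Q R : Set ℓ} (φ : P ↔ Q) (ψ : Q ↔ R) → wire φ ∷∷ wire ψ ≅ wire (ψ ↔-∘ φ)
wire-∘ φ ψ = ≅-trans (∷∷-wire (wire φ) ψ) (mk≅ id id (λ y → y , refl)
  (λ { (inj₁ _) → refl ; (inj₂ v) → refl }) (λ { (inj₁ v) → refl ; (inj₂ _) → refl }) (λ _ _ → mk⇔ id id))

-- The monoidal product of morphisms.

interchange↔ : ((A ⊎ B) ⊎ (C ⊎ D)) ↔ ((A ⊎ C) ⊎ (B ⊎ D))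
interchange↔ = mk↔ₛ′ interchange interchange
  (λ { (inj₁ (inj₁ _)) → refl ; (inj₁ (inj₂ _)) → refl ; (inj₂ (inj₁ _)) → refl ; (inj₂ (inj₂ _)) → refl })
  (λ { (inj₁ (inj₁ _)) → refl ; (inj₁ (inj₂ _)) → refl ; (inj₂ (inj₁ _)) → refl ; (inj₂ (inj₂ _)) → refl })

infixr 7 _⊠_

_⊠_ : {P Q P′ Q′ : Set ℓ} → CohGraph (P ⊎ Q) → CohGraph (P′ ⊎ Q′) → CohGraph ((P ⊎ P′) ⊎ (Q ⊎ Q′))
F ⊠ G = rename interchange (F ⊗ᴳ G)

wire-⊠ : {P Q R S : Set ℓ} (φ : P ↔ Q) (ψ : R ↔ S) → wire φ ⊠ wire ψ ≅ wire (⊎-cong φ ψ)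
wire-⊠ φ ψ = mk≅ interchange (↔-inj interchange↔)
  (λ y → interchange y , Inverse.strictlyInverseˡ interchange↔ y)
  (λ { (inj₁ (inj₁ y)) → refl ; (inj₁ (inj₂ y)) → refl ; (inj₂ (inj₁ y)) → refl ; (inj₂ (inj₂ y)) → refl })
  (λ { (inj₁ (inj₁ y)) → refl ; (inj₁ (inj₂ y)) → refl ; (inj₂ (inj₁ y)) → refl ; (inj₂ (inj₂ y)) → refl })
  (λ { (inj₁ _) (inj₁ _) → mk⇔ id id ; (inj₁ _) (inj₂ _) → mk⇔ id id
     ; (inj₂ _) (inj₁ _) → mk⇔ id id ; (inj₂ _) (inj₂ _) → mk⇔ id id })

-- Once `exec-⊗` has merged the two executions, both sides execute the same four graphs, with
-- vertices placed differently; `θ` relates the placements.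
∷∷-⊠ : {P Q R P′ Q′ R′ : Set ℓ} (F : CohGraph (P ⊎ Q)) (G : CohGraph (Q ⊎ R)) (F′ : CohGraph (P′ ⊎ Q′))
       (G′ : CohGraph (Q′ ⊎ R′)) →
       (F ∷∷ G) ⊠ (F′ ∷∷ G′) ≅ (F ⊠ F′) ∷∷ (G ⊠ G′)
∷∷-⊠ {P = P} {Q} {R} {P′} {Q′} {R′} F G F′ G′ = ≅-trans
  (rename-cong interchange (exec-⊗ (rename (Sum.map₂ inj₁) F) (rename inj₂ G) (rename (Sum.map₂ inj₁) F′) (rename inj₂ G′)
    map₂-inj₂-injective map₂-inj₂-injective))
  (exec-map θ-inj
    (plugging-cong θ
      (≅-trans (rename-□ θ _ _) (≅-trans (□-cong
        (rename-ext {φ = θ ∘′ inj₁ ∘′ Sum.map₂ inj₁} {ψ = Sum.map₂ inj₁ ∘′ interchange ∘′ inj₁} F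
          λ { (inj₁ _) → refl ; (inj₂ _) → refl })
        (rename-ext {φ = θ ∘′ inj₂ ∘′ Sum.map₂ inj₁} {ψ = Sum.map₂ inj₁ ∘′ interchange ∘′ inj₂} F′
          λ { (inj₁ _) → refl ; (inj₂ _) → refl }))
        (≅-sym (rename-□ (Sum.map₂ inj₁ ∘′ interchange) (rename inj₁ F) (rename inj₂ F′)))))
      (≅-trans (rename-□ θ _ _) (≅-trans (□-cong
        (rename-ext {φ = θ ∘′ inj₁ ∘′ inj₂} {ψ = inj₂ ∘′ interchange ∘′ inj₁} G
          λ { (inj₁ _) → refl ; (inj₂ _) → refl })
        (rename-ext {φ = θ ∘′ inj₂ ∘′ inj₂} {ψ = inj₂ ∘′ interchange ∘′ inj₂} G′
          λ { (inj₁ _) → refl ; (inj₂ _) → refl }))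
        (≅-sym (rename-□ (inj₂ ∘′ interchange) (rename inj₁ G) (rename inj₂ G′))))))
    (map-inj map₂-inj₂-injective map₂-inj₂-injective) map₂-inj₂-injective interchange↔
    λ { (inj₁ (inj₁ _)) → refl ; (inj₁ (inj₂ _)) → refl ; (inj₂ (inj₁ _)) → refl ; (inj₂ (inj₂ _)) → refl })
  where
  θ : (P ⊎ (Q ⊎ R)) ⊎ (P′ ⊎ (Q′ ⊎ R′)) → (P ⊎ P′) ⊎ ((Q ⊎ Q′) ⊎ (R ⊎ R′))
  θ x = Sum.map₂ interchange (interchange x)
  θ-inj : Inj θ
  θ-inj eq = ↔-inj interchange↔ (map-inj id (↔-inj interchange↔) eq)

-- The edgeless graph and rules for orthogonality.

∅ᴳ : CohGraph V
∅ᴳ = record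
  { E = ⊥ₗ ; s = λ () ; t = λ () ; _≍_ = λ () ; ≍-refl = λ { {()} } ; ≍-sym = λ { {()} } ; ≍-irrelevant = λ { {()} } }

∅-⊗ : {V W : Set ℓ} → ∅ᴳ {V = V} ⊗ᴳ ∅ᴳ {V = W} ≅ ∅ᴳ
∅-⊗ = mk≅ (λ { (inj₁ ()) ; (inj₂ ()) }) (λ { {inj₁ ()} ; {inj₂ ()} }) (λ ())
  (λ { (inj₁ ()) ; (inj₂ ()) }) (λ { (inj₁ ()) ; (inj₂ ()) }) (λ { (inj₁ ()) ; (inj₂ ()) })

⊗-∅ : {V W : Set ℓ} (G : CohGraph V) → rename inj₁ G ≅ G ⊗ᴳ ∅ᴳ {V = W}
⊗-∅ G = mk≅ inj₁ inj₁-injective (λ { (inj₁ e) → e , refl }) (λ _ → refl) (λ _ → refl) (λ _ _ → mk⇔ id id)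

⊗-comm : {V W : Set ℓ} (G : CohGraph V) (H : CohGraph W) → rename Sum.swap (G ⊗ᴳ H) ≅ H ⊗ᴳ G
⊗-comm G H = ≅-trans (rename-□ Sum.swap _ _) (□-comm _ _)

rename-⊗ : {V W V′ W′ : Set ℓ} (φ : V → V′) (ψ : W → W′) (G : CohGraph V) (H : CohGraph W) →
           rename (Sum.map φ ψ) (G ⊗ᴳ H) ≅ rename φ G ⊗ᴳ rename ψ H
rename-⊗ φ ψ G H = rename-□ (Sum.map φ ψ) (rename inj₁ G) (rename inj₂ H)

⫫-cong : {G G′ H H′ : CohGraph V} → G ≅ G′ → H ≅ H′ → G ⫫ H → G′ ⫫ H′
⫫-cong i j = ⫫-map {θ = id} id (plugging-cong id i j)

⫫-congʳ : {G H H′ : CohGraph V} → H ≅ H′ → G ⫫ H → G ⫫ H′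
⫫-congʳ {G = G} = ⫫-cong (≅-refl {G = G})

⫫-congˡ : {G G′ H : CohGraph V} → G ≅ G′ → G ⫫ H → G′ ⫫ H
⫫-congˡ {H = H} i = ⫫-cong i (≅-refl {G = H})

⫫-swap : {G H : CohGraph V} → G ⫫ H → H ⫫ G
⫫-swap {G = G} {H} G⫫H = ⟂⇒⫫ (⟂-sym H G (⫫⇒⟂ G⫫H))

⫫-transpose : (φ : V ↔ W) {G : CohGraph V} {H : CohGraph W} →
              (G ⫫ rename (Inverse.from φ) H) ⇔ (rename (Inverse.to φ) G ⫫ H)
⫫-transpose φ {G} {H} = mk⇔ (⫫-map (↔-inj φ) p) (⫫-map⁻ (↔-inj φ) p)
  where
  module φ = Inverse φ
  p : Plugging≅ φ.to G (rename φ.from H) (rename φ.to G) H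
  p = plugging-cong φ.to (≅-refl {G = rename φ.to G}) (rename-inverse φ.from φ.to H φ.strictlyInverseˡ)

-- After an edge of `H` the state asks for an edge of the edgeless graph, so a walk of length one
-- does not close up and a longer one does not exist.
∅-⫫ : {H : CohGraph V} → ∅ᴳ ⫫ H
∅-⫫ {H = H} = acyclic λ
  { (_ , _ , ne , stop _ , _) → ne refl
  ; (_ , _ , _ , (_∷_ {e = inj₂ _} refl (stop ())) , _)
  ; (_ , _ , _ , (_∷_ {e = inj₂ _} _ (_∷_ {e = inj₂ _} () _)) , _) }

-- The adjunction between tensoring and execution.

infixr 5 _▷_
infixl 5 _◁_

opaque
  -- Application of a morphism to an element. Viewing `a` as a morphism out of the empty vertex set
  -- makes `_∷∷_` and its laws available; the empty summand is removed afterwards.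
  _▷_ : {P Q : Set ℓ} → CohGraph P → CohGraph (P ⊎ Q) → CohGraph Q
  _▷_ {ℓ} a F = rename [ ⊥-elimₗ , id ] (rename (inj₂ {A = ⊥ₗ {ℓ}}) a ∷∷ F)

_◁_ : {P Q : Set ℓ} → CohGraph (P ⊎ Q) → CohGraph Q → CohGraph P
F ◁ x = x ▷ rename Sum.swap F

module _ {ℓ} {P Q : Set ℓ} (F : CohGraph (P ⊎ Q)) (a : CohGraph P) where
  private
    ⊥′ : Set ℓ
    ⊥′ = ⊥ₗ
    a′ : CohGraph (⊥′ ⊎ P)
    a′ = rename inj₂ a
    -- The chain runs over the empty set, P, Q and the empty set: its flat plugging is `a ⊗ᴳ x`
    -- against `F`, its outer plugging is `a ▷ F` against `x`.
    module Flat (x : CohGraph Q) = Flattening a′ F (rename (inj₁ {B = ⊥′}) x)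

    plugged : ∀ x → Plugging≅ (Sum.map inj₂ inj₁) (a ⊗ᴳ x) F (a′ ⊗ᴳ rename inj₁ x) (Flat.Gᵗ x)
    plugged x = plugging-cong (Sum.map inj₂ inj₁) (rename-⊗ inj₂ inj₁ a x) (≅-refl {G = Flat.Gᵗ x})

    ends-inj : Inj (inj₂ {A = ⊥′} ∘′ inj₁ {A = Q} {B = ⊥′})
    ends-inj refl = refl

    opaque
      unfolding _▷_

      result : ∀ x → Plugging≅ (inj₂ {A = ⊥′} ∘′ inj₁ {B = ⊥′}) (a ▷ F) x (Flat.FG x) (Flat.H° x)
      result x = plugging-cong (inj₂ ∘′ inj₁)
        (rename-ext {φ = inj₂ ∘′ inj₁ ∘′ [ ⊥-elimₗ , id ]} {ψ = Sum.map₂ inj₁} (a′ ∷∷ F) (λ { (inj₂ _) → refl }))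
        (≅-refl {G = Flat.H° x})

  ▷-⫫ : ∀ {x} → F ⫫ a ⊗ᴳ x → a ▷ F ⫫ x
  ▷-⫫ {x} ⫫F = ⫫-map⁻ ends-inj (result x) (Flat.flat-⫫ x
    (⫫-map (map-inj inj₂-injective inj₁-injective) (plugged x) (⫫-swap ⫫F)))

  -- The first hypothesis excludes the cycles that avoid Q, which are lost in a ▷ F.
  ⫫-▷ : ∀ {x} → F ⫫ a ⊗ᴳ ∅ᴳ → a ▷ F ⫫ x → F ⫫ a ⊗ᴳ x
  ⫫-▷ {x} ⫫∅ ⫫x = ⫫-swap (⫫-map⁻ (map-inj inj₂-injective inj₁-injective) (plugged x) (Flat.unflat-⫫ x
    (⫫-map {θ = inj₂ {A = ⊥′}} inj₂-injective
      (plugging-cong inj₂ (rename-cong inj₂ (≅-sym (⊗-∅ a))) (≅-refl {G = rename inj₂ F})) (⫫-swap ⫫∅))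
    (⫫-map ends-inj (result x) ⫫x)))

module _ {ℓ} {P Q : Set ℓ} (F : CohGraph (P ⊎ Q)) {a : CohGraph P} (x : CohGraph Q) where
  private
    p : ∀ a → Plugging≅ Sum.swap F (a ⊗ᴳ x) (rename Sum.swap F) (x ⊗ᴳ a)
    p a = plugging-cong Sum.swap (≅-refl {G = rename Sum.swap F}) (⊗-comm a x)

  ◁-⫫ : F ⫫ a ⊗ᴳ x → F ◁ x ⫫ a
  ◁-⫫ ⫫F = ▷-⫫ (rename Sum.swap F) x (⫫-map (↔-inj (⊎-comm P Q)) (p a) ⫫F)

  ⫫-◁ : F ⫫ ∅ᴳ ⊗ᴳ x → F ◁ x ⫫ a → F ⫫ a ⊗ᴳ x
  ⫫-◁ ⫫∅ ⫫a = ⫫-map⁻ (↔-inj (⊎-comm P Q)) (p a)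
    (⫫-▷ (rename Sum.swap F) x (⫫-map (↔-inj (⊎-comm P Q)) (p ∅ᴳ) ⫫∅) ⫫a)

⫫-∅⊗∅ : {P Q : Set ℓ} {F : CohGraph (P ⊎ Q)} → F ⫫ ∅ᴳ ⊗ᴳ ∅ᴳ
⫫-∅⊗∅ = ⫫-congʳ (≅-sym ∅-⊗) (⫫-swap ∅-⫫)

opaque
  unfolding _▷_

  ▷-cong : {P Q : Set ℓ} {a a′ : CohGraph P} {F F′ : CohGraph (P ⊎ Q)} → a ≅ a′ → F ≅ F′ → a ▷ F ≅ a′ ▷ F′
  ▷-cong {a = a} {a′} {F} {F′} i j = rename-cong [ ⊥-elimₗ , id ] {rename inj₂ a ∷∷ F} {rename inj₂ a′ ∷∷ F′}
    (∷∷-cong {F = rename inj₂ a} {rename inj₂ a′} {F} {F′} (rename-cong inj₂ i) j)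

  ▷-∷∷ : {P Q R : Set ℓ} (a : CohGraph P) (F : CohGraph (P ⊎ Q)) (G : CohGraph (Q ⊎ R)) →
         (a ▷ F) ▷ G ≅ a ▷ (F ∷∷ G)
  ▷-∷∷ a F G = rename-cong [ ⊥-elimₗ , id ] {rename inj₂ (a ▷ F) ∷∷ G} {rename inj₂ a ∷∷ (F ∷∷ G)} (≅-trans
    (∷∷-cong {F = rename inj₂ (a ▷ F)} {rename inj₂ a ∷∷ F} {G} {G}
      (rename-inverse [ ⊥-elimₗ , id ] inj₂ (rename inj₂ a ∷∷ F) (λ { (inj₂ _) → refl })) (≅-refl {G = G}))
    (∷∷-assoc (rename inj₂ a) F G))

  ▷-wire : {P Q : Set ℓ} (a : CohGraph P) (φ : P ↔ Q) → a ▷ wire φ ≅ rename (Inverse.to φ) a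
  ▷-wire a φ = rename-cong [ ⊥-elimₗ , id ] (∷∷-wire (rename inj₂ a) φ)

module _ {ℓ} {P Q P′ Q′ : Set ℓ} (a : CohGraph P) (a′ : CohGraph P′) (F : CohGraph (P ⊎ Q))
    (F′ : CohGraph (P′ ⊎ Q′)) where
  private
    strip : ∀ {A : Set ℓ} → ⊥ₗ {ℓ} ⊎ A → A
    strip = [ ⊥-elimₗ , id ]

    ⊥⊎⊥ : (⊥ₗ {ℓ} ⊎ ⊥ₗ {ℓ}) ↔ ⊥ₗ {ℓ}
    ⊥⊎⊥ = mk↔ₛ′ strip inj₂ (λ _ → refl) (λ { (inj₂ _) → refl })

    aᵉ = rename (inj₂ {A = ⊥ₗ {ℓ}}) a
    a′ᵉ = rename (inj₂ {A = ⊥ₗ {ℓ}}) a′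
    A⊗F = (aᵉ ∷∷ F) ⊗ᴳ (a′ᵉ ∷∷ F′)
    A⊠F = (aᵉ ∷∷ F) ⊠ (a′ᵉ ∷∷ F′)
    A⊠ = aᵉ ⊠ a′ᵉ
    F⊠ = F ⊠ F′

    step₁ : rename strip (aᵉ ∷∷ F) ⊗ᴳ rename strip (a′ᵉ ∷∷ F′) ≅ rename (Sum.map strip strip) A⊗F
    step₁ = ≅-sym (rename-⊗ strip strip (aᵉ ∷∷ F) (a′ᵉ ∷∷ F′))

    step₂ : rename (Sum.map strip strip) A⊗F ≅ rename (strip ∘′ Sum.map strip id) A⊠F
    step₂ = rename-ext {φ = Sum.map strip strip} {ψ = strip ∘′ Sum.map strip id ∘′ interchange} A⊗F
      (λ { (inj₁ (inj₂ _)) → refl ; (inj₂ (inj₂ _)) → refl })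

    step₃ : rename (strip ∘′ Sum.map strip id) A⊠F ≅ rename (strip ∘′ Sum.map strip id) (A⊠ ∷∷ F⊠)
    step₃ = rename-cong (strip ∘′ Sum.map strip id) {A⊠F} {A⊠ ∷∷ F⊠} (∷∷-⊠ aᵉ F a′ᵉ F′)

    F⊠-id : rename (Sum.map (Inverse.to (↔-id (P ⊎ P′))) (Inverse.to (↔-id (Q ⊎ Q′)))) F⊠ ≅ F⊠
    F⊠-id = rename-ext {φ = Sum.map id id} {ψ = id} F⊠ map-id

    A⊠-strip : rename (Sum.map strip id) A⊠ ≅ rename inj₂ (a ⊗ᴳ a′)
    A⊠-strip = ≅-trans (rename-□ (Sum.map strip id ∘′ interchange) (rename inj₁ aᵉ) (rename inj₂ a′ᵉ))
      (≅-sym (rename-□ inj₂ (rename inj₁ a) (rename inj₂ a′)))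

    step₄ : rename (Sum.map strip id) (A⊠ ∷∷ F⊠) ≅ rename inj₂ (a ⊗ᴳ a′) ∷∷ F⊠
    step₄ = ∷∷-map ⊥⊎⊥ (↔-id (P ⊎ P′)) (↔-id (Q ⊎ Q′)) A⊠ {rename inj₂ (a ⊗ᴳ a′)} F⊠ {F⊠} A⊠-strip F⊠-id

  opaque
    unfolding _▷_

    -- This is `∷∷-⊠` for two morphisms out of the empty set. Their product starts at a sum of two
    -- empty sets, which `⊥⊎⊥` collapses.
    ▷-⊠ : (a ⊗ᴳ a′) ▷ (F ⊠ F′) ≅ (a ▷ F) ⊗ᴳ (a′ ▷ F′)
    ▷-⊠ = ≅-sym (≅-trans step₁ (≅-trans step₂ (≅-trans step₃
      (rename-cong strip {rename (Sum.map strip id) (A⊠ ∷∷ F⊠)} {rename inj₂ (a ⊗ᴳ a′) ∷∷ F⊠} step₄))))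

∷∷-◁ : {P Q R : Set ℓ} (F : CohGraph (P ⊎ Q)) (G : CohGraph (Q ⊎ R)) (c : CohGraph R) →
       (F ∷∷ G) ◁ c ≅ F ◁ (G ◁ c)
∷∷-◁ F G c =
  ≅-trans (▷-cong (≅-refl {G = c}) (∷∷-swap F G)) (≅-sym (▷-∷∷ c (rename Sum.swap G) (rename Sum.swap F)))

wire-◁ : {P Q : Set ℓ} (φ : P ↔ Q) (b : CohGraph Q) → wire φ ◁ b ≅ rename (Inverse.from φ) b
wire-◁ φ b = ≅-trans (▷-cong (≅-refl {G = b}) (wire-swap φ)) (▷-wire b (↔-sym φ))

-- Membership in conducts and closure of morphisms.

open Conduct using (graphs; isConduct) renaming (V to vertices)

∈-⟂⟂ : (A : Conduct ℓ) {G : CohGraph (vertices A)} → (∀ {H} → H ∈ graphs (A ^⟂ᶜ) → G ⫫ H) → G ∈ graphs A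
∈-⟂⟂ A G⫫ = proj₂ (isConduct A) λ H∈ → ⫫⇒⟂ (G⫫ H∈)

∈-⟂ : (A : Conduct ℓ) {G H : CohGraph (vertices A)} → G ∈ graphs A → H ∈ graphs (A ^⟂ᶜ) → G ⫫ H
∈-⟂ A G∈ H∈ = ⟂⇒⫫ (proj₁ (isConduct A) G∈ H∈)

∈-resp-≅ : (A : Conduct ℓ) {G H : CohGraph (vertices A)} → G ≅ H → G ∈ graphs A → H ∈ graphs A
∈-resp-≅ A i G∈ = ∈-⟂⟂ A λ K∈ → ⫫-congˡ i (∈-⟂ A G∈ K∈)

∅∈ : (A : Conduct ℓ) → ∅ᴳ ∈ graphs A
∅∈ A = ∈-⟂⟂ A λ _ → ∅-⫫

-- A third orthogonal is no smaller than the first, so it suffices to test `F` against pure tensors.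
⊸-intro : (A B : Conduct ℓ) {F : CohGraph (vertices A ⊎ vertices B)} →
          (∀ {a b} → a ∈ graphs A → b ∈ graphs (B ^⟂ᶜ) → F ⫫ a ⊗ᴳ b) → F ∈ graphs (A ⊸ B)
⊸-intro A B ⫫F X∈ = ⫫⇒⟂ (⫫-swap (⟂⇒⫫ (X∈ λ { (a , b , a∈ , b∈ , i) → ⫫⇒⟂ (⫫-congʳ (≅-sym i) (⫫F a∈ b∈)) })))

⊸-elim : (A B : Conduct ℓ) (F : CohGraph (vertices A ⊎ vertices B)) → F ∈ graphs (A ⊸ B) →
         ∀ {a b} → a ∈ graphs A → b ∈ graphs (B ^⟂ᶜ) → F ⫫ a ⊗ᴳ b
⊸-elim A B F F∈ {a} {b} a∈ b∈ = ⟂⇒⫫ (F∈ (⊆-^⟂^⟂ (Tensors A (B ^⟂ᶜ)) (a , b , a∈ , b∈ , ≅-refl)))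

▷-∈ : (A B : Conduct ℓ) (F : CohGraph (vertices A ⊎ vertices B)) {a : CohGraph (vertices A)} →
      F ∈ graphs (A ⊸ B) → a ∈ graphs A → a ▷ F ∈ graphs B
▷-∈ A B F {a} F∈ a∈ = ∈-⟂⟂ B λ b∈ → ▷-⫫ F a (⊸-elim A B F F∈ a∈ b∈)

◁-∈ : (A B : Conduct ℓ) (F : CohGraph (vertices A ⊎ vertices B)) {b : CohGraph (vertices B)} →
      F ∈ graphs (A ⊸ B) → b ∈ graphs (B ^⟂ᶜ) → F ◁ b ∈ graphs (A ^⟂ᶜ)
◁-∈ A B F {b} F∈ b∈ a∈ = ⫫⇒⟂ (◁-⫫ F b (⊸-elim A B F F∈ a∈ b∈))

module _ {ℓ} {P Q : Set ℓ} (F : CohGraph (P ⊎ Q)) where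

  -- For fixed `c`, and given `⫫∅`, being orthogonal to `x ⊗ᴳ c` is a condition on `x` alone:
  -- orthogonality to the one graph `F ◁ c`. Conditions of this form pass from `X` to its
  -- biorthogonal.
  ⫫-extendˡ : (X : GraphSet P) {c : CohGraph Q} → F ⫫ ∅ᴳ ⊗ᴳ c → (∀ {x} → x ∈ X → F ⫫ x ⊗ᴳ c) →
              ∀ {x} → x ∈ X ^⟂ ^⟂ → F ⫫ x ⊗ᴳ c
  ⫫-extendˡ X {c} ⫫∅ ⫫X x∈ = ⫫-◁ F c ⫫∅ (⫫-swap (⟂⇒⫫ (x∈ λ y∈ → ⫫⇒⟂ (◁-⫫ F c (⫫X y∈)))))

  ⫫-extendʳ : (Y : GraphSet Q) {a : CohGraph P} → F ⫫ a ⊗ᴳ ∅ᴳ → (∀ {y} → y ∈ Y → F ⫫ a ⊗ᴳ y) →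
              ∀ {y} → y ∈ Y ^⟂ ^⟂ → F ⫫ a ⊗ᴳ y
  ⫫-extendʳ Y {a} ⫫∅ ⫫Y y∈ = ⫫-▷ F a ⫫∅ (⫫-swap (⟂⇒⫫ (y∈ λ x∈ → ⫫⇒⟂ (▷-⫫ F a (⫫Y x∈)))))

-- Makes the side condition of `⫫-extendˡ` and `⫫-extendʳ` an instance of their hypothesis on the
-- generators.
∅∈-Tensors : (A B : Conduct ℓ) → ∅ᴳ ∈ Tensors A B
∅∈-Tensors A B = ∅ᴳ , ∅ᴳ , ∅∈ A , ∅∈ B , ≅-sym ∅-⊗

⊗-∈ : (A B : Conduct ℓ) {a : CohGraph (vertices A)} {b : CohGraph (vertices B)} → a ∈ graphs A → b ∈ graphs B →
      a ⊗ᴳ b ∈ graphs (A ⊗ B)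
⊗-∈ A B {a} {b} a∈ b∈ = ⊆-^⟂^⟂ (Tensors A B) (a , b , a∈ , b∈ , ≅-refl)

-- Testing against `c` moves it through the chain: `G ◁ c` lies in the dual of `B`, where `F` can be
-- tested against it. The side condition is approached from the other end, through `∅ᴳ ▷ F`, which
-- lies in `B`.
∷∷-closed : (A B C : Conduct ℓ) → ∀ {F G} → F ∈ graphs (A ⊸ B) → G ∈ graphs (B ⊸ C) → F ∷∷ G ∈ graphs (A ⊸ C)
∷∷-closed A B C {F} {G} F∈ G∈ = ⊸-intro A C λ {a} {c} a∈ c∈ → ⫫-◁ (F ∷∷ G) c
  (⫫-▷ (F ∷∷ G) ∅ᴳ ⫫-∅⊗∅
    (⫫-congˡ (▷-∷∷ ∅ᴳ F G) (▷-⫫ G (∅ᴳ ▷ F) (⊸-elim B C G G∈ (▷-∈ A B F F∈ (∅∈ A)) c∈))))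
  (⫫-congˡ (≅-sym (∷∷-◁ F G c)) (◁-⫫ F (G ◁ c) (⊸-elim A B F F∈ a∈ (◁-∈ B C G G∈ c∈))))

-- A graph `y` in the dual of `B ⊗ B′` need not be a tensor, so it is kept whole, and only the other
-- argument is reduced to some `a ⊗ᴳ a′`. Applying the product morphism to that gives a tensor of
-- elements of `B` and `B′`, orthogonal to `y` by definition.
⊗-closed : (A B A′ B′ : Conduct ℓ) {F : CohGraph (vertices A ⊎ vertices B)}
           {G : CohGraph (vertices A′ ⊎ vertices B′)} → F ∈ graphs (A ⊸ B) → G ∈ graphs (A′ ⊸ B′) →
           rename interchange (F ⊗ᴳ G) ∈ graphs (A ⊗ A′ ⊸ B ⊗ B′)
⊗-closed A B A′ B′ {F} {G} F∈ G∈ = ⊸-intro (A ⊗ A′) (B ⊗ B′) λ {_} {y} x∈ y∈ →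
  ⫫-extendˡ I (Tensors A A′) (on-tensor (∅∈-Tensors A A′) y∈) (λ x∈ → on-tensor x∈ y∈) x∈
  where
  I = F ⊠ G

  swap-I : rename Sum.swap I ≅ rename Sum.swap F ⊠ rename Sum.swap G
  swap-I = ≅-trans
    (rename-ext {φ = Sum.swap ∘′ interchange} {ψ = interchange ∘′ Sum.map Sum.swap Sum.swap} (F ⊗ᴳ G)
      λ { (inj₁ (inj₁ _)) → refl ; (inj₁ (inj₂ _)) → refl ; (inj₂ (inj₁ _)) → refl ; (inj₂ (inj₂ _)) → refl })
    (rename-cong interchange (rename-⊗ Sum.swap Sum.swap F G))

  I◁∅ : I ◁ ∅ᴳ ≅ (F ◁ ∅ᴳ) ⊗ᴳ (G ◁ ∅ᴳ)
  I◁∅ = ≅-trans (▷-cong (≅-sym ∅-⊗) swap-I) (▷-⊠ ∅ᴳ ∅ᴳ (rename Sum.swap F) (rename Sum.swap G))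

  on-tensor : ∀ {x y} → x ∈ Tensors A A′ → y ∈ graphs ((B ⊗ B′) ^⟂ᶜ) → I ⫫ x ⊗ᴳ y
  on-tensor {y = y} (a , a′ , a∈ , a′∈ , i) y∈ = ⫫-congʳ (⊗ᴳ-cong (≅-sym i) (≅-refl {G = y}))
    (⫫-▷ I (a ⊗ᴳ a′)
      -- In the side condition `y` has become edgeless and does split as a tensor, so the question
      -- decomposes into one for `F` and one for `G`.
      (⫫-◁ I ∅ᴳ ⫫-∅⊗∅ (⫫-congˡ (≅-sym I◁∅)
        (⫫-⊗ (F ◁ ∅ᴳ) a (G ◁ ∅ᴳ) a′
          (◁-⫫ F ∅ᴳ (⊸-elim A B F F∈ a∈ (∅∈ (B ^⟂ᶜ)))) (◁-⫫ G ∅ᴳ (⊸-elim A′ B′ G G∈ a′∈ (∅∈ (B′ ^⟂ᶜ)))))))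
      (⫫-congˡ (≅-sym (▷-⊠ a a′ F G))
        (∈-⟂ (B ⊗ B′) (⊗-∈ B B′ (▷-∈ A B F F∈ a∈) (▷-∈ A′ B′ G G∈ a′∈)) y∈)))

*-closed : (A B : Conduct ℓ) {F : CohGraph (vertices A ⊎ vertices B)} → F ∈ graphs (A ⊸ B) →
           rename Sum.swap F ∈ graphs (B ^⟂ᶜ ⊸ A ^⟂ᶜ)
*-closed A B {F} F∈ = ⊸-intro (B ^⟂ᶜ) (A ^⟂ᶜ) λ {b} {a} b∈ a∈ → ⫫-map (↔-inj (⊎-comm (vertices A) (vertices B)))
  (plugging-cong Sum.swap (≅-refl {G = rename Sum.swap F}) (⊗-comm a b))
  (⊸-elim A B F F∈ (proj₂ (isConduct A) a∈) b∈)

wellDefined : WellDefined ℓ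
wellDefined = record
  { ∷∷-closed = λ A B C {F} {G} → ∷∷-closed A B C {F} {G}
  ; ⊗-closed  = λ A B A′ B′ {F} {G} → ⊗-closed A B A′ B′ {F} {G}
  ; *-closed  = λ A B {F} → *-closed A B {F}
  }

-- Applying a wire to `a` only renames it, so the hypothesis is the main condition of the
-- adjunction. The side condition asks about a renamed edgeless graph, which is orthogonal to
-- everything.
wire-∈ : (A B : Conduct ℓ) (φ : vertices A ↔ vertices B) →
         (∀ {a} → a ∈ graphs A → rename (Inverse.to φ) a ∈ graphs B) → wire φ ∈ graphs (A ⊸ B)
wire-∈ A B φ φ-∈ = ⊸-intro A B λ {a} {b} a∈ b∈ → ⫫-▷ (wire φ) a
  (⫫-◁ (wire φ) ∅ᴳ ⫫-∅⊗∅ (⫫-congˡ (≅-sym (wire-◁ φ ∅ᴳ)) (∅-rename (Inverse.from φ))))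
  (⫫-congˡ (≅-sym (▷-wire a φ)) (∈-⟂ B (φ-∈ a∈) b∈))
  where
  ∅-rename : (ψ : V → W) {H : CohGraph W} → rename ψ ∅ᴳ ⫫ H
  ∅-rename ψ = ⫫-congˡ (mk≅ id id (λ y → y , refl) (λ ()) (λ ()) (λ ())) ∅-⫫

-- A renaming along a bijection can be moved to the other side of an orthogonality, so the condition
-- on generators extends to their biorthogonal.
rename-∈ : (φ : V ↔ W) (X : GraphSet V) (Y : GraphSet W) → (∀ {x} → x ∈ X → rename (Inverse.to φ) x ∈ Y ^⟂) →
           ∀ {x} → x ∈ X ^⟂ ^⟂ → rename (Inverse.to φ) x ∈ Y ^⟂
rename-∈ φ X Y φ-∈ x∈ {y} y∈ =
  ⫫⇒⟂ (⇒ (⫫-transpose φ) (⟂⇒⫫ (x∈ λ x′∈ → ⫫⇒⟂ (⫫-swap (⇐ (⫫-transpose φ) (⟂⇒⫫ (φ-∈ x′∈ y∈)))))))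

-- Naturality of the structural maps at the level of graphs.

rename-□² : (θ : V → W) (κ : U → V) (F G : CohGraph U) (H : CohGraph V) →
            rename θ (rename κ (F □ G) □ H) ≅ (rename (θ ∘′ κ) F □ rename (θ ∘′ κ) G) □ rename θ H
rename-□² θ κ F G H =
  ≅-trans (rename-□ θ (rename κ (F □ G)) H) (□-cong (rename-□ (θ ∘′ κ) F G) (≅-refl {G = rename θ H}))

rename-□²′ : (θ : V → W) (κ : U → V) (F : CohGraph V) (G H : CohGraph U) →
             rename θ (F □ rename κ (G □ H)) ≅ rename θ F □ (rename (θ ∘′ κ) G □ rename (θ ∘′ κ) H)
rename-□²′ θ κ F G H =
  ≅-trans (rename-□ θ F (rename κ (G □ H))) (□-cong (≅-refl {G = rename θ F}) (rename-□ (θ ∘′ κ) G H))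

module _ {ℓ} {A A′ B B′ C C′ : Set ℓ} (f : CohGraph (A ⊎ A′)) (g : CohGraph (B ⊎ B′))
    (h : CohGraph (C ⊎ C′)) where

  -- Both sides plug together `f`, `g` and `h`. After `□-assoc` has regrouped the edges, each factor
  -- carries two vertex maps that agree pointwise.
  ⊗-assoc-natural : rename (Sum.map₂ Sum.assocʳ) ((f ⊠ g) ⊠ h) ≅
                    rename (Sum.map₁ Sum.assocˡ) (f ⊠ (g ⊠ h))
  ⊗-assoc-natural = ≅-trans
    (rename-□² (Sum.map₂ Sum.assocʳ ∘′ interchange) (inj₁ ∘′ interchange) (rename inj₁ f) (rename inj₂ g) (rename inj₂ h))
    (≅-trans (□-assoc _ _ _)
    (≅-trans
      (□-cong
        (rename-ext {φ = Sum.map₂ Sum.assocʳ ∘′ interchange ∘′ inj₁ ∘′ interchange ∘′ inj₁}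
                    {ψ = Sum.map₁ Sum.assocˡ ∘′ interchange ∘′ inj₁} f λ { (inj₁ _) → refl ; (inj₂ _) → refl })
        (□-cong
          (rename-ext {φ = Sum.map₂ Sum.assocʳ ∘′ interchange ∘′ inj₁ ∘′ interchange ∘′ inj₂}
                      {ψ = Sum.map₁ Sum.assocˡ ∘′ interchange ∘′ inj₂ ∘′ interchange ∘′ inj₁} g
                        λ { (inj₁ _) → refl ; (inj₂ _) → refl })
          (rename-ext {φ = Sum.map₂ Sum.assocʳ ∘′ interchange ∘′ inj₂}
                      {ψ = Sum.map₁ Sum.assocˡ ∘′ interchange ∘′ inj₂ ∘′ interchange ∘′ inj₂} h
                        λ { (inj₁ _) → refl ; (inj₂ _) → refl })))
    (≅-sym (rename-□²′ (Sum.map₁ Sum.assocˡ ∘′ interchange) (inj₂ ∘′ interchange) (rename inj₁ f) (rename inj₁ g) (rename inj₂ h)))))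

module _ {ℓ} {A A′ B B′ : Set ℓ} (f : CohGraph (A ⊎ A′)) (g : CohGraph (B ⊎ B′)) where

  ⊗-comm-natural : rename (Sum.map₂ Sum.swap) (f ⊠ g) ≅ rename (Sum.map₁ Sum.swap) (g ⊠ f)
  ⊗-comm-natural = ≅-trans (rename-□ (Sum.map₂ Sum.swap ∘′ interchange) (rename inj₁ f) (rename inj₂ g))
    (≅-trans (□-comm _ _) (≅-trans
      (□-cong
        (rename-ext {φ = Sum.map₂ Sum.swap ∘′ interchange ∘′ inj₂}
                    {ψ = Sum.map₁ Sum.swap ∘′ interchange ∘′ inj₁} g
          λ { (inj₁ _) → refl ; (inj₂ _) → refl })
        (rename-ext {φ = Sum.map₂ Sum.swap ∘′ interchange ∘′ inj₁}
                    {ψ = Sum.map₁ Sum.swap ∘′ interchange ∘′ inj₂} f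
          λ { (inj₁ _) → refl ; (inj₂ _) → refl }))
      (≅-sym (rename-□ (Sum.map₁ Sum.swap ∘′ interchange) (rename inj₁ g) (rename inj₂ f)))))

⊥⊎↔ : ∀ {ℓ} {A : Set ℓ} → (⊥ₗ {ℓ} ⊎ A) ↔ A
⊥⊎↔ = mk↔ₛ′ [ ⊥-elimₗ , id ] inj₂ (λ _ → refl) λ { (inj₂ _) → refl }

⊎⊥↔ : ∀ {ℓ} {A : Set ℓ} → (A ⊎ ⊥ₗ {ℓ}) ↔ A
⊎⊥↔ = mk↔ₛ′ [ id , ⊥-elimₗ ] inj₁ (λ _ → refl) λ { (inj₁ _) → refl }

module _ {ℓ} {A A′ : Set ℓ} (f : CohGraph (A ⊎ A′)) where

  private
    unitLoop : CohGraph (⊥ₗ {ℓ} ⊎ ⊥ₗ {ℓ})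
    unitLoop = wire (↔-id ⊥ₗ)

  ⊗-unitˡ-natural : rename (Sum.map₂ [ ⊥-elimₗ , id ]) (unitLoop ⊠ f) ≅ rename (Sum.map₁ inj₂) f
  ⊗-unitˡ-natural =
    ≅-sym (mk≅ inj₂ inj₂-injective (λ { (inj₂ e) → e , refl ; (inj₁ (inj₁ ())) ; (inj₁ (inj₂ ())) })
    (λ e → vertex (s f e)) (λ e → vertex (t f e)) (λ _ _ → mk⇔ id id))
    where
    vertex : ∀ v → Sum.map₂ [ ⊥-elimₗ , id ] (interchange (inj₂ v)) ≡ Sum.map₁ inj₂ v
    vertex (inj₁ _) = refl
    vertex (inj₂ _) = refl

  ⊗-unitʳ-natural : rename (Sum.map₂ [ id , ⊥-elimₗ ]) (f ⊠ unitLoop) ≅ rename (Sum.map₁ inj₁) f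
  ⊗-unitʳ-natural =
    ≅-sym (mk≅ inj₁ inj₁-injective (λ { (inj₁ e) → e , refl ; (inj₂ (inj₁ ())) ; (inj₂ (inj₂ ())) })
    (λ e → vertex (s f e)) (λ e → vertex (t f e)) (λ _ _ → mk⇔ id id))
    where
    vertex : ∀ v → Sum.map₂ [ id , ⊥-elimₗ ] (interchange (inj₁ v)) ≡ Sum.map₁ inj₁ v
    vertex (inj₁ _) = refl
    vertex (inj₂ _) = refl

module _ {ℓ} {A A′ B B′ C C′ : Set ℓ} (f : CohGraph (A′ ⊎ A)) (g : CohGraph (B′ ⊎ B)) (h : CohGraph (C′ ⊎ C))
         (k : CohGraph ((A ⊎ B) ⊎ C)) where
  private
    θ : ((A′ ⊎ B′) ⊎ (A ⊎ B)) ⊎ (C ⊎ C′) → (A′ ⊎ A) ⊎ ((B ⊎ C) ⊎ (B′ ⊎ C′))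
    θ (inj₁ (inj₁ (inj₁ a′))) = inj₁ (inj₁ a′)
    θ (inj₁ (inj₁ (inj₂ b′))) = inj₂ (inj₂ (inj₁ b′))
    θ (inj₁ (inj₂ (inj₁ a)))  = inj₁ (inj₂ a)
    θ (inj₁ (inj₂ (inj₂ b)))  = inj₂ (inj₁ (inj₁ b))
    θ (inj₂ (inj₁ c))         = inj₂ (inj₁ (inj₂ c))
    θ (inj₂ (inj₂ c′))        = inj₂ (inj₂ (inj₂ c′))

    θ⁻¹ : (A′ ⊎ A) ⊎ ((B ⊎ C) ⊎ (B′ ⊎ C′)) → ((A′ ⊎ B′) ⊎ (A ⊎ B)) ⊎ (C ⊎ C′)
    θ⁻¹ (inj₁ (inj₁ a′))        = inj₁ (inj₁ (inj₁ a′))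
    θ⁻¹ (inj₂ (inj₂ (inj₁ b′))) = inj₁ (inj₁ (inj₂ b′))
    θ⁻¹ (inj₁ (inj₂ a))         = inj₁ (inj₂ (inj₁ a))
    θ⁻¹ (inj₂ (inj₁ (inj₁ b)))  = inj₁ (inj₂ (inj₂ b))
    θ⁻¹ (inj₂ (inj₁ (inj₂ c)))  = inj₂ (inj₁ c)
    θ⁻¹ (inj₂ (inj₂ (inj₂ c′))) = inj₂ (inj₂ c′)

    θ⁻¹-θ : ∀ x → θ⁻¹ (θ x) ≡ x
    θ⁻¹-θ (inj₁ (inj₁ (inj₁ _))) = refl
    θ⁻¹-θ (inj₁ (inj₁ (inj₂ _))) = refl
    θ⁻¹-θ (inj₁ (inj₂ (inj₁ _))) = refl
    θ⁻¹-θ (inj₁ (inj₂ (inj₂ _))) = refl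
    θ⁻¹-θ (inj₂ (inj₁ _))        = refl
    θ⁻¹-θ (inj₂ (inj₂ _))        = refl

    θ-inj : Inj θ
    θ-inj {x} {y} eq = trans (sym (θ⁻¹-θ x)) (trans (cong θ⁻¹ eq) (θ⁻¹-θ y))

    sides : rename θ ((f ⊠ g) ⊗ᴳ rename Sum.swap h) ≅ f ⊗ᴳ rename Sum.swap (g ⊠ h)
    sides =
      ≅-trans (rename-□² θ (inj₁ ∘′ interchange) (rename inj₁ f) (rename inj₂ g) (rename inj₂ (rename Sum.swap h)))
      (≅-trans (□-assoc _ _ _) (≅-trans
        (□-cong
          (rename-ext {φ = θ ∘′ inj₁ ∘′ interchange ∘′ inj₁} {ψ = inj₁} f
            λ { (inj₁ _) → refl ; (inj₂ _) → refl })
          (□-cong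
            (rename-ext {φ = θ ∘′ inj₁ ∘′ interchange ∘′ inj₂} {ψ = inj₂ ∘′ Sum.swap ∘′ interchange ∘′ inj₁} g
              λ { (inj₁ _) → refl ; (inj₂ _) → refl })
            (rename-ext {φ = θ ∘′ inj₂ ∘′ Sum.swap} {ψ = inj₂ ∘′ Sum.swap ∘′ interchange ∘′ inj₂} h
              λ { (inj₁ _) → refl ; (inj₂ _) → refl })))
      (≅-sym (rename-□²′ id (inj₂ ∘′ Sum.swap ∘′ interchange) (rename inj₁ f) (rename inj₁ g) (rename inj₂ h)))))

    middle : rename θ (rename (Sum.map inj₂ inj₁) k) ≅ rename (Sum.map inj₂ inj₁) (rename Sum.assocʳ k)
    middle = rename-ext {φ = θ ∘′ Sum.map inj₂ inj₁} {ψ = Sum.map inj₂ inj₁ ∘′ Sum.assocʳ} k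
      λ { (inj₁ (inj₁ _)) → refl ; (inj₁ (inj₂ _)) → refl ; (inj₂ _) → refl }

    bent : rename Sum.assocʳ (exec (Sum.map inj₁ inj₂) ((f ⊠ g) ⊗ᴳ rename Sum.swap h) (rename (Sum.map inj₂ inj₁) k)) ≅
           exec (Sum.map inj₁ inj₂) (f ⊗ᴳ rename Sum.swap (g ⊠ h)) (rename (Sum.map inj₂ inj₁) (rename Sum.assocʳ k))
    bent = exec-map θ-inj (plugging-cong θ sides middle)
      (map-inj inj₁-injective inj₂-injective) (map-inj inj₁-injective inj₂-injective) (⊎-assoc ℓ A′ B′ C′)
      λ { (inj₁ (inj₁ _)) → refl ; (inj₁ (inj₂ _)) → refl ; (inj₂ _) → refl }

  -- Both sides are chains with `k` in the middle. Flattening plugs `k` against `f`, `g` and `h` at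
  -- once, and then moving `g` from the left end to the right end is just the renaming `θ`.
  bend-natural : rename Sum.assocʳ (((f ⊠ g) ∷∷ k) ∷∷ rename Sum.swap h) ≅
                 (f ∷∷ rename Sum.assocʳ k) ∷∷ rename Sum.swap (g ⊠ h)
  bend-natural = ≅-trans
    (rename-cong Sum.assocʳ {((f ⊠ g) ∷∷ k) ∷∷ rename Sum.swap h}
      {exec (Sum.map inj₁ inj₂) ((f ⊠ g) ⊗ᴳ rename Sum.swap h) (rename (Sum.map inj₂ inj₁) k)}
      (Flattening.flat-≅ (f ⊠ g) k (rename Sum.swap h)))
    (≅-trans bent (≅-sym (Flattening.flat-≅ f (rename Sum.assocʳ k) (rename Sum.swap (g ⊠ h)))))

  -- Every intermediate composite is a variable, so that none is unfolded when this is applied to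
  -- morphisms of conducts, whose vertex sets are sums only up to unfolding.
  bend-natural-via :
    {fg : CohGraph ((A′ ⊎ B′) ⊎ (A ⊎ B))} {fgk : CohGraph ((A′ ⊎ B′) ⊎ C)} {h* : CohGraph (C ⊎ C′)}
    {fgkh : CohGraph ((A′ ⊎ B′) ⊎ C′)} {gh : CohGraph ((B′ ⊎ C′) ⊎ (B ⊎ C))} {gh* : CohGraph ((B ⊎ C) ⊎ (B′ ⊎ C′))}
    {k′ : CohGraph (A ⊎ (B ⊎ C))} {fk : CohGraph (A′ ⊎ (B ⊎ C))} {fkgh : CohGraph (A′ ⊎ (B′ ⊎ C′))} →
    fg ≅ f ⊠ g → fgk ≅ fg ∷∷ k → h* ≅ rename Sum.swap h → fgkh ≅ fgk ∷∷ h* →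
    gh ≅ g ⊠ h → gh* ≅ rename Sum.swap gh → k′ ≅ rename Sum.assocʳ k → fk ≅ f ∷∷ k′ → fkgh ≅ fk ∷∷ gh* →
    rename Sum.assocʳ fgkh ≅ fkgh
  bend-natural-via {fg} {fgk} {h*} {fgkh} {gh} {gh*} {k′} {fk} {fkgh} fg≅ fgk≅ h≅ fgkh≅ gh≅ gh*≅ k≅ fk≅ fkgh≅ =
    ≅-trans (rename-cong Sum.assocʳ {fgkh} {((f ⊠ g) ∷∷ k) ∷∷ rename Sum.swap h} (≅-trans fgkh≅
      (∷∷-cong {F = fgk} {(f ⊠ g) ∷∷ k} {h*} {rename Sum.swap h}
        (≅-trans fgk≅ (∷∷-cong {F = fg} {f ⊠ g} {k} {k} fg≅ ≅-refl)) h≅)))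
    (≅-trans bend-natural (≅-sym (≅-trans fkgh≅
      (∷∷-cong {F = fk} {f ∷∷ rename Sum.assocʳ k} {gh*} {rename Sum.swap (g ⊠ h)}
        (≅-trans fk≅ (∷∷-cong {F = f} {f} {k′} {rename Sum.assocʳ k} ≅-refl k≅))
        (≅-trans gh*≅ (rename-cong Sum.swap {gh} {g ⊠ h} gh≅))))))

-- The unit, currying, and wires that are morphisms.

-- Without vertices there are no cycles, so every orthogonal consists of all graphs, and this is the
-- only conduct on the empty set.
unit : Conduct ℓ
unit = record { V = ⊥ₗ ; graphs = λ _ → ⊤ₗ ; isConduct = (λ { _ _ (() , _) }) , λ _ → ttₗ }

wire-∈-⊗ : (A B C : Conduct ℓ) (φ : (vertices A ⊎ vertices B) ↔ vertices C) →
           (∀ {a b} → a ∈ graphs A → b ∈ graphs B → rename (Inverse.to φ) (a ⊗ᴳ b) ∈ graphs C) → wire φ ∈ graphs (A ⊗ B ⊸ C)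
wire-∈-⊗ A B C φ φ-∈ = wire-∈ (A ⊗ B) C φ λ {x} x∈ → ∈-⟂⟂ C λ {y} y∈ →
  ⟂⇒⫫ (rename-∈ φ (Tensors A B) (graphs C ^⟂)
    (λ { {x′} (a , b , a∈ , b∈ , i) {y′} y′∈ → ⫫⇒⟂ (∈-⟂ C
      (∈-resp-≅ C (rename-cong (Inverse.to φ) {a ⊗ᴳ b} {x′} (≅-sym i)) (φ-∈ a∈ b∈)) y′∈) }) {x} x∈ {y} y∈)

module _ {ℓ} {A B C : Set ℓ} (F : CohGraph ((A ⊎ B) ⊎ C)) (a : CohGraph A) (b : CohGraph B)
    (c : CohGraph C) where
  private
    tensor-assoc : rename Sum.assocʳ ((a ⊗ᴳ b) ⊗ᴳ c) ≅ a ⊗ᴳ (b ⊗ᴳ c)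
    tensor-assoc = ≅-trans (rename-□² Sum.assocʳ inj₁ (rename inj₁ a) (rename inj₂ b) (rename inj₂ c))
      (≅-trans (□-assoc _ _ _) (□-cong (≅-refl {G = rename inj₁ a}) (≅-sym (rename-□ inj₂ (rename inj₁ b) (rename inj₂ c)))))

    p : Plugging≅ Sum.assocʳ F ((a ⊗ᴳ b) ⊗ᴳ c) (rename Sum.assocʳ F) (a ⊗ᴳ (b ⊗ᴳ c))
    p = plugging-cong Sum.assocʳ (≅-refl {G = rename Sum.assocʳ F}) tensor-assoc

  ⫫-assoc : F ⫫ (a ⊗ᴳ b) ⊗ᴳ c → rename Sum.assocʳ F ⫫ a ⊗ᴳ (b ⊗ᴳ c)
  ⫫-assoc = ⫫-map (↔-inj (⊎-assoc ℓ A B C)) p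

  ⫫-assoc⁻ : rename Sum.assocʳ F ⫫ a ⊗ᴳ (b ⊗ᴳ c) → F ⫫ (a ⊗ᴳ b) ⊗ᴳ c
  ⫫-assoc⁻ = ⫫-map⁻ (↔-inj (⊎-assoc ℓ A B C)) p

module _ {ℓ} (A B C : Conduct ℓ) where

  -- Both memberships amount to orthogonality to all `a ⊗ b ⊗ c`. The elements of `B ⊗ C` that are
  -- not tensors are reached by `⫫-extendʳ`.
  curry-∈ : ∀ {F} → F ∈ graphs (A ⊗ B ⊸ C ^⟂ᶜ) → rename Sum.assocʳ F ∈ graphs (A ⊸ (B ⊗ C) ^⟂ᶜ)
  curry-∈ {F} F∈ = ⊸-intro A ((B ⊗ C) ^⟂ᶜ) λ {a} a∈ x∈ →
    ⫫-extendʳ (rename Sum.assocʳ F) (Tensors B C) (on-tensor a∈ (∅∈-Tensors B C)) (on-tensor a∈) (proj₂ (isConduct (B ⊗ C)) x∈)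
    where
    on-tensor : ∀ {a y} → a ∈ graphs A → y ∈ Tensors B C → rename Sum.assocʳ F ⫫ a ⊗ᴳ y
    on-tensor {a} {y} a∈ (b , c , b∈ , c∈ , i) = ⫫-congʳ (⊗ᴳ-cong (≅-refl {G = a}) (≅-sym i))
      (⫫-assoc F a b c (⊸-elim (A ⊗ B) (C ^⟂ᶜ) F F∈ (⊗-∈ A B a∈ b∈) (proj₁ (isConduct C) c∈)))

  uncurry-∈ : ∀ {F} → F ∈ graphs (A ⊸ (B ⊗ C) ^⟂ᶜ) → rename Sum.assocˡ F ∈ graphs (A ⊗ B ⊸ C ^⟂ᶜ)
  uncurry-∈ {F} F∈ = ⊸-intro (A ⊗ B) (C ^⟂ᶜ) λ {_} {c} x∈ c∈ →
    ⫫-extendˡ (rename Sum.assocˡ F) (Tensors A B) (on-tensor (∅∈-Tensors A B) (proj₂ (isConduct C) c∈))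
      (λ x∈ → on-tensor x∈ (proj₂ (isConduct C) c∈)) x∈
    where
    on-tensor : ∀ {x c} → x ∈ Tensors A B → c ∈ graphs C → rename Sum.assocˡ F ⫫ x ⊗ᴳ c
    on-tensor {x} {c} (a , b , a∈ , b∈ , i) c∈ = ⫫-congʳ (⊗ᴳ-cong (≅-sym i) (≅-refl {G = c}))
      (⫫-assoc⁻ (rename Sum.assocˡ F) a b c (⫫-congˡ
        (≅-sym (rename-inverse Sum.assocˡ Sum.assocʳ F (Inverse.strictlyInverseˡ (⊎-assoc ℓ (vertices A) (vertices B) (vertices C)))))
        (⊸-elim A ((B ⊗ C) ^⟂ᶜ) F F∈ a∈ (proj₁ (isConduct (B ⊗ C)) (⊗-∈ B C b∈ c∈)))))

  -- A test graph `y` in the dual of `A ⊗ (B ⊗ C)` is read as a morphism from `A` to the dual of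
  -- `B ⊗ C`; uncurried, it can be tested against `u` and `c`. Currying thus spares any direct
  -- analysis of nested biorthogonals.
  ⊗-assocʳ-∈ : ∀ {u c} → u ∈ graphs (A ⊗ B) → c ∈ graphs C → rename Sum.assocʳ (u ⊗ᴳ c) ∈ graphs (A ⊗ (B ⊗ C))
  ⊗-assocʳ-∈ {u} {c} u∈ c∈ =
    ∈-⟂⟂ (A ⊗ (B ⊗ C)) λ {y} y∈ → ⇒ (⫫-transpose (⊎-assoc ℓ (vertices A) (vertices B) (vertices C))) (⫫-swap
    (⊸-elim (A ⊗ B) (C ^⟂ᶜ) (rename Sum.assocˡ y)
      (uncurry-∈ {y} (⊸-intro A ((B ⊗ C) ^⟂ᶜ) λ a∈ x∈ →
        ⫫-swap (∈-⟂ (A ⊗ (B ⊗ C)) (⊗-∈ A (B ⊗ C) a∈ (proj₂ (isConduct (B ⊗ C)) x∈)) y∈)))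
      u∈ (proj₁ (isConduct C) c∈)))

  ⊗-assocˡ-∈ : ∀ {a v} → a ∈ graphs A → v ∈ graphs (B ⊗ C) → rename Sum.assocˡ (a ⊗ᴳ v) ∈ graphs ((A ⊗ B) ⊗ C)
  ⊗-assocˡ-∈ {a} {v} a∈ v∈ =
    ∈-⟂⟂ ((A ⊗ B) ⊗ C) λ {y} y∈ → ⇒ (⫫-transpose (↔-sym (⊎-assoc ℓ (vertices A) (vertices B) (vertices C)))) (⫫-swap
    (⊸-elim A ((B ⊗ C) ^⟂ᶜ) (rename Sum.assocʳ y)
      (curry-∈ {y} (⊸-intro (A ⊗ B) (C ^⟂ᶜ) λ x∈ c∈ →
        ⫫-swap (∈-⟂ ((A ⊗ B) ⊗ C) (⊗-∈ (A ⊗ B) C x∈ (proj₂ (isConduct C) c∈)) y∈)))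
      a∈ (proj₁ (isConduct (B ⊗ C)) v∈)))

⊗-unitˡ : {A : Set ℓ} (u : CohGraph (⊥ₗ {ℓ})) (a : CohGraph A) → a ≅ rename [ ⊥-elimₗ , id ] (u ⊗ᴳ a)
⊗-unitˡ u a = mk≅ inj₂ inj₂-injective surjective (λ _ → refl) (λ _ → refl) (λ _ _ → mk⇔ id id)
  where
  surjective : ∀ e → ∃[ e′ ] inj₂ e′ ≡ e
  surjective (inj₁ e) with () ← s u e
  surjective (inj₂ e) = e , refl

⊗-unitʳ : {A : Set ℓ} (a : CohGraph A) (u : CohGraph (⊥ₗ {ℓ})) → a ≅ rename [ id , ⊥-elimₗ ] (a ⊗ᴳ u)
⊗-unitʳ a u = mk≅ inj₁ inj₁-injective surjective (λ _ → refl) (λ _ → refl) (λ _ _ → mk⇔ id id)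
  where
  surjective : ∀ e → ∃[ e′ ] inj₁ e′ ≡ e
  surjective (inj₁ e) = e , refl
  surjective (inj₂ e) with () ← s u e

∅-⊗ˡ : {V W : Set ℓ} (G : CohGraph W) → ∅ᴳ {V = V} ⊗ᴳ G ≅ rename inj₂ G
∅-⊗ˡ G =
  ≅-sym (mk≅ inj₂ inj₂-injective (λ { (inj₂ e) → e , refl }) (λ _ → refl) (λ _ → refl) (λ _ _ → mk⇔ id id))

-- A second transposition gives a morphism between the double duals, which coincide with `A` and
-- `B`.
transpose-∈⁻ : (A B : Conduct ℓ) {F : CohGraph (vertices B ⊎ vertices A)} → F ∈ graphs (B ^⟂ᶜ ⊸ A ^⟂ᶜ) →
               rename Sum.swap F ∈ graphs (A ⊸ B)
transpose-∈⁻ A B {F} F∈ = ⊸-intro A B λ {a} {b} a∈ b∈ → ⊸-elim ((A ^⟂ᶜ) ^⟂ᶜ) ((B ^⟂ᶜ) ^⟂ᶜ) (rename Sum.swap F)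
  (*-closed (B ^⟂ᶜ) (A ^⟂ᶜ) {F} F∈) {a} {b} (proj₁ (isConduct A) a∈) (proj₁ (isConduct (B ^⟂ᶜ)) b∈)

-- Abstract in the operations, because comparing unfolded composites of graphs is expensive.
module Laws {ℓ} {m}
  (Hom : Conduct ℓ → Conduct ℓ → Set m)
  (⟦_⟧ : {A B : Conduct ℓ} → Hom A B → CohGraph (vertices A ⊎ vertices B))
  (⟦⟧-∈ : {A B : Conduct ℓ} (F : Hom A B) → ⟦ F ⟧ ∈ graphs (A ⊸ B))
  (hom : {A B : Conduct ℓ} (F : CohGraph (vertices A ⊎ vertices B)) → F ∈ graphs (A ⊸ B) → Hom A B)
  (hom-≅ : {A B : Conduct ℓ} (F : CohGraph (vertices A ⊎ vertices B)) (F∈ : F ∈ graphs (A ⊸ B)) → ⟦ hom {A} {B} F F∈ ⟧ ≅ F)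
  (_∘_ : {A B C : Conduct ℓ} → Hom B C → Hom A B → Hom A C)
  (_⊗₁_ : {A B A′ B′ : Conduct ℓ} → Hom A B → Hom A′ B′ → Hom (A ⊗ A′) (B ⊗ B′))
  (_*₁ : {A B : Conduct ℓ} → Hom A B → Hom (B ^⟂ᶜ) (A ^⟂ᶜ))
  (∘-≅ : {A B C : Conduct ℓ} (G : Hom B C) (F : Hom A B) → ⟦ G ∘ F ⟧ ≅ ⟦ F ⟧ ∷∷ ⟦ G ⟧)
  (⊗-≅ : {A B A′ B′ : Conduct ℓ} (F : Hom A B) (G : Hom A′ B′) → ⟦ F ⊗₁ G ⟧ ≅ ⟦ F ⟧ ⊠ ⟦ G ⟧)
  (*-≅ : {A B : Conduct ℓ} (F : Hom A B) → ⟦ F *₁ ⟧ ≅ rename Sum.swap ⟦ F ⟧)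
  where

  -- The category laws and the calculus of structural morphisms.

  raw : RawStarCategory _ _ _
  raw = record
    { Obj = Conduct ℓ ; Hom = Hom ; _≈_ = λ F G → ⟦ F ⟧ ≅ ⟦ G ⟧ ; _∘_ = _∘_
    ; _⊗₀_ = _⊗_ ; _⊗₁_ = _⊗₁_ ; _*₀ = _^⟂ᶜ ; _*₁ = _*₁ }

  private variable
    X Y Z X′ Y′ : Conduct ℓ

  ∘-via : {G : Hom Y Z} {F : Hom X Y} {G′ : CohGraph (vertices Y ⊎ vertices Z)}
          {F′ : CohGraph (vertices X ⊎ vertices Y)} →
          ⟦ G ⟧ ≅ G′ → ⟦ F ⟧ ≅ F′ → ⟦ G ∘ F ⟧ ≅ F′ ∷∷ G′
  ∘-via {G = G} {F} {G′} {F′} i j = ≅-trans (∘-≅ G F) (∷∷-cong {F = ⟦ F ⟧} {F′} {⟦ G ⟧} {G′} j i)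

  ⊗-via : {F : Hom X Y} {G : Hom X′ Y′} {F′ : CohGraph (vertices X ⊎ vertices Y)}
          {G′ : CohGraph (vertices X′ ⊎ vertices Y′)} →
          ⟦ F ⟧ ≅ F′ → ⟦ G ⟧ ≅ G′ → ⟦ F ⊗₁ G ⟧ ≅ F′ ⊠ G′
  ⊗-via {F = F} {G} {F′} {G′} i j = ≅-trans (⊗-≅ F G)
    (rename-cong interchange {⟦ F ⟧ ⊗ᴳ ⟦ G ⟧} {F′ ⊗ᴳ G′} (⊗ᴳ-cong {G = ⟦ F ⟧} {F′} {⟦ G ⟧} {G′} i j))

  *-via : {F : Hom X Y} {F′ : CohGraph (vertices X ⊎ vertices Y)} → ⟦ F ⟧ ≅ F′ → ⟦ F *₁ ⟧ ≅ rename Sum.swap F′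
  *-via {F = F} {F′} i = ≅-trans (*-≅ F) (rename-cong Sum.swap {⟦ F ⟧} {F′} i)

  along : {V : Set ℓ} {F F′ G G′ : CohGraph V} → F ≅ F′ → G ≅ G′ → F′ ≅ G′ → F ≅ G
  along i j k = ≅-trans i (≅-trans k (≅-sym j))

  -- Being a wire is asked only up to `≅`, which keeps the class closed under composition, tensor
  -- and duality. The bijection is stored as data, so that for a composite of structural maps it
  -- computes and can be compared vertex by vertex.
  record Structural (F : Hom X Y) : Set ℓ where
    constructor structural
    field
      bijection : vertices X ↔ vertices Y
      is-wire   : ⟦ F ⟧ ≅ wire bijection

  open Structural

  infixr 9 _∘ˢ_
  infixr 10 _⊗ˢ_

  _∘ˢ_ : {G : Hom Y Z} {F : Hom X Y} → Structural G → Structural F → Structural (G ∘ F)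
  structural ψ j ∘ˢ structural φ i =
    structural (ψ ↔-∘ φ) (≅-trans (∘-via {G′ = wire ψ} {wire φ} j i) (wire-∘ φ ψ))

  _⊗ˢ_ : {F : Hom X Y} {G : Hom X′ Y′} → Structural F → Structural G → Structural (F ⊗₁ G)
  structural φ i ⊗ˢ structural ψ j =
    structural (⊎-cong φ ψ) (≅-trans (⊗-via {F′ = wire φ} {wire ψ} i j) (wire-⊠ φ ψ))

  _*ˢ : {F : Hom X Y} → Structural F → Structural (F *₁)
  structural φ i *ˢ = structural (↔-sym φ) (≅-trans (*-via {F′ = wire φ} i) (wire-swap φ))

  coherence : {F G : Hom X Y} (p : Structural F) (q : Structural G) →
              (∀ v → Inverse.to (bijection p) v ≡ Inverse.to (bijection q) v) → ⟦ F ⟧ ≅ ⟦ G ⟧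
  coherence (structural φ i) (structural ψ j) eq = along i j (wire-cong φ ψ eq)

  homˢ : (X Y : Conduct ℓ) (φ : vertices X ↔ vertices Y) (φ∈ : wire φ ∈ graphs (X ⊸ Y)) →
         Structural (hom {X} {Y} (wire φ) φ∈)
  homˢ X Y φ φ∈ = structural φ (hom-≅ (wire φ) φ∈)

  postcompose : {G : Hom Y Z} {F : Hom X Y} {F′ : CohGraph (vertices X ⊎ vertices Y)} (p : Structural G) →
                ⟦ F ⟧ ≅ F′ → ⟦ G ∘ F ⟧ ≅ rename (Sum.map₂ (Inverse.to (bijection p))) F′
  postcompose {F′ = F′} (structural ψ i) j = ≅-trans (∘-via {G′ = wire ψ} {F′} i j) (∷∷-wire F′ ψ)

  precompose : {G : Hom Y Z} {F : Hom X Y} {G′ : CohGraph (vertices Y ⊎ vertices Z)} →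
               ⟦ G ⟧ ≅ G′ → (p : Structural F) → ⟦ G ∘ F ⟧ ≅ rename (Sum.map₁ (Inverse.from (bijection p))) G′
  precompose {G′ = G′} i (structural φ j) = ≅-trans (∘-via {G′ = G′} {wire φ} i j) (wire-∷∷ φ G′)

  id↔ : (X : Conduct ℓ) → vertices X ↔ vertices X
  id↔ X = ↔-id (vertices X)

  id-∈ : (X : Conduct ℓ) → wire (id↔ X) ∈ graphs (X ⊸ X)
  id-∈ X = wire-∈ X X (id↔ X) (λ x∈ → x∈)

  ι : (X : Conduct ℓ) → Hom X X
  ι X = hom (wire (id↔ X)) (id-∈ X)

  ιˢ : (X : Conduct ℓ) → Structural (ι X)
  ιˢ X = homˢ X X (id↔ X) (id-∈ X)

  isCategory : IsCategory raw
  isCategory = record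
    { ≈-isEquivalence = record { refl = ≅-refl ; sym = ≅-sym ; trans = ≅-trans }
    ; idₘ = λ {X} → ι X
    ; ∘-cong = λ {_} {_} {_} {g} {g′} {f} {f′} i j → ≅-trans (∘-via {G′ = ⟦ g′ ⟧} {⟦ f′ ⟧} i j) (≅-sym (∘-≅ g′ f′))
    ; identityˡ = λ {_} {Y} f → ≅-trans (postcompose {F′ = ⟦ f ⟧} (ιˢ Y) ≅-refl) (rename-id {φ = Sum.map₂ id} ⟦ f ⟧ map-id)
    ; identityʳ = λ {X} f → ≅-trans (precompose {G′ = ⟦ f ⟧} ≅-refl (ιˢ X)) (rename-id {φ = Sum.map₁ id} ⟦ f ⟧ map-id)
    ; assoc = λ h g f → along
        (∘-via {G′ = ⟦ g ⟧ ∷∷ ⟦ h ⟧} {⟦ f ⟧} (∘-≅ h g) ≅-refl) (∘-via {G′ = ⟦ h ⟧} {⟦ f ⟧ ∷∷ ⟦ g ⟧} ≅-refl (∘-≅ g f))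
        (≅-sym (∷∷-assoc ⟦ f ⟧ ⟦ g ⟧ ⟦ h ⟧))
    }

  open IsCategory isCategory using (Iso)

  wireIso : (X Y : Conduct ℓ) (φ : vertices X ↔ vertices Y) → wire φ ∈ graphs (X ⊸ Y) →
            wire (↔-sym φ) ∈ graphs (Y ⊸ X) → Iso X Y
  wireIso X Y φ φ∈ φ⁻¹∈ = record
    { to   = hom (wire φ) φ∈
    ; from = hom (wire (↔-sym φ)) φ⁻¹∈
    ; isoˡ = coherence (homˢ Y X (↔-sym φ) φ⁻¹∈ ∘ˢ homˢ X Y φ φ∈) (ιˢ X) (Inverse.strictlyInverseʳ φ)
    ; isoʳ = coherence (homˢ X Y φ φ∈ ∘ˢ homˢ Y X (↔-sym φ) φ⁻¹∈) (ιˢ Y) (Inverse.strictlyInverseˡ φ)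
    }

  -- The symmetric monoidal structure.

  module _ (X Y Z : Conduct ℓ) where
    α↔ : ((vertices X ⊎ vertices Y) ⊎ vertices Z) ↔ (vertices X ⊎ (vertices Y ⊎ vertices Z))
    α↔ = ⊎-assoc ℓ (vertices X) (vertices Y) (vertices Z)

    α-∈ : wire α↔ ∈ graphs ((X ⊗ Y) ⊗ Z ⊸ X ⊗ (Y ⊗ Z))
    α-∈ = wire-∈-⊗ (X ⊗ Y) Z (X ⊗ (Y ⊗ Z)) α↔ λ {u} {c} → ⊗-assocʳ-∈ X Y Z {u} {c}

    α⁻¹-∈ : wire (↔-sym α↔) ∈ graphs (X ⊗ (Y ⊗ Z) ⊸ (X ⊗ Y) ⊗ Z)
    α⁻¹-∈ = wire-∈-⊗ X (Y ⊗ Z) ((X ⊗ Y) ⊗ Z) (↔-sym α↔) λ {a} {v} → ⊗-assocˡ-∈ X Y Z {a} {v}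

    associator : Iso ((X ⊗ Y) ⊗ Z) (X ⊗ (Y ⊗ Z))
    associator = wireIso ((X ⊗ Y) ⊗ Z) (X ⊗ (Y ⊗ Z)) α↔ α-∈ α⁻¹-∈

    αˢ : Structural (Iso.to associator)
    αˢ = homˢ ((X ⊗ Y) ⊗ Z) (X ⊗ (Y ⊗ Z)) α↔ α-∈

  module _ (X : Conduct ℓ) where
    lam-∈ : wire ⊥⊎↔ ∈ graphs (unit ⊗ X ⊸ X)
    lam-∈ = wire-∈-⊗ unit X X ⊥⊎↔ λ {u} {x} _ x∈ → ∈-resp-≅ X (⊗-unitˡ u x) x∈

    unitorˡ : Iso (unit ⊗ X) X
    unitorˡ = wireIso (unit ⊗ X) X ⊥⊎↔ lam-∈
      (wire-∈ X (unit ⊗ X) (↔-sym ⊥⊎↔) λ {x} x∈ → ∈-resp-≅ (unit ⊗ X) (∅-⊗ˡ x) (⊗-∈ unit X {∅ᴳ} {x} ttₗ x∈))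

    lamˢ : Structural (Iso.to unitorˡ)
    lamˢ = homˢ (unit ⊗ X) X ⊥⊎↔ lam-∈

    rho-∈ : wire ⊎⊥↔ ∈ graphs (X ⊗ unit ⊸ X)
    rho-∈ = wire-∈-⊗ X unit X ⊎⊥↔ λ {x} {u} x∈ _ → ∈-resp-≅ X (⊗-unitʳ x u) x∈

    unitorʳ : Iso (X ⊗ unit) X
    unitorʳ = wireIso (X ⊗ unit) X ⊎⊥↔ rho-∈
      (wire-∈ X (X ⊗ unit) (↔-sym ⊎⊥↔) λ {x} x∈ → ∈-resp-≅ (X ⊗ unit) (≅-sym (⊗-∅ x)) (⊗-∈ X unit {x} {∅ᴳ} x∈ ttₗ))

    rhoˢ : Structural (Iso.to unitorʳ)
    rhoˢ = homˢ (X ⊗ unit) X ⊎⊥↔ rho-∈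

  module _ (X Y : Conduct ℓ) where
    σ↔ : (vertices X ⊎ vertices Y) ↔ (vertices Y ⊎ vertices X)
    σ↔ = ⊎-comm (vertices X) (vertices Y)

    σ-∈ : wire σ↔ ∈ graphs (X ⊗ Y ⊸ Y ⊗ X)
    σ-∈ = wire-∈-⊗ X Y (Y ⊗ X) σ↔ λ {x} {y} x∈ y∈ → ∈-resp-≅ (Y ⊗ X) (≅-sym (⊗-comm x y)) (⊗-∈ Y X y∈ x∈)

    σ : Hom (X ⊗ Y) (Y ⊗ X)
    σ = hom (wire σ↔) σ-∈

    σˢ : Structural σ
    σˢ = homˢ (X ⊗ Y) (Y ⊗ X) σ↔ σ-∈

  isSymmetricMonoidal : IsSymmetricMonoidal raw
  isSymmetricMonoidal = record
    { isCategory = isCategory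
    ; ⊗-cong = λ {_} {_} {_} {_} {f} {g} {f′} {g′} i j → ≅-trans (⊗-via {F′ = ⟦ g ⟧} {⟦ g′ ⟧} i j) (≅-sym (⊗-≅ g g′))
    ; ⊗-id = λ {A} {B} → coherence (ιˢ A ⊗ˢ ιˢ B) (ιˢ (A ⊗ B)) map-id
    ; ⊗-∘ = λ g f g′ f′ → along
        (⊗-via {F′ = ⟦ f ⟧ ∷∷ ⟦ g ⟧} {⟦ f′ ⟧ ∷∷ ⟦ g′ ⟧} (∘-≅ g f) (∘-≅ g′ f′))
        (∘-via {G′ = ⟦ g ⟧ ⊠ ⟦ g′ ⟧} {⟦ f ⟧ ⊠ ⟦ f′ ⟧} (⊗-≅ g g′) (⊗-≅ f f′))
        (∷∷-⊠ ⟦ f ⟧ ⟦ g ⟧ ⟦ f′ ⟧ ⟦ g′ ⟧)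
    ; unit = unit
    ; associator = associator
    ; unitorˡ = unitorˡ
    ; unitorʳ = unitorʳ
    ; σ = λ {A} {B} → σ A B
    ; α-natural = λ {A} {B} {C} {A′} {B′} {C′} f g h → along
        (postcompose {F′ = (⟦ f ⟧ ⊠ ⟦ g ⟧) ⊠ ⟦ h ⟧} (αˢ A′ B′ C′) (⊗-via {F′ = ⟦ f ⟧ ⊠ ⟦ g ⟧} {⟦ h ⟧} (⊗-≅ f g) ≅-refl))
        (precompose {G′ = ⟦ f ⟧ ⊠ (⟦ g ⟧ ⊠ ⟦ h ⟧)} (⊗-via {F′ = ⟦ f ⟧} {⟦ g ⟧ ⊠ ⟦ h ⟧} ≅-refl (⊗-≅ g h)) (αˢ A B C))
        (⊗-assoc-natural ⟦ f ⟧ ⟦ g ⟧ ⟦ h ⟧)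
    ; lam-natural = λ {A} {A′} f → along
        (postcompose {F′ = wire (id↔ unit) ⊠ ⟦ f ⟧} (lamˢ A′) (⊗-via {F′ = wire (id↔ unit)} {⟦ f ⟧} (is-wire (ιˢ unit)) ≅-refl))
        (precompose {G′ = ⟦ f ⟧} ≅-refl (lamˢ A)) (⊗-unitˡ-natural ⟦ f ⟧)
    ; rho-natural = λ {A} {A′} f → along
        (postcompose {F′ = ⟦ f ⟧ ⊠ wire (id↔ unit)} (rhoˢ A′) (⊗-via {F′ = ⟦ f ⟧} {wire (id↔ unit)} ≅-refl (is-wire (ιˢ unit))))
        (precompose {G′ = ⟦ f ⟧} ≅-refl (rhoˢ A)) (⊗-unitʳ-natural ⟦ f ⟧)
    ; σ-natural = λ {A} {B} {A′} {B′} f g → along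
        (postcompose {F′ = ⟦ f ⟧ ⊠ ⟦ g ⟧} (σˢ A′ B′) (⊗-≅ f g))
        (precompose {G′ = ⟦ g ⟧ ⊠ ⟦ f ⟧} (⊗-≅ g f) (σˢ A B)) (⊗-comm-natural ⟦ f ⟧ ⟦ g ⟧)
    ; pentagon = λ {A} {B} {C} {D} → coherence
        ((ιˢ A ⊗ˢ αˢ B C D) ∘ˢ (αˢ A (B ⊗ C) D ∘ˢ (αˢ A B C ⊗ˢ ιˢ D))) (αˢ A B (C ⊗ D) ∘ˢ αˢ (A ⊗ B) C D)
        λ { (inj₁ (inj₁ (inj₁ _))) → refl ; (inj₁ (inj₁ (inj₂ _))) → refl ; (inj₁ (inj₂ _)) → refl ; (inj₂ _) → refl }
    ; triangle = λ {A} {B} → coherence ((ιˢ A ⊗ˢ lamˢ B) ∘ˢ αˢ A unit B) (rhoˢ A ⊗ˢ ιˢ B)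
        λ { (inj₁ (inj₁ _)) → refl ; (inj₁ (inj₂ ())) ; (inj₂ _) → refl }
    ; hexagon = λ {A} {B} {C} → coherence
        ((ιˢ B ⊗ˢ σˢ A C) ∘ˢ (αˢ B A C ∘ˢ (σˢ A B ⊗ˢ ιˢ C))) (αˢ B C A ∘ˢ (σˢ A (B ⊗ C) ∘ˢ αˢ A B C))
        λ { (inj₁ (inj₁ _)) → refl ; (inj₁ (inj₂ _)) → refl ; (inj₂ _) → refl }
    ; σ-involutive = λ {A} {B} → coherence (σˢ B A ∘ˢ σˢ A B) (ιˢ (A ⊗ B)) swap-involutive
    }

  -- Currying, transposition and star-autonomy.

  module _ (X Y Z : Conduct ℓ) where
    curry : Hom (X ⊗ Y) (Z ^⟂ᶜ) → Hom X ((Y ⊗ Z) ^⟂ᶜ)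
    curry F = hom (rename Sum.assocʳ ⟦ F ⟧) (curry-∈ X Y Z {⟦ F ⟧} (⟦⟧-∈ F))

    uncurry : Hom X ((Y ⊗ Z) ^⟂ᶜ) → Hom (X ⊗ Y) (Z ^⟂ᶜ)
    uncurry F = hom (rename Sum.assocˡ ⟦ F ⟧) (uncurry-∈ X Y Z {⟦ F ⟧} (⟦⟧-∈ F))

    curry-via : {F : Hom (X ⊗ Y) (Z ^⟂ᶜ)} {F′ : CohGraph ((vertices X ⊎ vertices Y) ⊎ vertices Z)} →
                ⟦ F ⟧ ≅ F′ → ⟦ curry F ⟧ ≅ rename Sum.assocʳ F′
    curry-via {F} {F′} i =
      ≅-trans (hom-≅ (rename Sum.assocʳ ⟦ F ⟧) (curry-∈ X Y Z {⟦ F ⟧} (⟦⟧-∈ F))) (rename-cong Sum.assocʳ {⟦ F ⟧} {F′} i)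

    uncurry-≅ : (F : Hom X ((Y ⊗ Z) ^⟂ᶜ)) → ⟦ uncurry F ⟧ ≅ rename Sum.assocˡ ⟦ F ⟧
    uncurry-≅ F = hom-≅ (rename Sum.assocˡ ⟦ F ⟧) (uncurry-∈ X Y Z {⟦ F ⟧} (⟦⟧-∈ F))

    curry-injective : {F G : Hom (X ⊗ Y) (Z ^⟂ᶜ)} → ⟦ curry F ⟧ ≅ ⟦ curry G ⟧ → ⟦ F ⟧ ≅ ⟦ G ⟧
    curry-injective {F} {G} i = ≅-trans (≅-sym (cancel ⟦ F ⟧)) (≅-trans
      (rename-cong Sum.assocˡ {rename Sum.assocʳ ⟦ F ⟧} {rename Sum.assocʳ ⟦ G ⟧}
        (≅-trans (≅-sym (curry-via {F} {⟦ F ⟧} ≅-refl)) (≅-trans i (curry-via {G} {⟦ G ⟧} ≅-refl)))) (cancel ⟦ G ⟧))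
      where
      cancel : (F : CohGraph ((vertices X ⊎ vertices Y) ⊎ vertices Z)) →
               rename Sum.assocˡ (rename Sum.assocʳ F) ≅ F
      cancel F = rename-inverse Sum.assocʳ Sum.assocˡ F (Inverse.strictlyInverseʳ (α↔ X Y Z))

    curry-uncurry : (F : Hom X ((Y ⊗ Z) ^⟂ᶜ)) {G : Hom (X ⊗ Y) (Z ^⟂ᶜ)} → ⟦ G ⟧ ≅ ⟦ uncurry F ⟧ →
                    ⟦ curry G ⟧ ≅ ⟦ F ⟧
    curry-uncurry F {G} i = ≅-trans (curry-via {G} {rename Sum.assocˡ ⟦ F ⟧} (≅-trans i (uncurry-≅ F)))
      (rename-inverse Sum.assocˡ Sum.assocʳ ⟦ F ⟧ (Inverse.strictlyInverseˡ (α↔ X Y Z)))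

  swap-cancel : {V W : Set ℓ} (F : CohGraph (V ⊎ W)) → rename Sum.swap (rename Sum.swap F) ≅ F
  swap-cancel F = rename-inverse Sum.swap Sum.swap F swap-involutive

  untranspose : (X Y : Conduct ℓ) → Hom (Y ^⟂ᶜ) (X ^⟂ᶜ) → Hom X Y
  untranspose X Y F = hom (rename Sum.swap ⟦ F ⟧) (transpose-∈⁻ X Y {⟦ F ⟧} (⟦⟧-∈ F))

  untranspose-≅ : (X Y : Conduct ℓ) (F : Hom (Y ^⟂ᶜ) (X ^⟂ᶜ)) → ⟦ untranspose X Y F ⟧ ≅ rename Sum.swap ⟦ F ⟧
  untranspose-≅ X Y F = hom-≅ (rename Sum.swap ⟦ F ⟧) (transpose-∈⁻ X Y {⟦ F ⟧} (⟦⟧-∈ F))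

  adj-natural : {A B C A′ B′ C′ : Conduct ℓ} (f : Hom A′ A) (g : Hom B′ B) (h : Hom C′ C)
                (k : Hom (A ⊗ B) (C ^⟂ᶜ)) →
                ⟦ curry A′ B′ C′ ((h *₁) ∘ (k ∘ (f ⊗₁ g))) ⟧ ≅ ⟦ ((g ⊗₁ h) *₁) ∘ (curry A B C k ∘ f) ⟧
  adj-natural {A} {B} {C} {A′} {B′} {C′} f g h k = ≅-trans
    (curry-via A′ B′ C′ {(h *₁) ∘ (k ∘ (f ⊗₁ g))} {⟦ (h *₁) ∘ (k ∘ (f ⊗₁ g)) ⟧} ≅-refl)
    (bend-natural-via ⟦ f ⟧ ⟦ g ⟧ ⟦ h ⟧ ⟦ k ⟧
      {⟦ f ⊗₁ g ⟧} {⟦ k ∘ (f ⊗₁ g) ⟧} {⟦ h *₁ ⟧} {⟦ (h *₁) ∘ (k ∘ (f ⊗₁ g)) ⟧} {⟦ g ⊗₁ h ⟧} {⟦ (g ⊗₁ h) *₁ ⟧}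
      {⟦ curry A B C k ⟧} {⟦ curry A B C k ∘ f ⟧} {⟦ ((g ⊗₁ h) *₁) ∘ (curry A B C k ∘ f) ⟧}
      (⊗-≅ f g) (∘-≅ k (f ⊗₁ g)) (*-≅ h) (∘-≅ (h *₁) (k ∘ (f ⊗₁ g))) (⊗-≅ g h) (*-≅ (g ⊗₁ h))
      (curry-via A B C {k} {⟦ k ⟧} ≅-refl) (∘-≅ (curry A B C k) f) (∘-≅ ((g ⊗₁ h) *₁) (curry A B C k ∘ f)))

  isStarAutonomous : IsStarAutonomous raw
  isStarAutonomous = record
    { isSymmetricMonoidal = isSymmetricMonoidal
    ; *-cong = λ {_} {_} {f} {g} i → ≅-trans (*-via {F′ = ⟦ g ⟧} i) (≅-sym (*-≅ g))
    ; *-id = λ {A} → coherence (ιˢ A *ˢ) (ιˢ (A ^⟂ᶜ)) (λ _ → refl)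
    ; *-∘ = λ g f → along
        (*-via {F′ = ⟦ f ⟧ ∷∷ ⟦ g ⟧} (∘-≅ g f))
        (∘-via {G′ = rename Sum.swap ⟦ f ⟧} {rename Sum.swap ⟦ g ⟧} (*-≅ f) (*-≅ g))
        (∷∷-swap ⟦ f ⟧ ⟦ g ⟧)
    ; *-bijective = λ {A} {B} →
        (λ {f} {g} i → ≅-trans (≅-sym (swap-cancel ⟦ f ⟧)) (≅-trans
          (rename-cong Sum.swap {rename Sum.swap ⟦ f ⟧} {rename Sum.swap ⟦ g ⟧} (≅-trans (≅-sym (*-≅ f)) (≅-trans i (*-≅ g))))
          (swap-cancel ⟦ g ⟧))) ,
        λ F → untranspose A B F , λ {z} i →
          ≅-trans (*-via {F = z} {rename Sum.swap ⟦ F ⟧} (≅-trans i (untranspose-≅ A B F))) (swap-cancel ⟦ F ⟧)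
    ; adj = λ {A} {B} {C} → curry A B C
    ; adj-cong = λ {A} {B} {C} {f} {g} i → ≅-trans (curry-via A B C {f} {⟦ g ⟧} i) (≅-sym (curry-via A B C {g} {⟦ g ⟧} ≅-refl))
    ; adj-bijective = λ {A} {B} {C} → (λ {f} {g} → curry-injective A B C {f} {g}) ,
        λ F → uncurry A B C F , λ {z} → curry-uncurry A B C F {z}
    ; adj-natural = adj-natural
    }

theorem31 : ∀ {ℓ} → Σ[ wd ∈ WellDefined ℓ ] IsStarAutonomous (conducts wd)
theorem31 {ℓ} = wellDefined , Laws.isStarAutonomous Morphism proj₁ proj₂ _,_ (λ _ _ → ≅-refl)
  (λ {A} {B} {C} → C._∘_ {A} {B} {C}) (λ {A} {B} {A′} {B′} → C._⊗₁_ {A} {B} {A′} {B′}) (λ {A} {B} → C._*₁ {A} {B})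
  -- The operations of `conducts` are the operations on graphs by definition, so the comparison
  -- isomorphisms are identities.
  (λ _ _ → ≅-refl) (λ _ _ → ≅-refl) (λ _ → ≅-refl)
  where module C = RawStarCategory (conducts (wellDefined {ℓ}))
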